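{- Let $p\ge 3$ be any prime. Then for all nonnegative integers $n$ and $\alpha$ the following hold. (1) If $n$ is not a triangular number (i.e. not of the form $k(k+1)/2$ with $k\ge0$ an integer), then $$v_0(p^{2\alpha}\, 9^{2}(32n+4))\equiv 0\pmod{27}.$$ (2) For every $i\in\{1,2,3,\ldots,p-1\}$, $$v_0(p^{2\alpha+1}\, 9^{2}(32pn+32i+4p))\equiv 0\pmod{27}.$$ (3) For every integer $j\ge 0$ such that $8j+1$ is a quadratic nonresidue modulo $p$, $$v_0(p^{2\alpha}\, 9^{2}(32pn+32j+4))\equiv 0\pmod{27}.$$
   Context: The integer sequence $v_0(n)$, $n\ge 0$, is defined by the generating function (formal power series in $q$) $$\sum_{n=0}^\infty v_0(n)q^n=\sum_{n=0}^\infty \frac{q^{n^2}(-q;q^2)_n}{(q;q^2)_n},$$ where $(a;q)_0=1$ and $(a;q)_n=\prod_{i=1}^n(1-aq^{i-1})$ for $n\ge1$, so that $(-q;q^2)_n=\prod_{i=1}^n(1+q^{2i-1})$ and $(q;q^2)_n=\prod_{i=1}^n(1-q^{2i-1})$. -}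

module Defs where

open import Data.Bool.Base using (if_then_else_)
open import Data.Fin.Base using (toℕ)
open import Data.Integer.Base using (ℤ; +_; 0ℤ; 1ℤ; _+_; _-_; _*_; -_)
open import Data.Integer.Divisibility using (_∣_)
open import Data.Integer.Properties
  using (+-0-commutativeMonoid; *-identityʳ; +-identityʳ)
open import Data.Integer.Tactic.RingSolver using (solve-∀)
open import Data.Nat.Base as ℕ using (ℕ; zero; suc; _∸_; _≡ᵇ_; _/_)
open import Data.Nat.Coprimality using (Coprime)
open import Data.Product.Base using (∃; _×_)
open import Relation.Binary.PropositionalEquality
open import Relation.Nullary.Negation using (¬_)

open import Algebra.Properties.CommutativeMonoid.Sum +-0-commutativeMonoid
  using () renaming (sum to Σℤ)

-- f : Series stands for Σₙ (f n) qⁿ in ℤ[[q]].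
Series : Set
Series = ℕ → ℤ

q^_ : ℕ → Series
(q^ k) n = if k ≡ᵇ n then 1ℤ else 0ℤ

infixl 6 _⊖_
infixl 7 _⊛_ _⊘_
infix  8 ⊝_
infixr 9 _⊛^_ q^_

⊝_ : Series → Series
(⊝ f) n = - f n

_⊖_ : Series → Series → Series
(f ⊖ g) n = f n - g n

_⊛_ : Series → Series → Series
(f ⊛ g) n = Σℤ {suc n} λ k → f (toℕ k) * g (n ∸ toℕ k)

_⊛^_ : Series → ℕ → Series
f ⊛^ zero  = q^ 0
f ⊛^ suc n = (f ⊛^ n) ⊛ f

-- Long division; f ⊘ g is the quotient f / g only when g 0 ≡ 1ℤ,
-- see ⊘-correct.
_⊘_ : Series → Series → Series
(f ⊘ g) zero    = f 0
(f ⊘ g) (suc n) = ((λ m → f (suc m) - f 0 * g (suc m)) ⊘ g) n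

⊘-correct : ∀ f g → g 0 ≡ 1ℤ → (f ⊘ g) ⊛ g ≗ f
⊘-correct f g g₀≡1 zero = begin
  f 0 * g 0 + 0ℤ  ≡⟨ +-identityʳ _ ⟩
  f 0 * g 0       ≡⟨ cong (f 0 *_) g₀≡1 ⟩
  f 0 * 1ℤ        ≡⟨ *-identityʳ _ ⟩
  f 0             ∎
  where open ≡-Reasoning
⊘-correct f g g₀≡1 (suc n) = begin
  f 0 * g (suc n) + ((f′ ⊘ g) ⊛ g) n             ≡⟨ cong (λ x → f 0 * g (suc n) + x) (⊘-correct f′ g g₀≡1 n) ⟩
  f 0 * g (suc n) + (f (suc n) - f 0 * g (suc n)) ≡⟨ cancel (f 0 * g (suc n)) (f (suc n)) ⟩
  f (suc n)                                       ∎
  where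
  open ≡-Reasoning
  f′ : Series
  f′ m = f (suc m) - f 0 * g (suc m)
  cancel : ∀ x y → x + (y - x) ≡ y
  cancel = solve-∀

-- (a ; b)ₙ = ∏_{i=1}^{n} (1 - a b^{i-1})
pochhammer : Series → Series → ℕ → Series
pochhammer a b zero    = q^ 0
pochhammer a b (suc n) = pochhammer a b n ⊛ (q^ 0 ⊖ a ⊛ b ⊛^ n)

-- Σ_{m≥0} F m.  The truncation at m ≤ n is legitimate only when F m ∈ (qᵐ)
-- for every m, so that later terms do not contribute to qⁿ.
Σ∞ : (ℕ → Series) → Series
Σ∞ F n = Σℤ {suc n} λ m → F (toℕ m) n

-- The m-th term below is divisible by q^(m²), and its denominator has constant
-- coefficient 1, as Σ∞ and _⊘_ require.
v₀ : ℕ → ℤ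
v₀ = Σ∞ λ m →
  (q^ (m ℕ.* m) ⊛ pochhammer (⊝ q^ 1) (q^ 2) m) ⊘ pochhammer (q^ 1) (q^ 2) m

infix 4 _≡_[mod_]

_≡_[mod_] : ℤ → ℤ → ℕ → Set
a ≡ b [mod m ] = + m ∣ a - b

Triangular : ℕ → Set
Triangular n = ∃ λ k → n ≡ k ℕ.* (k ℕ.+ 1) / 2

QuadraticNonresidue : ℕ → ℕ → Set
QuadraticNonresidue a p =
  Coprime a p × ¬ (∃ λ (x : ℤ) → x * x ≡ + a [mod p ])

{-# OPTIONS --safe #-}

-- Write φ(q) = Σ q^{n²}, ψ(q) = Σ q^{n(n+1)/2}, c = (-q;q)∞.  With p = q² the m-th summand of Σ v₀(n) qⁿ
-- is ∏_{i≤m} (p^{2i-1} + x p^{i-1}) / (1 - x p^{i-1}) at x = q.  Let G_K be the sum at x = q^{2K+1}.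
-- A telescoping sum yields
--   (1 - x²) G_K = (1 + x²) G_{K+1} + x - x² .
-- Only the even part is needed; there the recurrence is homogeneous for 2 G_K - 1, and K → ∞ gives
--   2 Σ v₀(2n) qⁿ - 1 = φ(q) (-q;q²)∞ / (q;q²)∞ = φ(q)² / φ(-q²) .
-- The 2-dissections of φ, which follow from φ(q) φ(-q) = φ(-q²)², then lead to
--   2 Σ v₀(32n+4) qⁿ = 6 ψ + 1024 q ψ⁹ / φ(-q)⁸ = 6 ψ + 1024 q φ(-q) c²⁷ ,
-- since ψ = c³ φ(-q) by the triple product.  Modulo 27 one has c²⁷ ≡ c(q³)⁹, so that the 3-dissections
-- of ψ and φ(-q) show that the coefficients at 81n + 10 form a multiple of ψ.  Hence 27 divides
-- v₀(324 (8n+1)) unless n is triangular, i.e. unless 8n + 1 is a square; in all three parts the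
-- argument has this form with 8n + 1 replaced by a number that is not a square.
module Submission where

open import Defs
open import Data.Nat.Base using (ℕ; _+_; _*_; _^_; _≤_; _<_)
open import Data.Nat.Primality using (Prime)
open import Data.Integer.Base using (0ℤ)
open import Data.Product.Base using (_×_)
open import Relation.Nullary.Negation using (¬_)

open import Algebra.Bundles using (CommutativeRing)
import Algebra.Solver.Ring
open import Algebra.Solver.Ring.AlmostCommutativeRing
  using (fromCommutativeRing; _-Raw-AlmostCommutative⟶_)
open import Data.Fin.Base using (toℕ)
open import Data.Integer.Base as ℤ using (ℤ; 1ℤ; -1ℤ; +_)
open import Data.Integer.Divisibility.Signed using (divides; ∣⇒∣ᵤ)
import Data.Integer.Properties as ℤ
open import Data.Integer.Tactic.RingSolver using (solve-∀)
open import Data.Maybe.Base using (Maybe; just; nothing)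
open import Data.Nat.Base using (zero; suc; z≤n; s≤s; _∸_; NonZero; >-nonZero; >-nonZero⁻¹)
open import Data.Nat.Divisibility as ℕ using (_∣_; ∣⇒≤; ∣m+n∣m⇒∣n; m∣m*n)
open import Data.Nat.DivMod
  using (_%_; _/_; m≡m%n+[m/n]*n; m%n<n; [m+kn]%n≡m%n; m*n%n≡0; m<n⇒m%n≡m; m*n/n≡m)
open import Data.Nat.Primality using (euclidsLemma; prime⇒irreducible; prime⇒nonZero)
import Data.Nat.Properties as ℕ
open import Data.Nat.Tactic.RingSolver using () renaming (solve-∀ to solveℕ-∀)
open import Data.Product.Base using (∃; proj₁; proj₂; _,_)
open import Data.Sum.Base using (_⊎_; inj₁; inj₂)
open import Relation.Binary.PropositionalEquality
import Relation.Binary.Reasoning.Setoid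
open import Relation.Nullary.Decidable using (yes; no)
open import Relation.Nullary.Negation using (contradiction)
open import Algebra.Properties.CommutativeMonoid.Sum ℤ.+-0-commutativeMonoid
  using () renaming (sum to Σℤ)

-- Everything takes place in ℤ[[q]]: x is a power of q rather than a second variable, so that K → ∞
-- plays the part of x → 0, where the m-th summand becomes q^(2m²). Negative powers of q never
-- occur, thanks to `ρ` in the telescoping sum and to a variable y with xy = Q in the triple
-- product. Even parts are taken because x is an odd power of q and drops out of x - x²; what is
-- left has the constant solution 1/2, which explains 2 G_K - 1. An extraction from a quotient
-- requires a denominator in q². Multiplication by φ(q) or φ(q²) supplies it, and the numerators
-- collapse by φ(q)⁴ - φ(-q)⁴ = 16 q ψ(q²)⁴. The obstacle modulo 27 is that the first 3-extraction
-- turns c(q³)⁹ into c⁹, which the Frobenius congruence determines only modulo 9; hence c³ is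
-- written exactly as c(q³) plus 3 times a series. The index 81n + 10 comes from 32 (81n + 10) + 4 =
-- 324 (8n + 1), the factor 2 before v₀ is invertible modulo 27, and p^(2α) ≡ 1 modulo 8 keeps
-- p^(2α) (8r + 1) in the form 8m + 1.

infix 4 _≋_
infixl 6 _⊕_
infixl 7 _⊗_
infix  8 ⊟_

-- A record rather than a bare pointwise equality, so that both series can be inferred from the type
-- of a proof.
record _≋_ (f g : Series) : Set where
  constructor coeffs
  field coeff : ∀ n → f n ≡ g n

open _≋_

-- Opacity keeps Agda from unfolding products while it infers series.
opaque
  _⊕_ _⊗_ : Series → Series → Series
  (f ⊕ g) n = f n ℤ.+ g n
  f ⊗ g = f ⊛ g

  ⊟_ tail : Series → Series
  ⊟ f = ⊝ f
  tail f n = f (suc n)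

  κ : ℤ → Series
  κ a zero    = a
  κ a (suc n) = 0ℤ

  X^ : ℕ → Series
  X^ k = q^ k

  𝟎 : Series
  𝟎 _ = 0ℤ

  ⊗-defn : ∀ f g → f ⊛ g ≋ f ⊗ g
  ⊗-defn f g .coeff _ = refl

  ⊟-defn : ∀ f → ⊝ f ≋ ⊟ f
  ⊟-defn f .coeff _ = refl

  X^-defn : ∀ k → q^ k ≋ X^ k
  X^-defn k .coeff _ = refl

  ⊕-coeff : ∀ f g n → (f ⊕ g) n ≡ f n ℤ.+ g n
  ⊕-coeff f g n = refl

  ⊟-coeff : ∀ f n → (⊟ f) n ≡ ℤ.- f n
  ⊟-coeff f n = refl

  tail-coeff : ∀ f n → tail f n ≡ f (suc n)
  tail-coeff f n = refl

  ⊗-zero : ∀ f g → (f ⊗ g) 0 ≡ f 0 ℤ.* g 0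
  ⊗-zero f g = ℤ.+-identityʳ _

  ⊗-suc : ∀ f g n → (f ⊗ g) (suc n) ≡ f 0 ℤ.* g (suc n) ℤ.+ (tail f ⊗ g) n
  ⊗-suc f g n = refl

  κ-zero : ∀ a → κ a 0 ≡ a
  κ-zero a = refl

  κ-suc : ∀ a n → κ a (suc n) ≡ 0ℤ
  κ-suc a n = refl

  𝟎-coeff : ∀ n → 𝟎 n ≡ 0ℤ
  𝟎-coeff n = refl

  X^0-coeff-zero : X^ 0 0 ≡ 1ℤ
  X^0-coeff-zero = refl

  X^0-coeff-suc : ∀ n → X^ 0 (suc n) ≡ 0ℤ
  X^0-coeff-suc n = refl

  X^suc-coeff-zero : ∀ k → X^ (suc k) 0 ≡ 0ℤ
  X^suc-coeff-zero k = refl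

  X^suc-coeff-suc : ∀ k n → X^ (suc k) (suc n) ≡ X^ k n
  X^suc-coeff-suc k n = refl

-- The commutative ring of formal power series

𝟏 : Series
𝟏 = X^ 0

≋-refl : ∀ {f} → f ≋ f
≋-refl .coeff n = refl

≋-sym : ∀ {f g} → f ≋ g → g ≋ f
≋-sym p .coeff n = sym (coeff p n)

≋-trans : ∀ {f g h} → f ≋ g → g ≋ h → f ≋ h
≋-trans p r .coeff n = trans (coeff p n) (coeff r n)

tail-cong : ∀ {f g} → f ≋ g → tail f ≋ tail g
tail-cong p .coeff n = trans (tail-coeff _ n) (trans (coeff p (suc n)) (sym (tail-coeff _ n)))

⊕-cong : ∀ {f f′ g g′} → f ≋ f′ → g ≋ g′ → f ⊕ g ≋ f′ ⊕ g′
⊕-cong p r .coeff n =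
  trans (⊕-coeff _ _ n) (trans (cong₂ ℤ._+_ (coeff p n) (coeff r n)) (sym (⊕-coeff _ _ n)))

⊟-cong : ∀ {f g} → f ≋ g → ⊟ f ≋ ⊟ g
⊟-cong p .coeff n = trans (⊟-coeff _ n) (trans (cong ℤ.-_ (coeff p n)) (sym (⊟-coeff _ n)))

private
  ⊗-cong-coeff : ∀ {f f′ g g′} → f ≋ f′ → g ≋ g′ → ∀ n → (f ⊗ g) n ≡ (f′ ⊗ g′) n
  ⊗-cong-coeff {f} {f′} {g} {g′} p r zero = begin
    (f ⊗ g) 0     ≡⟨ ⊗-zero f g ⟩
    f 0 ℤ.* g 0   ≡⟨ cong₂ ℤ._*_ (coeff p 0) (coeff r 0) ⟩
    f′ 0 ℤ.* g′ 0 ≡⟨ ⊗-zero f′ g′ ⟨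
    (f′ ⊗ g′) 0   ∎
    where open ≡-Reasoning
  ⊗-cong-coeff {f} {f′} {g} {g′} p r (suc n) = begin
    (f ⊗ g) (suc n)                             ≡⟨ ⊗-suc f g n ⟩
    f 0 ℤ.* g (suc n) ℤ.+ (tail f ⊗ g) n
      ≡⟨ cong₂ ℤ._+_ (cong₂ ℤ._*_ (coeff p 0) (coeff r (suc n)))
           (⊗-cong-coeff (tail-cong p) r n) ⟩
    f′ 0 ℤ.* g′ (suc n) ℤ.+ (tail f′ ⊗ g′) n    ≡⟨ ⊗-suc f′ g′ n ⟨
    (f′ ⊗ g′) (suc n)                           ∎
    where open ≡-Reasoning

⊗-cong : ∀ {f f′ g g′} → f ≋ f′ → g ≋ g′ → f ⊗ g ≋ f′ ⊗ g′
⊗-cong p r .coeff = ⊗-cong-coeff p r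

private
  opaque
    unfolding _⊗_

    -- Mirror image of `⊗-suc`: the last summand of the Cauchy product is split off instead of the
    -- first. Commutativity follows by playing the two recursions against each other.
    ⊗-sucʳ : ∀ f g n → (f ⊗ g) (suc n) ≡ (f ⊗ tail g) n ℤ.+ f (suc n) ℤ.* g 0
    ⊗-sucʳ f g zero    = lemma (f 0 ℤ.* g 1) (f 1 ℤ.* g 0)
      where
      lemma : ∀ x y → x ℤ.+ (y ℤ.+ 0ℤ) ≡ (x ℤ.+ 0ℤ) ℤ.+ y
      lemma = solve-∀
    ⊗-sucʳ f g (suc n) =
      trans (cong (ℤ._+_ (f 0 ℤ.* g (suc (suc n)))) (⊗-sucʳ (tail f) g n))
            (sym (ℤ.+-assoc (f 0 ℤ.* g (suc (suc n))) _ _))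

    ⊗-comm-coeff : ∀ f g n → (f ⊗ g) n ≡ (g ⊗ f) n
    ⊗-comm-coeff f g zero    = cong (ℤ._+ 0ℤ) (ℤ.*-comm (f 0) (g 0))
    ⊗-comm-coeff f g (suc n) = begin
      f 0 ℤ.* g (suc n) ℤ.+ (tail f ⊗ g) n ≡⟨ ℤ.+-comm (f 0 ℤ.* g (suc n)) _ ⟩
      (tail f ⊗ g) n ℤ.+ f 0 ℤ.* g (suc n) ≡⟨ cong₂ ℤ._+_ (⊗-comm-coeff (tail f) g n) (ℤ.*-comm (f 0) _) ⟩
      (g ⊗ tail f) n ℤ.+ g (suc n) ℤ.* f 0 ≡⟨ ⊗-sucʳ g f n ⟨
      (g ⊗ f) (suc n)                      ∎
      where open ≡-Reasoning

    ⊗-distribʳ-coeff : ∀ h f g n → ((f ⊕ g) ⊗ h) n ≡ (f ⊗ h) n ℤ.+ (g ⊗ h) n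
    ⊗-distribʳ-coeff h f g zero    = lemma (f 0) (g 0) (h 0)
      where
      lemma : ∀ x y z → (x ℤ.+ y) ℤ.* z ℤ.+ 0ℤ ≡ (x ℤ.* z ℤ.+ 0ℤ) ℤ.+ (y ℤ.* z ℤ.+ 0ℤ)
      lemma = solve-∀
    ⊗-distribʳ-coeff h f g (suc n) =
      trans (cong (ℤ._+_ ((f 0 ℤ.+ g 0) ℤ.* h (suc n))) (⊗-distribʳ-coeff h (tail f) (tail g) n))
            (lemma (f 0) (g 0) (h (suc n)) _ _)
      where
      lemma : ∀ x y z u v → (x ℤ.+ y) ℤ.* z ℤ.+ (u ℤ.+ v) ≡ (x ℤ.* z ℤ.+ u) ℤ.+ (y ℤ.* z ℤ.+ v)
      lemma = solve-∀

    -- With this, the tail of `f ⊗ g` is `scale (f 0) (tail g) ⊕ tail f ⊗ g` by computation, which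
    -- drives the induction for associativity.
    scale : ℤ → Series → Series
    scale a f n = a ℤ.* f n

    scale-⊗-assoc : ∀ a f g n → (scale a f ⊗ g) n ≡ a ℤ.* (f ⊗ g) n
    scale-⊗-assoc a f g zero    = lemma a (f 0) (g 0)
      where
      lemma : ∀ x y z → (x ℤ.* y) ℤ.* z ℤ.+ 0ℤ ≡ x ℤ.* (y ℤ.* z ℤ.+ 0ℤ)
      lemma = solve-∀
    scale-⊗-assoc a f g (suc n) =
      trans (cong (ℤ._+_ ((a ℤ.* f 0) ℤ.* g (suc n))) (scale-⊗-assoc a (tail f) g n))
            (lemma a (f 0) (g (suc n)) _)
      where
      lemma : ∀ x y z u → (x ℤ.* y) ℤ.* z ℤ.+ x ℤ.* u ≡ x ℤ.* (y ℤ.* z ℤ.+ u)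
      lemma = solve-∀

    ⊗-assoc-coeff : ∀ f g h n → ((f ⊗ g) ⊗ h) n ≡ (f ⊗ (g ⊗ h)) n
    ⊗-assoc-coeff f g h zero    = lemma (f 0) (g 0) (h 0)
      where
      lemma : ∀ x y z → (x ℤ.* y ℤ.+ 0ℤ) ℤ.* z ℤ.+ 0ℤ ≡ x ℤ.* (y ℤ.* z ℤ.+ 0ℤ) ℤ.+ 0ℤ
      lemma = solve-∀
    ⊗-assoc-coeff f g h (suc n) = begin
      (f 0 ℤ.* g 0 ℤ.+ 0ℤ) ℤ.* h (suc n) ℤ.+ ((scale (f 0) (tail g) ⊕ tail f ⊗ g) ⊗ h) n
        ≡⟨ cong (ℤ._+_ ((f 0 ℤ.* g 0 ℤ.+ 0ℤ) ℤ.* h (suc n)))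
             (trans (⊗-distribʳ-coeff h (scale (f 0) (tail g)) (tail f ⊗ g) n)
               (cong₂ ℤ._+_ (scale-⊗-assoc (f 0) (tail g) h n) (⊗-assoc-coeff (tail f) g h n))) ⟩
      (f 0 ℤ.* g 0 ℤ.+ 0ℤ) ℤ.* h (suc n) ℤ.+ (f 0 ℤ.* (tail g ⊗ h) n ℤ.+ (tail f ⊗ (g ⊗ h)) n)
        ≡⟨ lemma (f 0) (g 0) (h (suc n)) _ _ ⟩
      f 0 ℤ.* (g 0 ℤ.* h (suc n) ℤ.+ (tail g ⊗ h) n) ℤ.+ (tail f ⊗ (g ⊗ h)) n ∎
      where
      open ≡-Reasoning
      lemma : ∀ x y z u v → (x ℤ.* y ℤ.+ 0ℤ) ℤ.* z ℤ.+ (x ℤ.* u ℤ.+ v) ≡ x ℤ.* (y ℤ.* z ℤ.+ u) ℤ.+ v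
      lemma = solve-∀

    𝟎-⊗-coeff : ∀ f n → (𝟎 ⊗ f) n ≡ 0ℤ
    𝟎-⊗-coeff f zero    = refl
    𝟎-⊗-coeff f (suc n) = trans (ℤ.+-identityˡ _) (𝟎-⊗-coeff f n)

    κ-⊗-coeff : ∀ a f n → (κ a ⊗ f) n ≡ a ℤ.* f n
    κ-⊗-coeff a f zero    = ℤ.+-identityʳ _
    κ-⊗-coeff a f (suc n) =
      trans (cong (ℤ._+_ (a ℤ.* f (suc n))) (𝟎-⊗-coeff f n)) (ℤ.+-identityʳ _)

    κ-+ : ∀ a b n → κ (a ℤ.+ b) n ≡ (κ a ⊕ κ b) n
    κ-+ a b zero    = refl
    κ-+ a b (suc n) = refl

    κ-neg : ∀ a n → κ (ℤ.- a) n ≡ (⊟ κ a) n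
    κ-neg a zero    = refl
    κ-neg a (suc n) = refl

    κ-0 : ∀ n → κ 0ℤ n ≡ 𝟎 n
    κ-0 zero    = refl
    κ-0 (suc n) = refl

    κ-1-coeff : ∀ n → κ 1ℤ n ≡ 𝟏 n
    κ-1-coeff zero    = refl
    κ-1-coeff (suc n) = refl

κ-coeff : ∀ a f n → (κ a ⊗ f) n ≡ a ℤ.* f n
κ-coeff = κ-⊗-coeff

κ-1 : κ 1ℤ ≋ 𝟏
κ-1 = coeffs κ-1-coeff

⊗-comm : ∀ f g → f ⊗ g ≋ g ⊗ f
⊗-comm f g = coeffs (⊗-comm-coeff f g)

⊗-assoc : ∀ f g h → (f ⊗ g) ⊗ h ≋ f ⊗ (g ⊗ h)
⊗-assoc f g h = coeffs (⊗-assoc-coeff f g h)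

⊗-distribʳ : ∀ h f g → (f ⊕ g) ⊗ h ≋ f ⊗ h ⊕ g ⊗ h
⊗-distribʳ h f g = coeffs λ n → trans (⊗-distribʳ-coeff h f g n) (sym (⊕-coeff _ _ n))

⊗-identityˡ : ∀ f → 𝟏 ⊗ f ≋ f
⊗-identityˡ f = ≋-trans (⊗-cong (≋-sym κ-1) ≋-refl)
                  (coeffs λ n → trans (κ-coeff 1ℤ f n) (ℤ.*-identityˡ (f n)))

seriesRing : CommutativeRing _ _
seriesRing = record
  { Carrier = Series ; _≈_ = _≋_ ; _+_ = _⊕_ ; _*_ = _⊗_ ; -_ = ⊟_ ; 0# = 𝟎 ; 1# = 𝟏
  ; isCommutativeRing = record
    { isRing = record
      { +-isAbelianGroup = record
        { isGroup = record
          { isMonoid = record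
            { isSemigroup = record
              { isMagma = record
                { isEquivalence = record { refl = ≋-refl ; sym = ≋-sym ; trans = ≋-trans }
                ; ∙-cong = ⊕-cong }
              ; assoc = λ f g h → coeffs (⊕-assoc f g h) }
            ; identity = (λ f → coeffs (⊕-identityˡ f)) , λ f → coeffs (⊕-identityʳ f) }
          ; inverse = (λ f → coeffs (⊕-inverseˡ f)) , λ f → coeffs (⊕-inverseʳ f)
          ; ⁻¹-cong = ⊟-cong }
        ; comm = λ f g → coeffs (⊕-comm f g) }
      ; *-cong = ⊗-cong
      ; *-assoc = ⊗-assoc
      ; *-identity = ⊗-identityˡ , (λ f → ≋-trans (⊗-comm f 𝟏) (⊗-identityˡ f))
      ; distrib = (λ h f g → ≋-trans (⊗-comm h (f ⊕ g))
                    (≋-trans (⊗-distribʳ h f g) (⊕-cong (⊗-comm f h) (⊗-comm g h))))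
                , ⊗-distribʳ
      }
    ; *-comm = ⊗-comm
    }
  }
  where
  opaque
    unfolding _⊕_
    ⊕-assoc : ∀ f g h n → (f ⊕ g ⊕ h) n ≡ (f ⊕ (g ⊕ h)) n
    ⊕-assoc f g h n = ℤ.+-assoc (f n) (g n) (h n)
    ⊕-comm : ∀ f g n → (f ⊕ g) n ≡ (g ⊕ f) n
    ⊕-comm f g n = ℤ.+-comm (f n) (g n)
    ⊕-identityˡ : ∀ f n → (𝟎 ⊕ f) n ≡ f n
    ⊕-identityˡ f n = ℤ.+-identityˡ (f n)
    ⊕-identityʳ : ∀ f n → (f ⊕ 𝟎) n ≡ f n
    ⊕-identityʳ f n = ℤ.+-identityʳ (f n)
    ⊕-inverseˡ : ∀ f n → (⊟ f ⊕ f) n ≡ 𝟎 n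
    ⊕-inverseˡ f n = ℤ.+-inverseˡ (f n)
    ⊕-inverseʳ : ∀ f n → (f ⊕ ⊟ f) n ≡ 𝟎 n
    ⊕-inverseʳ f n = ℤ.+-inverseʳ (f n)

κ-* : ∀ a b → κ (a ℤ.* b) ≋ κ a ⊗ κ b
κ-* a b .coeff zero    = trans (κ-zero _) (sym (trans (κ-coeff a (κ b) 0) (cong (a ℤ.*_) (κ-zero b))))
κ-* a b .coeff (suc n) = trans (κ-suc _ n)
  (sym (trans (κ-coeff a (κ b) (suc n)) (trans (cong (a ℤ.*_) (κ-suc b n)) (ℤ.*-zeroʳ a))))

κ-homomorphism : ℤ.+-*-rawRing -Raw-AlmostCommutative⟶ fromCommutativeRing seriesRing
κ-homomorphism = record
  { ⟦_⟧    = κ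
  ; +-homo = λ a b → coeffs (κ-+ a b)
  ; *-homo = κ-*
  ; -‿homo = λ a → coeffs (κ-neg a)
  ; 0-homo = coeffs κ-0
  ; 1-homo = κ-1
  }

_≟κ_ : ∀ a b → Maybe (κ a ≋ κ b)
a ≟κ b with a ℤ.≟ b
... | yes refl = just ≋-refl
... | no _     = nothing

-- Integer constants enter the solver through `κ`. Its constant one is therefore `κ 1ℤ`, which
-- equals `𝟏` only by a proof; this is the reason for the conversions by `κ-1` around many calls.
module SeriesSolver =
  Algebra.Solver.Ring ℤ.+-*-rawRing (fromCommutativeRing seriesRing) κ-homomorphism _≟κ_
open SeriesSolver using (solve; _:=_; _:+_; _:*_; _:-_; :-_; con)
module ≋-Reasoning = Relation.Binary.Reasoning.Setoid (CommutativeRing.setoid seriesRing)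

_³ : Series → Series
f ³ = f ⊗ f ⊗ f

open CommutativeRing seriesRing using ()
  renaming ( zeroˡ to ⊗-zeroˡ; zeroʳ to ⊗-zeroʳ; *-identityʳ to ⊗-identityʳ
           ; +-identityˡ to ⊕-identityˡ; +-identityʳ to ⊕-identityʳ )

private
  variable
    f f′ g g′ h m : Series

≡⇒≋ : f ≡ g → f ≋ g
≡⇒≋ refl = ≋-refl

κ-0≋𝟎 : κ 0ℤ ≋ 𝟎
κ-0≋𝟎 .coeff zero    = trans (κ-zero 0ℤ) (sym (𝟎-coeff 0))
κ-0≋𝟎 .coeff (suc n) = trans (κ-suc 0ℤ n) (sym (𝟎-coeff (suc n)))

-- Monomials and series with constant coefficient 1

tail-X^suc : ∀ k → tail (X^ (suc k)) ≋ X^ k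
tail-X^suc k .coeff n = trans (tail-coeff _ n) (X^suc-coeff-suc k n)

X^suc-⊗-zero : ∀ k f → (X^ (suc k) ⊗ f) 0 ≡ 0ℤ
X^suc-⊗-zero k f = trans (⊗-zero _ f) (cong (ℤ._* f 0) (X^suc-coeff-zero k))

X^suc-⊗-suc : ∀ k f n → (X^ (suc k) ⊗ f) (suc n) ≡ (X^ k ⊗ f) n
X^suc-⊗-suc k f n = begin
  (X^ (suc k) ⊗ f) (suc n)
    ≡⟨ ⊗-suc _ f n ⟩
  X^ (suc k) 0 ℤ.* f (suc n) ℤ.+ (tail (X^ (suc k)) ⊗ f) n
    ≡⟨ cong₂ ℤ._+_ (cong (ℤ._* f (suc n)) (X^suc-coeff-zero k)) (coeff (⊗-cong (tail-X^suc k) ≋-refl) n) ⟩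
  0ℤ ℤ.+ (X^ k ⊗ f) n
    ≡⟨ ℤ.+-identityˡ _ ⟩
  (X^ k ⊗ f) n ∎
  where open ≡-Reasoning

X^-⊗-coeff-+ : ∀ k f n → (X^ k ⊗ f) (k + n) ≡ f n
X^-⊗-coeff-+ zero    f n = coeff (⊗-identityˡ f) n
X^-⊗-coeff-+ (suc k) f n = trans (X^suc-⊗-suc k f (k + n)) (X^-⊗-coeff-+ k f n)

X^-⊗-coeff-< : ∀ {k n} f → n < k → (X^ k ⊗ f) n ≡ 0ℤ
X^-⊗-coeff-< {suc k} {zero}  f _         = X^suc-⊗-zero k f
X^-⊗-coeff-< {suc k} {suc n} f (s≤s n<k) = trans (X^suc-⊗-suc k f n) (X^-⊗-coeff-< f n<k)

X^-+ : ∀ a b → X^ a ⊗ X^ b ≋ X^ (a + b)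
X^-+ zero    b = ⊗-identityˡ (X^ b)
X^-+ (suc a) b .coeff zero    = trans (X^suc-⊗-zero a (X^ b)) (sym (X^suc-coeff-zero (a + b)))
X^-+ (suc a) b .coeff (suc n) =
  trans (X^suc-⊗-suc a (X^ b) n) (trans (coeff (X^-+ a b) n) (sym (X^suc-coeff-suc (a + b) n)))

X^-coeff-diag : ∀ k → X^ k k ≡ 1ℤ
X^-coeff-diag zero    = X^0-coeff-zero
X^-coeff-diag (suc k) = trans (X^suc-coeff-suc k k) (X^-coeff-diag k)

X^-coeff-off : ∀ k n → k ≢ n → X^ k n ≡ 0ℤ
X^-coeff-off zero    zero    k≢n = contradiction refl k≢n
X^-coeff-off zero    (suc n) _   = X^0-coeff-suc n
X^-coeff-off (suc k) zero    _   = X^suc-coeff-zero k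
X^-coeff-off (suc k) (suc n) k≢n = trans (X^suc-coeff-suc k n) (X^-coeff-off k n λ e → k≢n (cong suc e))

decompose : ∀ f → f ≋ κ (f 0) ⊕ X^ 1 ⊗ tail f
decompose f .coeff zero    = sym (trans (⊕-coeff _ _ 0)
  (trans (cong₂ ℤ._+_ (κ-zero (f 0)) (X^suc-⊗-zero 0 (tail f))) (ℤ.+-identityʳ _)))
decompose f .coeff (suc n) = sym (trans (⊕-coeff _ _ (suc n))
  (trans (cong₂ ℤ._+_ (κ-suc (f 0) n)
           (trans (X^suc-⊗-suc 0 (tail f) n) (trans (coeff (⊗-identityˡ (tail f)) n) (tail-coeff f n))))
         (ℤ.+-identityˡ _)))

recip : Series → Series
recip f = q^ 0 ⊘ f

⊘-⊗ : ∀ f → g 0 ≡ 1ℤ → (f ⊘ g) ⊗ g ≋ f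
⊘-⊗ {g} f g₀ = ≋-trans (≋-sym (⊗-defn (f ⊘ g) g)) (coeffs (⊘-correct f g g₀))

⊗-recip : f 0 ≡ 1ℤ → f ⊗ recip f ≋ 𝟏
⊗-recip {f} f₀ = ≋-trans (⊗-comm f _) (≋-trans (⊘-⊗ (q^ 0) f₀) (X^-defn 0))

-- Constant coefficient 1 makes `h` a unit. Identities between quotients formed by `_⊘_` are proved
-- by clearing such denominators.
⊗-cancelʳ : h 0 ≡ 1ℤ → f ⊗ h ≋ g ⊗ h → f ≋ g
⊗-cancelʳ {h} {f} {g} h₀ e = begin
  f                  ≈⟨ ⊗-identityʳ f ⟨
  f ⊗ 𝟏              ≈⟨ ⊗-cong ≋-refl (⊗-recip h₀) ⟨
  f ⊗ (h ⊗ recip h)  ≈⟨ ⊗-assoc f h (recip h) ⟨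
  f ⊗ h ⊗ recip h    ≈⟨ ⊗-cong e ≋-refl ⟩
  g ⊗ h ⊗ recip h    ≈⟨ ⊗-assoc g h (recip h) ⟩
  g ⊗ (h ⊗ recip h)  ≈⟨ ⊗-cong ≋-refl (⊗-recip h₀) ⟩
  g ⊗ 𝟏              ≈⟨ ⊗-identityʳ g ⟩
  g                  ∎
  where open ≋-Reasoning

⊗-coeff₀ : f 0 ≡ 1ℤ → g 0 ≡ 1ℤ → (f ⊗ g) 0 ≡ 1ℤ
⊗-coeff₀ {f} {g} f₀ g₀ = trans (⊗-zero f g) (cong₂ ℤ._*_ f₀ g₀)

-- Congruences modulo the ideal generated by a series

-- The modulus m is q^N, to compare series with truncations, or a constant.
infix 4 _≈_[_]

record _≈_[_] (f g m : Series) : Set where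
  constructor by
  field
    multiplier : Series
    equation   : f ≋ g ⊕ m ⊗ multiplier

≋⇒≈ : f ≋ g → f ≈ g [ m ]
≋⇒≈ {f} {g} {m} e = by 𝟎 (≋-trans e (≋-sym (≋-trans (⊕-cong ≋-refl (⊗-zeroʳ m)) (⊕-identityʳ g))))

≈-refl : f ≈ f [ m ]
≈-refl = ≋⇒≈ ≋-refl

≈-sym : f ≈ g [ m ] → g ≈ f [ m ]
≈-sym {f} {g} {m} (by k e) = by (⊟ k) (begin
  g                     ≈⟨ solve 3 (λ g m k → g := g :+ m :* k :+ m :* (:- k)) ≋-refl g m k ⟩
  g ⊕ m ⊗ k ⊕ m ⊗ ⊟ k   ≈⟨ ⊕-cong e ≋-refl ⟨
  f ⊕ m ⊗ ⊟ k           ∎)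
  where open ≋-Reasoning

≈-trans : f ≈ g [ m ] → g ≈ h [ m ] → f ≈ h [ m ]
≈-trans {f} {g} {m} {h} (by k e) (by l d) = by (l ⊕ k) (begin
  f                     ≈⟨ e ⟩
  g ⊕ m ⊗ k             ≈⟨ ⊕-cong d ≋-refl ⟩
  h ⊕ m ⊗ l ⊕ m ⊗ k     ≈⟨ solve 4 (λ h m l k → h :+ m :* l :+ m :* k := h :+ m :* (l :+ k)) ≋-refl h m l k ⟩
  h ⊕ m ⊗ (l ⊕ k)       ∎)
  where open ≋-Reasoning

≈-⊕ : f ≈ f′ [ m ] → g ≈ g′ [ m ] → f ⊕ g ≈ f′ ⊕ g′ [ m ]
≈-⊕ {f} {f′} {m} {g} {g′} (by k e) (by l d) = by (k ⊕ l) (≋-trans (⊕-cong e d)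
  (solve 5 (λ a b m k l → a :+ m :* k :+ (b :+ m :* l) := a :+ b :+ m :* (k :+ l)) ≋-refl f′ g′ m k l))

≈-⊗ : f ≈ f′ [ m ] → g ≈ g′ [ m ] → f ⊗ g ≈ f′ ⊗ g′ [ m ]
≈-⊗ {f} {f′} {m} {g} {g′} (by k e) (by l d) = by (f′ ⊗ l ⊕ k ⊗ g′ ⊕ m ⊗ k ⊗ l) (≋-trans (⊗-cong e d)
  (solve 5 (λ a b m k l → (a :+ m :* k) :* (b :+ m :* l) := a :* b :+ m :* (a :* l :+ k :* b :+ m :* k :* l)) ≋-refl f′ g′ m k l))

≈-scale : ∀ h → f ≈ g [ m ] → h ⊗ f ≈ h ⊗ g [ h ⊗ m ]
≈-scale {f} {g} {m} h (by k e) = by k (≋-trans (⊗-cong ≋-refl e)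
  (solve 4 (λ g m k h → h :* (g :+ m :* k) := h :* g :+ h :* m :* k) ≋-refl g m k h))

≈-weaken : ∀ {n} → m ≋ n ⊗ h → f ≈ g [ m ] → f ≈ g [ n ]
≈-weaken {m} {h} {f} {g} {n} d (by k e) = by (h ⊗ k) (≋-trans e
  (⊕-cong ≋-refl (≋-trans (⊗-cong d ≋-refl) (⊗-assoc n h k))))

≈𝟎-⊗ : ∀ {n} → f ≈ 𝟎 [ m ] → g ≈ 𝟎 [ n ] → f ⊗ g ≈ 𝟎 [ m ⊗ n ]
≈𝟎-⊗ {f} {m} {g} {n} (by k e) (by l d) = by (k ⊗ l) (begin
  f ⊗ g                         ≈⟨ ⊗-cong (≋-trans e (⊕-identityˡ _)) (≋-trans d (⊕-identityˡ _)) ⟩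
  m ⊗ k ⊗ (n ⊗ l)               ≈⟨ solve 4 (λ m n k l → m :* k :* (n :* l) := m :* n :* (k :* l)) ≋-refl m n k l ⟩
  m ⊗ n ⊗ (k ⊗ l)               ≈⟨ ⊕-identityˡ _ ⟨
  𝟎 ⊕ m ⊗ n ⊗ (k ⊗ l)           ∎)
  where open ≋-Reasoning

≈𝟎-⊗ˡ : f ≈ 𝟎 [ m ] → f ⊗ g ≈ 𝟎 [ m ]
≈𝟎-⊗ˡ {f} {m} {g} e = ≈-trans (≈-⊗ e ≈-refl) (≋⇒≈ (⊗-zeroˡ g))

≈-cancelʳ : h 0 ≡ 1ℤ → f ⊗ h ≈ g ⊗ h [ m ] → f ≈ g [ m ]
≈-cancelʳ {h} {f} {g} h₀ e =
  ≈-trans (≋⇒≈ (≋-sym (undo f))) (≈-trans (≈-⊗ e ≈-refl) (≋⇒≈ (undo g)))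
  where
  undo : ∀ f → f ⊗ h ⊗ recip h ≋ f
  undo f = ≋-trans (⊗-assoc f h (recip h)) (≋-trans (⊗-cong ≋-refl (⊗-recip h₀)) (⊗-identityʳ f))

≈-precision : ∀ {M N} → N ≤ M → f ≈ g [ X^ M ] → f ≈ g [ X^ N ]
≈-precision {M = M} {N} N≤M = ≈-weaken {h = X^ (M ∸ N)}
  (≋-trans (subst (λ k → X^ M ≋ X^ k) (sym (ℕ.m+[n∸m]≡n N≤M)) ≋-refl) (≋-sym (X^-+ N (M ∸ N))))

X^≈𝟎 : ∀ {M N} → N ≤ M → X^ M ≈ 𝟎 [ X^ N ]
X^≈𝟎 {M} {N} N≤M = ≈-precision N≤M
  (by 𝟏 (≋-sym (≋-trans (⊕-identityˡ _) (⊗-identityʳ _))))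

≈⇒coeff : ∀ {N n} → f ≈ g [ X^ N ] → n < N → f n ≡ g n
≈⇒coeff {f} {g} {n = n} (by k e) n<N = trans (coeff e n) (trans (⊕-coeff g _ n)
  (trans (cong (ℤ._+_ (g n)) (X^-⊗-coeff-< k n<N)) (ℤ.+-identityʳ _)))

coeff⇒≈ : ∀ N → (∀ n → n < N → f n ≡ g n) → f ≈ g [ X^ N ]
coeff⇒≈ {f} {g} N p = by d (coeffs λ n → sym (trans (⊕-coeff g _ n) (go n)))
  where
  d = λ n → f (N + n) ℤ.- g (N + n)
  cancel : ∀ x y → x ℤ.+ (y ℤ.- x) ≡ y
  cancel = solve-∀
  go : ∀ n → g n ℤ.+ (X^ N ⊗ d) n ≡ f n
  go n with n ℕ.<? N
  ... | yes n<N = trans (cong (ℤ._+_ (g n)) (X^-⊗-coeff-< d n<N)) (trans (ℤ.+-identityʳ _) (sym (p n n<N)))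
  ... | no n≮N  = subst (λ n → g n ℤ.+ (X^ N ⊗ d) n ≡ f n) (ℕ.m+[n∸m]≡n (ℕ.≮⇒≥ n≮N))
    (trans (cong (ℤ._+_ (g (N + (n ∸ N)))) (X^-⊗-coeff-+ N d (n ∸ N))) (cancel (g (N + (n ∸ N))) (f (N + (n ∸ N)))))

≈⇒≋ : (∀ N → f ≈ g [ X^ N ]) → f ≋ g
≈⇒≋ p .coeff n = ≈⇒coeff (p (suc n)) ℕ.≤-refl

-- q-adic limits

-- The rate of convergence is built in: the step from `s k` to `s (suc k)` may change only
-- coefficients of q^k and beyond. The coefficient of q^n is thus final from `s (suc n)` on, which
-- is where `lim` reads it.
Cauchy : (ℕ → Series) → Set
Cauchy s = ∀ k → s (suc k) ≈ s k [ X^ k ]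

opaque
  lim : (ℕ → Series) → Series
  lim s n = s (suc n) n

  lim-coeff : ∀ s n → lim s n ≡ s (suc n) n
  lim-coeff s n = refl

Cauchy-≤ : ∀ {s} → Cauchy s → ∀ N d → s (N + d) ≈ s N [ X^ N ]
Cauchy-≤ {s} c N zero    = subst (λ k → s k ≈ s N [ X^ N ]) (sym (ℕ.+-identityʳ N)) ≈-refl
Cauchy-≤ {s} c N (suc d) = subst (λ k → s k ≈ s N [ X^ N ]) (sym (ℕ.+-suc N d))
  (≈-trans (≈-precision (ℕ.m≤m+n N d) (c (N + d))) (Cauchy-≤ c N d))

lim-≈ : ∀ {s} → Cauchy s → ∀ {N M} → N ≤ M → lim s ≈ s M [ X^ N ]
lim-≈ {s} c {N} {M} N≤M = coeff⇒≈ N λ n n<N →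
  trans (lim-coeff s n) (sym
    (subst (λ k → s k n ≡ s (suc n) n) (ℕ.m+[n∸m]≡n (ℕ.≤-trans n<N N≤M))
      (≈⇒coeff (Cauchy-≤ c (suc n) (M ∸ suc n)) ℕ.≤-refl)))

lim-unique : ∀ {s f} → Cauchy s → (∀ N → f ≈ s N [ X^ N ]) → f ≋ lim s
lim-unique c p = ≈⇒≋ λ N → ≈-trans (p N) (≈-sym (lim-≈ c ℕ.≤-refl))

-- Finite sums and products of series

Σ[_] Π[_] : (ℕ → Series) → ℕ → Series
Σ[ F ] zero    = 𝟎
Σ[ F ] (suc n) = Σ[ F ] n ⊕ F n
Π[ F ] zero    = 𝟏
Π[ F ] (suc n) = Π[ F ] n ⊗ F n

Σ-Cauchy : ∀ {F} → (∀ k → F k ≈ 𝟎 [ X^ k ]) → Cauchy Σ[ F ]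
Σ-Cauchy {F} p k = ≈-trans (≈-⊕ ≈-refl (p k)) (≋⇒≈ (⊕-identityʳ _))

Π-Cauchy : ∀ {F} → (∀ k → F k ≈ 𝟏 [ X^ k ]) → Cauchy Π[ F ]
Π-Cauchy {F} p k = ≈-trans (≈-⊗ ≈-refl (p k)) (≋⇒≈ (⊗-identityʳ _))

Σ-cong : ∀ {F G} n → (∀ k → k < n → F k ≋ G k) → Σ[ F ] n ≋ Σ[ G ] n
Σ-cong zero    p = ≋-refl
Σ-cong (suc n) p = ⊕-cong (Σ-cong n λ k k<n → p k (ℕ.m<n⇒m<1+n k<n)) (p n ℕ.≤-refl)

Σ-≈ : ∀ {F G m} n → (∀ k → k < n → F k ≈ G k [ m ]) → Σ[ F ] n ≈ Σ[ G ] n [ m ]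
Σ-≈ zero    p = ≈-refl
Σ-≈ (suc n) p = ≈-⊕ (Σ-≈ n λ k k<n → p k (ℕ.m<n⇒m<1+n k<n)) (p n ℕ.≤-refl)

Σ-⊗ : ∀ h F n → h ⊗ Σ[ F ] n ≋ Σ[ (λ k → h ⊗ F k) ] n
Σ-⊗ h F zero    = ⊗-zeroʳ h
Σ-⊗ h F (suc n) = ≋-trans
  (solve 3 (λ h a b → h :* (a :+ b) := h :* a :+ h :* b) ≋-refl h (Σ[ F ] n) (F n))
  (⊕-cong (Σ-⊗ h F n) ≋-refl)

Σ-⊕ : ∀ F G n → Σ[ (λ k → F k ⊕ G k) ] n ≋ Σ[ F ] n ⊕ Σ[ G ] n
Σ-⊕ F G zero    = ≋-sym (⊕-identityʳ 𝟎)
Σ-⊕ F G (suc n) = ≋-trans (⊕-cong (Σ-⊕ F G n) ≋-refl)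
  (solve 4 (λ a b c d → a :+ b :+ (c :+ d) := a :+ c :+ (b :+ d)) ≋-refl (Σ[ F ] n) (Σ[ G ] n) (F n) (G n))

Σ-suc : ∀ F n → Σ[ F ] (suc n) ≋ F 0 ⊕ Σ[ (λ k → F (suc k)) ] n
Σ-suc F zero    = ≋-trans (⊕-identityˡ _) (≋-sym (⊕-identityʳ _))
Σ-suc F (suc n) = ≋-trans (⊕-cong (Σ-suc F n) ≋-refl)
  (solve 3 (λ a b c → a :+ b :+ c := a :+ (b :+ c)) ≋-refl _ _ _)

Π-cong : ∀ {F G} n → (∀ k → k < n → F k ≋ G k) → Π[ F ] n ≋ Π[ G ] n
Π-cong zero    p = ≋-refl
Π-cong (suc n) p = ⊗-cong (Π-cong n λ k k<n → p k (ℕ.m<n⇒m<1+n k<n)) (p n ℕ.≤-refl)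

Π-⊗ : ∀ F G n → Π[ (λ k → F k ⊗ G k) ] n ≋ Π[ F ] n ⊗ Π[ G ] n
Π-⊗ F G zero    = ≋-sym (⊗-identityʳ 𝟏)
Π-⊗ F G (suc n) = ≋-trans (⊗-cong (Π-⊗ F G n) ≋-refl)
  (solve 4 (λ a b c d → a :* b :* (c :* d) := a :* c :* (b :* d)) ≋-refl (Π[ F ] n) (Π[ G ] n) (F n) (G n))

Π-suc : ∀ F n → Π[ F ] (suc n) ≋ F 0 ⊗ Π[ (λ k → F (suc k)) ] n
Π-suc F zero    = ⊗-comm 𝟏 (F 0)
Π-suc F (suc n) = ≋-trans (⊗-cong (Π-suc F n) ≋-refl) (⊗-assoc _ _ _)

-- Substitution of q^k for q, and extraction of residue classes

-- V k f is f(q^k).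
private
  atMultiple : ℕ → ℤ → ℤ
  atMultiple zero    z = z
  atMultiple (suc _) z = 0ℤ

opaque
  V : (k : ℕ) .{{_ : NonZero k}} → Series → Series
  V k f n = atMultiple (n % k) (f (n / k))

  U : ℕ → ℕ → Series → Series
  U k r f n = f (r + n * k)

  U-coeff : ∀ k r f n → U k r f n ≡ f (r + n * k)
  U-coeff k r f n = refl

U-cong : ∀ k r → f ≋ g → U k r f ≋ U k r g
U-cong k r e .coeff n = trans (U-coeff k r _ n) (trans (coeff e _) (sym (U-coeff k r _ n)))

U-⊕ : ∀ k r f g → U k r (f ⊕ g) ≋ U k r f ⊕ U k r g
U-⊕ k r f g .coeff n = trans (U-coeff k r _ n) (trans (⊕-coeff f g _)
  (sym (trans (⊕-coeff _ _ n) (cong₂ ℤ._+_ (U-coeff k r f n) (U-coeff k r g n)))))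

U-⊟ : ∀ k r f → U k r (⊟ f) ≋ ⊟ U k r f
U-⊟ k r f .coeff n = trans (U-coeff k r _ n) (trans (⊟-coeff f _)
  (sym (trans (⊟-coeff _ n) (cong ℤ.-_ (U-coeff k r f n)))))

U-κ : ∀ k r a f → U k r (κ a ⊗ f) ≋ κ a ⊗ U k r f
U-κ k r a f .coeff n = trans (U-coeff k r _ n) (trans (κ-coeff a f _)
  (sym (trans (κ-coeff a _ n) (cong (a ℤ.*_) (U-coeff k r f n)))))

U-≈ : ∀ k r {a} → f ≈ g [ κ a ] → U k r f ≈ U k r g [ κ a ]
U-≈ {f} {g} k r {a} (by h e) = by (U k r h)
  (≋-trans (U-cong k r e) (≋-trans (U-⊕ k r g _) (⊕-cong ≋-refl (U-κ k r a h))))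

opaque
  unfolding V

  V-coeff-0 : ∀ k .{{_ : NonZero k}} f n → V k f (n * k) ≡ f n
  V-coeff-0 k f n = cong₂ (λ r d → atMultiple r (f d)) (m*n%n≡0 n k) (m*n/n≡m n k)

  V-coeff-suc : ∀ k .{{_ : NonZero k}} f r n → suc r < k → V k f (suc r + n * k) ≡ 0ℤ
  V-coeff-suc k f r n r<k =
    cong (λ s → atMultiple s (f ((suc r + n * k) / k)))
      (trans ([m+kn]%n≡m%n (suc r) n k) (m<n⇒m%n≡m r<k))

-- A series is determined by its k residue classes. Identities for `V` are checked class by class
-- through this.
U-ext : ∀ k .{{_ : NonZero k}} → (∀ r → r < k → U k r f ≋ U k r g) → f ≋ g
U-ext {f} {g} k p .coeff n = subst (λ n → f n ≡ g n) (sym (m≡m%n+[m/n]*n n k))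
  (trans (sym (U-coeff k _ f (n / k))) (trans (coeff (p (n % k) (m%n<n n k)) (n / k)) (U-coeff k _ g (n / k))))

U-V : ∀ k .{{_ : NonZero k}} f → U k 0 (V k f) ≋ f
U-V k f .coeff n = trans (U-coeff k 0 _ n) (V-coeff-0 k f n)

U-V-suc : ∀ k .{{_ : NonZero k}} f r → suc r < k → U k (suc r) (V k f) ≋ 𝟎
U-V-suc k f r r<k .coeff n =
  trans (U-coeff k (suc r) _ n) (trans (V-coeff-suc k f r n r<k) (sym (𝟎-coeff n)))

V-cong : ∀ k .{{_ : NonZero k}} → f ≋ g → V k f ≋ V k g
V-cong {f} {g} k e = U-ext k λ
  { zero    _ → ≋-trans (U-V k f) (≋-trans e (≋-sym (U-V k g)))
  ; (suc r) l → ≋-trans (U-V-suc k f r l) (≋-sym (U-V-suc k g r l)) }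

V-⊕ : ∀ k .{{_ : NonZero k}} f g → V k (f ⊕ g) ≋ V k f ⊕ V k g
V-⊕ k f g = U-ext k λ
  { zero    _ → ≋-trans (U-V k _) (≋-sym (≋-trans (U-⊕ k 0 _ _) (⊕-cong (U-V k f) (U-V k g))))
  ; (suc r) l → ≋-trans (U-V-suc k _ r l) (≋-sym (≋-trans (U-⊕ k (suc r) _ _)
      (≋-trans (⊕-cong (U-V-suc k f r l) (U-V-suc k g r l)) (⊕-identityˡ 𝟎)))) }

V-κ⊗ : ∀ k .{{_ : NonZero k}} a f → V k (κ a ⊗ f) ≋ κ a ⊗ V k f
V-κ⊗ k a f = U-ext k λ
  { zero    _ → ≋-trans (U-V k _) (≋-sym (≋-trans (U-κ k 0 a _) (⊗-cong ≋-refl (U-V k f))))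
  ; (suc r) l → ≋-trans (U-V-suc k _ r l) (≋-sym (≋-trans (U-κ k (suc r) a _)
      (≋-trans (⊗-cong ≋-refl (U-V-suc k f r l)) (⊗-zeroʳ (κ a))))) }

V-⊟ : ∀ k .{{_ : NonZero k}} f → V k (⊟ f) ≋ ⊟ V k f
V-⊟ k f = begin
  V k (⊟ f)                  ≈⟨ V-cong k (solve 1 (λ f → :- f := con (ℤ.- 1ℤ) :* f) ≋-refl f) ⟩
  V k (κ (ℤ.- 1ℤ) ⊗ f)       ≈⟨ V-κ⊗ k (ℤ.- 1ℤ) f ⟩
  κ (ℤ.- 1ℤ) ⊗ V k f         ≈⟨ solve 1 (λ f → con (ℤ.- 1ℤ) :* f := :- f) ≋-refl (V k f) ⟩
  ⊟ V k f                    ∎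
  where open ≋-Reasoning

V-coeff-zero : ∀ k .{{_ : NonZero k}} f → V k f 0 ≡ f 0
V-coeff-zero k f = V-coeff-0 k f 0

-- `V` is defined by division with remainder; this recursion along `tail` is what permits induction
-- on coefficients in `U-V-⊗` and `frobenius`.
V-decompose : ∀ k .{{_ : NonZero k}} f → V k f ≋ κ (f 0) ⊕ X^ k ⊗ V k (tail f)
V-decompose k f = U-ext k λ r l → coeffs λ n →
  trans (U-coeff k r _ n) (trans (go r n l) (sym (U-coeff k r _ n)))
  where
  T = V k (tail f)

  rhs : ∀ n → (κ (f 0) ⊕ X^ k ⊗ T) n ≡ κ (f 0) n ℤ.+ (X^ k ⊗ T) n
  rhs n = ⊕-coeff _ _ n

  k>0 : ∀ r n → r < k → ∃ λ l → r + suc n * k ≡ suc l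
  k>0 r n r<k = r + (k ∸ 1 + n * k) , trans (cong (λ j → r + (j + n * k)) (sym (ℕ.m+[n∸m]≡n (ℕ.≤-trans (s≤s z≤n) r<k)))) (ℕ.+-suc r _)

  swap : ∀ r n → r + suc n * k ≡ k + (r + n * k)
  swap r n = trans (sym (ℕ.+-assoc r k _)) (trans (cong (_+ n * k) (ℕ.+-comm r k)) (ℕ.+-assoc k r _))

  later : ∀ r n → r < k → (κ (f 0) ⊕ X^ k ⊗ T) (r + suc n * k) ≡ T (r + n * k)
  later r n l = begin
    (κ (f 0) ⊕ X^ k ⊗ T) (r + suc n * k)              ≡⟨ rhs (r + suc n * k) ⟩
    κ (f 0) (r + suc n * k) ℤ.+ (X^ k ⊗ T) (r + suc n * k)
      ≡⟨ cong₂ ℤ._+_ (trans (cong (κ (f 0)) (proj₂ (k>0 r n l))) (κ-suc (f 0) _)) (cong (X^ k ⊗ T) (swap r n)) ⟩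
    0ℤ ℤ.+ (X^ k ⊗ T) (k + (r + n * k))               ≡⟨ ℤ.+-identityˡ _ ⟩
    (X^ k ⊗ T) (k + (r + n * k))                      ≡⟨ X^-⊗-coeff-+ k T (r + n * k) ⟩
    T (r + n * k)                                     ∎
    where
    open ≡-Reasoning

  go : ∀ r n → r < k → V k f (r + n * k) ≡ (κ (f 0) ⊕ X^ k ⊗ T) (r + n * k)
  go zero    zero    l = trans (V-coeff-0 k f 0) (sym (trans (rhs 0)
    (trans (cong₂ ℤ._+_ (κ-zero (f 0)) (X^-⊗-coeff-< T l)) (ℤ.+-identityʳ _))))
  go zero    (suc n) l = trans (V-coeff-0 k f (suc n))
    (sym (trans (later 0 n l) (trans (V-coeff-0 k (tail f) n) (tail-coeff f n))))
  go (suc r) zero    l = trans (V-coeff-suc k f r 0 l) (sym (trans (rhs (suc r + 0))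
    (trans (cong₂ ℤ._+_ (κ-suc (f 0) (r + 0)) (X^-⊗-coeff-< T (subst (_< k) (sym (ℕ.+-identityʳ (suc r))) l))) refl)))
  go (suc r) (suc n) l = trans (V-coeff-suc k f r (suc n) l)
    (sym (trans (later (suc r) n l) (V-coeff-suc k (tail f) r n l)))

-- Multiplication by a series in q^k keeps every index in its residue class, so such a factor leaves
-- the extraction with q^k replaced by q. The induction on n peels off the constant coefficient of
-- f.
U-V-⊗ : ∀ k .{{_ : NonZero k}} r → r < k → ∀ f g → U k r (V k f ⊗ g) ≋ f ⊗ U k r g
U-V-⊗ k r r<k f g .coeff n = trans (U-coeff k r _ n) (go n f)
  where
  peel : ∀ f n → (V k f ⊗ g) n ≡ f 0 ℤ.* g n ℤ.+ (X^ k ⊗ (V k (tail f) ⊗ g)) n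
  peel f n = begin
    (V k f ⊗ g) n
      ≡⟨ coeff (≋-trans (⊗-cong (V-decompose k f) ≋-refl)
           (≋-trans (⊗-distribʳ g _ _) (⊕-cong ≋-refl (⊗-assoc _ _ g)))) n ⟩
    (κ (f 0) ⊗ g ⊕ X^ k ⊗ (V k (tail f) ⊗ g)) n
      ≡⟨ ⊕-coeff _ _ n ⟩
    (κ (f 0) ⊗ g) n ℤ.+ (X^ k ⊗ (V k (tail f) ⊗ g)) n
      ≡⟨ cong (ℤ._+ (X^ k ⊗ (V k (tail f) ⊗ g)) n) (κ-coeff (f 0) g n) ⟩
    f 0 ℤ.* g n ℤ.+ (X^ k ⊗ (V k (tail f) ⊗ g)) n ∎
    where open ≡-Reasoning

  go : ∀ n f → (V k f ⊗ g) (r + n * k) ≡ (f ⊗ U k r g) n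
  go zero f = begin
    (V k f ⊗ g) (r + 0)
      ≡⟨ peel f (r + 0) ⟩
    f 0 ℤ.* g (r + 0) ℤ.+ (X^ k ⊗ (V k (tail f) ⊗ g)) (r + 0)
      ≡⟨ cong (ℤ._+_ (f 0 ℤ.* g (r + 0))) (X^-⊗-coeff-< _ (subst (_< k) (sym (ℕ.+-identityʳ r)) r<k)) ⟩
    f 0 ℤ.* g (r + 0) ℤ.+ 0ℤ
      ≡⟨ ℤ.+-identityʳ _ ⟩
    f 0 ℤ.* g (r + 0)
      ≡⟨ cong (f 0 ℤ.*_) (U-coeff k r g 0) ⟨
    f 0 ℤ.* U k r g 0
      ≡⟨ ⊗-zero f (U k r g) ⟨
    (f ⊗ U k r g) 0 ∎
    where open ≡-Reasoning
  go (suc n) f = begin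
    (V k f ⊗ g) (r + suc n * k)
      ≡⟨ peel f (r + suc n * k) ⟩
    f 0 ℤ.* g (r + suc n * k) ℤ.+ (X^ k ⊗ (V k (tail f) ⊗ g)) (r + suc n * k)
      ≡⟨ cong₂ (λ x j → f 0 ℤ.* x ℤ.+ (X^ k ⊗ (V k (tail f) ⊗ g)) j) (sym (U-coeff k r g (suc n))) swap ⟩
    f 0 ℤ.* U k r g (suc n) ℤ.+ (X^ k ⊗ (V k (tail f) ⊗ g)) (k + (r + n * k))
      ≡⟨ cong (ℤ._+_ (f 0 ℤ.* U k r g (suc n))) (trans (X^-⊗-coeff-+ k _ (r + n * k)) (go n (tail f))) ⟩
    f 0 ℤ.* U k r g (suc n) ℤ.+ (tail f ⊗ U k r g) n
      ≡⟨ ⊗-suc f (U k r g) n ⟨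
    (f ⊗ U k r g) (suc n) ∎
    where
    open ≡-Reasoning
    swap : r + suc n * k ≡ k + (r + n * k)
    swap = trans (sym (ℕ.+-assoc r k _)) (trans (cong (_+ n * k) (ℕ.+-comm r k)) (ℕ.+-assoc k r _))

-- Both sides have `f ⊗ g ⊗ U k r 𝟏` as their class r: `U-V-⊗` is applied once on the left and twice
-- on the right.
V-⊗ : ∀ k .{{_ : NonZero k}} f g → V k (f ⊗ g) ≋ V k f ⊗ V k g
V-⊗ k f g = U-ext k λ r l → begin
  U k r (V k (f ⊗ g))        ≈⟨ U-cong k r (⊗-identityʳ _) ⟨
  U k r (V k (f ⊗ g) ⊗ 𝟏)    ≈⟨ U-V-⊗ k r l (f ⊗ g) 𝟏 ⟩
  f ⊗ g ⊗ U k r 𝟏            ≈⟨ ⊗-assoc f g _ ⟩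
  f ⊗ (g ⊗ U k r 𝟏)          ≈⟨ ⊗-cong ≋-refl (U-V-⊗ k r l g 𝟏) ⟨
  f ⊗ U k r (V k g ⊗ 𝟏)      ≈⟨ U-V-⊗ k r l f _ ⟨
  U k r (V k f ⊗ (V k g ⊗ 𝟏)) ≈⟨ U-cong k r (⊗-cong ≋-refl (⊗-identityʳ _)) ⟩
  U k r (V k f ⊗ V k g)      ∎
  where open ≋-Reasoning

V-κ : ∀ k .{{_ : NonZero k}} a → V k (κ a) ≋ κ a
V-κ k a = begin
  V k (κ a)                           ≈⟨ V-decompose k (κ a) ⟩
  κ (κ a 0) ⊕ X^ k ⊗ V k (tail (κ a)) ≈⟨ ⊕-cong (≡⇒≋ (cong κ (κ-zero a))) (⊗-cong ≋-refl (≋-trans (V-cong k tail-κ) V-𝟎)) ⟩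
  κ a ⊕ X^ k ⊗ 𝟎                      ≈⟨ ⊕-cong ≋-refl (⊗-zeroʳ _) ⟩
  κ a ⊕ 𝟎                             ≈⟨ ⊕-identityʳ _ ⟩
  κ a                                 ∎
  where
  open ≋-Reasoning
  tail-κ : tail (κ a) ≋ 𝟎
  tail-κ .coeff n = trans (tail-coeff _ n) (trans (κ-suc a n) (sym (𝟎-coeff n)))
  V-𝟎 : V k 𝟎 ≋ 𝟎
  V-𝟎 = begin
    V k 𝟎              ≈⟨ V-cong k (⊗-zeroʳ (κ 0ℤ)) ⟨
    V k (κ 0ℤ ⊗ 𝟎)     ≈⟨ V-κ⊗ k 0ℤ 𝟎 ⟩
    κ 0ℤ ⊗ V k 𝟎       ≈⟨ ⊗-cong κ-0≋𝟎 ≋-refl ⟩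
    𝟎 ⊗ V k 𝟎          ≈⟨ ⊗-zeroˡ _ ⟩
    𝟎                  ∎

V-X^ : ∀ k .{{_ : NonZero k}} e → V k (X^ e) ≋ X^ (e * k)
V-X^ k zero    = ≋-trans (V-cong k (≋-sym κ-1)) (≋-trans (V-κ k 1ℤ) κ-1)
V-X^ k (suc e) = begin
  V k (X^ (suc e))
    ≈⟨ V-decompose k _ ⟩
  κ (X^ (suc e) 0) ⊕ X^ k ⊗ V k (tail (X^ (suc e)))
    ≈⟨ ⊕-cong (≋-trans (≡⇒≋ (cong κ (X^suc-coeff-zero e))) κ-0≋𝟎)
         (⊗-cong ≋-refl (≋-trans (V-cong k (tail-X^suc e)) (V-X^ k e))) ⟩
  𝟎 ⊕ X^ k ⊗ X^ (e * k)
    ≈⟨ ⊕-identityˡ _ ⟩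
  X^ k ⊗ X^ (e * k)
    ≈⟨ X^-+ k (e * k) ⟩
  X^ (suc e * k) ∎
  where open ≋-Reasoning

V-≈ : ∀ k .{{_ : NonZero k}} {N} → f ≈ g [ X^ N ] → V k f ≈ V k g [ X^ N ]
V-≈ {f} {g} k@(suc k-1) {N} (by h e) = ≈-precision (ℕ.m≤m*n N k) (by (V k h) (begin
  V k f                         ≈⟨ V-cong k e ⟩
  V k (g ⊕ X^ N ⊗ h)            ≈⟨ V-⊕ k g _ ⟩
  V k g ⊕ V k (X^ N ⊗ h)        ≈⟨ ⊕-cong ≋-refl (≋-trans (V-⊗ k _ h) (⊗-cong (V-X^ k N) ≋-refl)) ⟩
  V k g ⊕ X^ (N * k) ⊗ V k h    ∎))
  where open ≋-Reasoning

U-X^-diag : ∀ k .{{_ : NonZero k}} r → U k r (X^ r) ≋ 𝟏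
U-X^-diag k r .coeff zero = trans (U-coeff k r _ 0) (trans (cong (X^ r) (ℕ.+-identityʳ r))
  (trans (X^-coeff-diag r) (sym X^0-coeff-zero)))
U-X^-diag k@(suc _) r .coeff (suc n) = trans (U-coeff k r _ (suc n))
  (trans (X^-coeff-off r _ (ℕ.<⇒≢ (ℕ.m<m+n r (s≤s z≤n)))) (sym (X^0-coeff-suc n)))

U-X^-off : ∀ k r s → r < k → s < k → r ≢ s → U k r (X^ s) ≋ 𝟎
U-X^-off k r s r<k s<k r≢s .coeff n = trans (U-coeff k r _ n) (trans (X^-coeff-off s _ (go n)) (sym (𝟎-coeff n)))
  where
  go : ∀ n → s ≢ r + n * k
  go zero    e = r≢s (sym (trans e (ℕ.+-identityʳ r)))
  go (suc n) e = ℕ.<-irrefl e (ℕ.<-≤-trans s<k (ℕ.≤-trans (ℕ.m≤m+n k (n * k)) (ℕ.m≤n+m _ r)))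

U-X^V-diag : ∀ k .{{_ : NonZero k}} r → r < k → ∀ f → U k r (X^ r ⊗ V k f) ≋ f
U-X^V-diag k r r<k f = begin
  U k r (X^ r ⊗ V k f)  ≈⟨ U-cong k r (⊗-comm _ _) ⟩
  U k r (V k f ⊗ X^ r)  ≈⟨ U-V-⊗ k r r<k f _ ⟩
  f ⊗ U k r (X^ r)      ≈⟨ ⊗-cong ≋-refl (U-X^-diag k r) ⟩
  f ⊗ 𝟏                 ≈⟨ ⊗-identityʳ f ⟩
  f                     ∎
  where open ≋-Reasoning

U-X^V-off : ∀ k .{{_ : NonZero k}} r s → r < k → s < k → r ≢ s → ∀ f → U k r (X^ s ⊗ V k f) ≋ 𝟎
U-X^V-off k r s r<k s<k r≢s f = begin
  U k r (X^ s ⊗ V k f)  ≈⟨ U-cong k r (⊗-comm _ _) ⟩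
  U k r (V k f ⊗ X^ s)  ≈⟨ U-V-⊗ k r r<k f _ ⟩
  f ⊗ U k r (X^ s)      ≈⟨ ⊗-cong ≋-refl (U-X^-off k r s r<k s<k r≢s) ⟩
  f ⊗ 𝟎                 ≈⟨ ⊗-zeroʳ f ⟩
  𝟎                     ∎
  where open ≋-Reasoning

U₂₀ : ∀ a b → U 2 0 (V 2 a ⊕ X^ 1 ⊗ V 2 b) ≋ a
U₂₀ a b = ≋-trans (U-⊕ 2 0 _ _) (≋-trans (⊕-cong (U-V 2 a)
  (U-X^V-off 2 0 1 (s≤s z≤n) (s≤s (s≤s z≤n)) (λ ()) b)) (⊕-identityʳ a))

U₂₁ : ∀ a b → U 2 1 (V 2 a ⊕ X^ 1 ⊗ V 2 b) ≋ b
U₂₁ a b = ≋-trans (U-⊕ 2 1 _ _) (≋-trans (⊕-cong (U-V-suc 2 a 0 (s≤s (s≤s z≤n)))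
  (U-X^V-diag 2 1 (s≤s (s≤s z≤n)) b)) (⊕-identityˡ b))

module _ (a b c : Series) where
  private
    split : ∀ r → U 3 r (V 3 a ⊕ X^ 1 ⊗ V 3 b ⊕ X^ 2 ⊗ V 3 c)
                ≋ U 3 r (V 3 a) ⊕ U 3 r (X^ 1 ⊗ V 3 b) ⊕ U 3 r (X^ 2 ⊗ V 3 c)
    split r = ≋-trans (U-⊕ 3 r _ _) (⊕-cong (U-⊕ 3 r _ _) ≋-refl)

    0<3 : 0 < 3
    0<3 = s≤s z≤n
    1<3 : 1 < 3
    1<3 = s≤s (s≤s z≤n)
    2<3 : 2 < 3
    2<3 = s≤s (s≤s (s≤s z≤n))

  U₃₀ : U 3 0 (V 3 a ⊕ X^ 1 ⊗ V 3 b ⊕ X^ 2 ⊗ V 3 c) ≋ a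
  U₃₀ = ≋-trans (split 0) (≋-trans (⊕-cong (⊕-cong (U-V 3 a)
    (U-X^V-off 3 0 1 0<3 1<3 (λ ()) b)) (U-X^V-off 3 0 2 0<3 2<3 (λ ()) c))
    (≋-trans (⊕-identityʳ _) (⊕-identityʳ _)))

U₃₁-X : ∀ f → U 3 1 (X^ 1 ⊗ f) ≋ U 3 0 f
U₃₁-X f .coeff n = trans (U-coeff 3 1 _ n)
  (trans (X^-⊗-coeff-+ 1 f (n * 3)) (sym (U-coeff 3 0 f n)))

-- Congruences of Frobenius type

pointwise⇒≈κ : ∀ k → (d : ℕ → ℤ) → (∀ n → f n ≡ g n ℤ.+ k ℤ.* d n) → f ≈ g [ κ k ]
pointwise⇒≈κ {f} {g} k d p = by d (coeffs λ n → trans (p n)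
  (sym (trans (⊕-coeff g _ n) (cong (ℤ._+_ (g n)) (κ-coeff k d n)))))

³-cong : f ≋ g → f ³ ≋ g ³
³-cong e = ⊗-cong (⊗-cong e e) e

V-³ : ∀ k .{{_ : NonZero k}} f → V k (f ³) ≋ V k f ³
V-³ k f = ≋-trans (V-⊗ k (f ⊗ f) f) (⊗-cong (V-⊗ k f f) ≋-refl)

fermat-3 : ∀ a → ∃ λ d → a ℤ.* a ℤ.* a ≡ a ℤ.+ + 3 ℤ.* d
fermat-3 (+ n) = nonnegative n
  where
  nonnegative : ∀ n → ∃ λ d → + n ℤ.* + n ℤ.* + n ≡ + n ℤ.+ + 3 ℤ.* d
  nonnegative zero    = 0ℤ , refl
  nonnegative (suc n) = d ℤ.+ + n ℤ.* + n ℤ.+ + n ,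
    trans (expand (+ n)) (trans (cong (λ c → c ℤ.+ + 3 ℤ.* (+ n ℤ.* + n ℤ.+ + n) ℤ.+ 1ℤ) (proj₂ (nonnegative n))) (collect (+ n) d))
    where
    d = proj₁ (nonnegative n)
    expand : ∀ x → (1ℤ ℤ.+ x) ℤ.* (1ℤ ℤ.+ x) ℤ.* (1ℤ ℤ.+ x) ≡ x ℤ.* x ℤ.* x ℤ.+ + 3 ℤ.* (x ℤ.* x ℤ.+ x) ℤ.+ 1ℤ
    expand = solve-∀
    collect : ∀ x d → x ℤ.+ + 3 ℤ.* d ℤ.+ + 3 ℤ.* (x ℤ.* x ℤ.+ x) ℤ.+ 1ℤ ≡ (1ℤ ℤ.+ x) ℤ.+ + 3 ℤ.* (d ℤ.+ x ℤ.* x ℤ.+ x)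
    collect = solve-∀
fermat-3 ℤ.-[1+ n ] = ℤ.- d , trans (negate (+ suc n)) (trans (cong ℤ.-_ e) (distribute (+ suc n) d))
  where
  d = proj₁ (fermat-3 (+ suc n))
  e = proj₂ (fermat-3 (+ suc n))
  negate : ∀ x → (ℤ.- x) ℤ.* (ℤ.- x) ℤ.* (ℤ.- x) ≡ ℤ.- (x ℤ.* x ℤ.* x)
  negate = solve-∀
  distribute : ∀ x d → ℤ.- (x ℤ.+ + 3 ℤ.* d) ≡ (ℤ.- x) ℤ.+ + 3 ℤ.* (ℤ.- d)
  distribute = solve-∀

-- Modulo 3 the cube of f(0) + q t is f(0) + q³ t³, by Fermat for the constant coefficient. `V 3 f`
-- obeys the same recursion in t = `tail f`, so the coefficients agree by induction in steps of
-- three.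
frobenius : ∀ f → f ³ ≈ V 3 f [ κ (+ 3) ]
frobenius f = pointwise⇒≈κ (+ 3) (λ n → proj₁ (go n f)) (λ n → proj₂ (go n f))
  where
  expand : ∀ a x t → (a ⊕ x ⊗ t) ³ ≋ a ⊗ a ⊗ a ⊕ x ⊗ x ⊗ x ⊗ t ³ ⊕ κ (+ 3) ⊗ (a ⊗ a ⊗ (x ⊗ t) ⊕ a ⊗ (x ⊗ t) ⊗ (x ⊗ t))
  expand = solve 3 (λ a x t → let c = λ y → y :* y :* y in
    c (a :+ x :* t) := c a :+ c x :* c t :+ con (+ 3) :* (a :* a :* (x :* t) :+ a :* (x :* t) :* (x :* t))) ≋-refl

  peel : ∀ f → ∃ λ r → f ³ ≋ κ (f 0) ⊕ X^ 3 ⊗ tail f ³ ⊕ κ (+ 3) ⊗ r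
  peel f with d , e ← fermat-3 (f 0) = κ d ⊕ r , (begin
    f ³
      ≈⟨ ³-cong (decompose f) ⟩
    (a ⊕ x ⊗ t) ³
      ≈⟨ expand a x t ⟩
    a ⊗ a ⊗ a ⊕ x ⊗ x ⊗ x ⊗ t ³ ⊕ κ (+ 3) ⊗ r
      ≈⟨ ⊕-cong (⊕-cong cube-a (⊗-cong (≋-trans (⊗-cong (X^-+ 1 1) ≋-refl) (X^-+ 2 1)) ≋-refl)) ≋-refl ⟩
    a ⊕ κ (+ 3) ⊗ κ d ⊕ X^ 3 ⊗ t ³ ⊕ κ (+ 3) ⊗ r
      ≈⟨ solve 4 (λ a d u r → a :+ con (+ 3) :* d :+ u :+ con (+ 3) :* r := a :+ u :+ con (+ 3) :* (d :+ r)) ≋-refl a (κ d) (X^ 3 ⊗ t ³) r ⟩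
    a ⊕ X^ 3 ⊗ t ³ ⊕ κ (+ 3) ⊗ (κ d ⊕ r) ∎)
    where
    open ≋-Reasoning
    a = κ (f 0)
    x = X^ 1
    t = tail f
    r = a ⊗ a ⊗ (x ⊗ t) ⊕ a ⊗ (x ⊗ t) ⊗ (x ⊗ t)
    cube-a : a ⊗ a ⊗ a ≋ a ⊕ κ (+ 3) ⊗ κ d
    cube-a = begin
      a ⊗ a ⊗ a                       ≈⟨ ⊗-cong (κ-* (f 0) (f 0)) ≋-refl ⟨
      κ (f 0 ℤ.* f 0) ⊗ a             ≈⟨ κ-* (f 0 ℤ.* f 0) (f 0) ⟨
      κ (f 0 ℤ.* f 0 ℤ.* f 0)         ≈⟨ ≡⇒≋ (cong κ e) ⟩
      κ (f 0 ℤ.+ + 3 ℤ.* d)           ≈⟨ +-homo _ _ ⟩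
      κ (f 0) ⊕ κ (+ 3 ℤ.* d)         ≈⟨ ⊕-cong ≋-refl (κ-* (+ 3) d) ⟩
      a ⊕ κ (+ 3) ⊗ κ d               ∎
      where open _-Raw-AlmostCommutative⟶_ κ-homomorphism using (+-homo)

  coeffˡ : ∀ a u r n → (a ⊕ u ⊕ κ (+ 3) ⊗ r) n ≡ (a ⊕ u) n ℤ.+ + 3 ℤ.* r n
  coeffˡ a u r n = trans (⊕-coeff _ _ n) (cong (ℤ._+_ ((a ⊕ u) n)) (κ-coeff (+ 3) r n))

  early : ∀ f n → n < 3 → ∃ λ d → (f ³) n ≡ V 3 f n ℤ.+ + 3 ℤ.* d
  early f n n<3 = r n , (begin
    (f ³) n                                            ≡⟨ trans (coeff e n) (coeffˡ _ _ r n) ⟩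
    (κ (f 0) ⊕ X^ 3 ⊗ tail f ³) n ℤ.+ + 3 ℤ.* r n      ≡⟨ cong (ℤ._+ + 3 ℤ.* r n) (⊕-coeff _ _ n) ⟩
    κ (f 0) n ℤ.+ (X^ 3 ⊗ tail f ³) n ℤ.+ + 3 ℤ.* r n
      ≡⟨ cong (λ z → κ (f 0) n ℤ.+ z ℤ.+ + 3 ℤ.* r n) (trans (X^-⊗-coeff-< _ n<3) (sym (X^-⊗-coeff-< _ n<3))) ⟩
    κ (f 0) n ℤ.+ (X^ 3 ⊗ V 3 (tail f)) n ℤ.+ + 3 ℤ.* r n
      ≡⟨ cong (ℤ._+ + 3 ℤ.* r n) (trans (coeff (V-decompose 3 f) n) (⊕-coeff _ _ n)) ⟨
    V 3 f n ℤ.+ + 3 ℤ.* r n ∎)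
    where
    open ≡-Reasoning
    r = proj₁ (peel f)
    e = proj₂ (peel f)

  go : ∀ n f → ∃ λ d → (f ³) n ≡ V 3 f n ℤ.+ + 3 ℤ.* d
  go 0 f = early f 0 (s≤s z≤n)
  go 1 f = early f 1 (s≤s (s≤s z≤n))
  go 2 f = early f 2 (s≤s (s≤s (s≤s z≤n)))
  go (suc (suc (suc n))) f = d ℤ.+ r N , (begin
    (f ³) N                                            ≡⟨ trans (coeff e N) (coeffˡ _ _ r N) ⟩
    (κ (f 0) ⊕ X^ 3 ⊗ tail f ³) N ℤ.+ + 3 ℤ.* r N      ≡⟨ cong (ℤ._+ + 3 ℤ.* r N) (late (tail f ³)) ⟩
    (tail f ³) n ℤ.+ + 3 ℤ.* r N                       ≡⟨ cong (ℤ._+ + 3 ℤ.* r N) i ⟩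
    V 3 (tail f) n ℤ.+ + 3 ℤ.* d ℤ.+ + 3 ℤ.* r N       ≡⟨ collect (V 3 (tail f) n) d (r N) ⟩
    V 3 (tail f) n ℤ.+ + 3 ℤ.* (d ℤ.+ r N)
      ≡⟨ cong (ℤ._+ + 3 ℤ.* (d ℤ.+ r N)) (trans (coeff (V-decompose 3 f) N) (late (V 3 (tail f)))) ⟨
    V 3 f N ℤ.+ + 3 ℤ.* (d ℤ.+ r N) ∎)
    where
    open ≡-Reasoning
    N = 3 + n
    r = proj₁ (peel f)
    e = proj₂ (peel f)
    d = proj₁ (go n (tail f))
    i = proj₂ (go n (tail f))
    late : ∀ g → (κ (f 0) ⊕ X^ 3 ⊗ g) N ≡ g n
    late g = trans (⊕-coeff _ _ N) (trans (cong₂ ℤ._+_ (κ-suc (f 0) (2 + n)) (X^-⊗-coeff-+ 3 g n)) (ℤ.+-identityˡ _))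
    collect : ∀ x d r → x ℤ.+ + 3 ℤ.* d ℤ.+ + 3 ℤ.* r ≡ x ℤ.+ + 3 ℤ.* (d ℤ.+ r)
    collect = solve-∀

-- In (g + 3kh)³ every term other than g³ is divisible by 9k: cubing gains a factor 3 in the
-- modulus.
³-≈ : ∀ k → f ≈ g [ κ (+ 3 ℤ.* k) ] → f ³ ≈ g ³ [ κ (+ 9 ℤ.* k) ]
³-≈ {f} {g} k (by h e) = by l
  (≋-trans (³-cong (≋-trans e (⊕-cong ≋-refl (⊗-cong (κ-* (+ 3) k) ≋-refl))))
  (≋-trans (solve 3 (λ g k h → let c = λ y → y :* y :* y in
    c (g :+ con (+ 3) :* k :* h) := c g :+ con (+ 9) :* k :*
      (g :* g :* h :+ con (+ 3) :* k :* g :* h :* h :+ con (+ 3) :* k :* k :* h :* h :* h)) ≋-refl g (κ k) h)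
    (⊕-cong ≋-refl (⊗-cong (≋-sym (κ-* (+ 9) k)) ≋-refl))))
  where
  l = g ⊗ g ⊗ h ⊕ κ (+ 3) ⊗ κ k ⊗ g ⊗ h ⊗ h ⊕ κ (+ 3) ⊗ κ k ⊗ κ k ⊗ h ⊗ h ⊗ h

-- Orders of vanishing and the triple product

_^ˢ_ : Series → ℕ → Series
f ^ˢ zero  = 𝟏
f ^ˢ suc n = f ^ˢ n ⊗ f

^ˢ-≈𝟎 : ∀ {f} → f ≈ 𝟎 [ X^ 1 ] → ∀ n → f ^ˢ n ≈ 𝟎 [ X^ n ]
^ˢ-≈𝟎 p zero    = X^≈𝟎 z≤n
^ˢ-≈𝟎 p (suc n) = ≈-weaken {h = 𝟏}
  (≋-trans (X^-+ n 1) (≋-trans (≡⇒≋ (cong X^ (ℕ.+-comm n 1))) (≋-sym (⊗-identityʳ _))))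
  (≈𝟎-⊗ (^ˢ-≈𝟎 p n) p)

≈𝟎-X^-⊗ : ∀ {f g} M N → f ≈ 𝟎 [ X^ M ] → g ≈ 𝟎 [ X^ N ] → f ⊗ g ≈ 𝟎 [ X^ (M + N) ]
≈𝟎-X^-⊗ M N p r = ≈-weaken {h = 𝟏} (≋-trans (X^-+ M N) (≋-sym (⊗-identityʳ _))) (≈𝟎-⊗ p r)

-- The order of h adds to the precision of f ≈ g. The triple product depends on this: towards the
-- ends of its sum the binomial is known only to low order, but the theta term beside it has high
-- order.
≈-⊗-≈𝟎 : ∀ {f g h} M N → f ≈ g [ X^ M ] → h ≈ 𝟎 [ X^ N ] → f ⊗ h ≈ g ⊗ h [ X^ (M + N) ]
≈-⊗-≈𝟎 {f} {g} {h} M N (by k e) r = ≈-trans (≋⇒≈ (begin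
    f ⊗ h                     ≈⟨ ⊗-cong e ≋-refl ⟩
    (g ⊕ X^ M ⊗ k) ⊗ h        ≈⟨ ⊗-distribʳ h g _ ⟩
    g ⊗ h ⊕ X^ M ⊗ k ⊗ h      ∎))
  (≈-trans (≈-⊕ ≈-refl (≈𝟎-X^-⊗ M N (≈𝟎-⊗ˡ (X^≈𝟎 ℕ.≤-refl)) r)) (≋⇒≈ (⊕-identityʳ _)))
  where open ≋-Reasoning

⊟-≈𝟎 : ∀ {f m} → f ≈ 𝟎 [ m ] → ⊟ f ≈ 𝟎 [ m ]
⊟-≈𝟎 {f} p = ≈-trans (≋⇒≈ (solve 1 (λ f → :- f := f :* con (ℤ.- 1ℤ)) ≋-refl f)) (≈𝟎-⊗ˡ p)

𝟏⊕≈𝟏 : ∀ {f m} → f ≈ 𝟎 [ m ] → 𝟏 ⊕ f ≈ 𝟏 [ m ]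
𝟏⊕≈𝟏 p = ≈-trans (≈-⊕ ≈-refl p) (≋⇒≈ (⊕-identityʳ 𝟏))

lim-⊗ : ∀ {s t} → Cauchy s → Cauchy t → ∀ N → lim s ⊗ lim t ≈ s N ⊗ t N [ X^ N ]
lim-⊗ c d N = ≈-⊗ (lim-≈ c ℕ.≤-refl) (lim-≈ d ℕ.≤-refl)

lim-cong : ∀ {s t} → Cauchy s → Cauchy t → (∀ N → s N ≋ t N) → lim s ≋ lim t
lim-cong c d p = lim-unique d λ N → ≈-trans (lim-≈ c ℕ.≤-refl) (≋⇒≈ (p N))

lim-coeff₀ : ∀ {s} → (∀ n → s n 0 ≡ 1ℤ) → lim s 0 ≡ 1ℤ
lim-coeff₀ {s} p = trans (lim-coeff s 0) (p 1)

-- The Jacobi triple product, as the limit of Cauchy's finite form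
--   Σ_k [a+b choose k]_Q x^{(a-k)(a-k+1)/2} y^{(a-k)(a-k-1)/2} = (-x;Q)_a (-y;Q)_b ,  xy = Q.
module TripleProduct
  (Q : Series) (Q-small : Q ≈ 𝟎 [ X^ 1 ])
  where

  -- Gaussian binomial coefficients in base Q, given by the q-Pascal rule and hence without
  -- division.
  bin : ℕ → ℕ → Series
  bin _       zero    = 𝟏
  bin zero    (suc k) = 𝟎
  bin (suc M) (suc k) = bin M k ⊕ Q ^ˢ suc k ⊗ bin M (suc k)

  bin-vanish : ∀ {M k} → M < k → bin M k ≋ 𝟎
  bin-vanish {zero}  {suc k} _         = ≋-refl
  bin-vanish {suc M} {suc k} (s≤s M<k) = begin
    bin M k ⊕ Q ^ˢ suc k ⊗ bin M (suc k)  ≈⟨ ⊕-cong (bin-vanish M<k) (⊗-cong ≋-refl (bin-vanish (ℕ.m<n⇒m<1+n M<k))) ⟩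
    𝟎 ⊕ Q ^ˢ suc k ⊗ 𝟎                    ≈⟨ ⊕-identityˡ _ ⟩
    Q ^ˢ suc k ⊗ 𝟎                        ≈⟨ ⊗-zeroʳ _ ⟩
    𝟎                                     ∎
    where open ≋-Reasoning

  factorQ : ℕ → Series
  factorQ i = 𝟏 ⊕ ⊟ Q ^ˢ suc i

  factorial : ℕ → Series
  factorial = Π[ factorQ ]

  bin-diag : ∀ k → bin k k ≋ 𝟏
  bin-diag zero    = ≋-refl
  bin-diag (suc k) = ≋-trans (⊕-cong (bin-diag k) (≋-trans (⊗-cong ≋-refl (bin-vanish (ℕ.n<1+n k))) (⊗-zeroʳ _))) (⊕-identityʳ 𝟏)

  ^ˢ-+ : ∀ m n → Q ^ˢ m ⊗ Q ^ˢ n ≋ Q ^ˢ (m + n)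
  ^ˢ-+ zero    n = ⊗-identityˡ _
  ^ˢ-+ (suc m) n = begin
    Q ^ˢ m ⊗ Q ⊗ Q ^ˢ n    ≈⟨ solve 3 (λ a q b → a :* q :* b := a :* b :* q) ≋-refl _ Q _ ⟩
    Q ^ˢ m ⊗ Q ^ˢ n ⊗ Q    ≈⟨ ⊗-cong (^ˢ-+ m n) ≋-refl ⟩
    Q ^ˢ (m + n) ⊗ Q       ∎
    where open ≋-Reasoning

  -- After the q-Pascal rule the step is (1 - Q^(k+1)) + Q^(k+1) (1 - Q^(l+1)) = 1 - Q^(k+l+2).
  bin-factorial : ∀ k l → bin (k + l) k ⊗ factorial k ⊗ factorial l ≋ factorial (k + l)
  bin-factorial zero    l = ≋-trans (⊗-cong (⊗-identityˡ 𝟏) ≋-refl) (⊗-identityˡ _)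
  bin-factorial (suc k) zero = subst (λ n → bin n (suc k) ⊗ factorial (suc k) ⊗ 𝟏 ≋ factorial n)
    (sym (ℕ.+-identityʳ (suc k)))
    (≋-trans (⊗-identityʳ _) (≋-trans (⊗-cong (bin-diag (suc k)) ≋-refl) (⊗-identityˡ _)))
  bin-factorial (suc k) (suc l) = begin
    (bin n k ⊕ Q ^ˢ suc k ⊗ bin n (suc k)) ⊗ factorial (suc k) ⊗ factorial (suc l)
      ≈⟨ solve 7 (λ b u c f g v w →
           (b :+ u :* c) :* (f :* w) :* (g :* v)
             := b :* f :* (g :* v) :* w :+ u :* v :* (c :* (f :* w) :* g))
           ≋-refl (bin n k) (Q ^ˢ suc k) (bin n (suc k)) (factorial k) (factorial l) (factorQ l) (factorQ k) ⟩
    bin n k ⊗ factorial k ⊗ factorial (suc l) ⊗ factorQ k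
      ⊕ Q ^ˢ suc k ⊗ factorQ l ⊗ (bin n (suc k) ⊗ factorial (suc k) ⊗ factorial l)
      ≈⟨ ⊕-cong (⊗-cong (bin-factorial k (suc l)) ≋-refl)
           (⊗-cong ≋-refl (subst (λ j → bin j (suc k) ⊗ factorial (suc k) ⊗ factorial l ≋ factorial j)
             (sym (ℕ.+-suc k l)) (bin-factorial (suc k) l))) ⟩
    factorial n ⊗ factorQ k ⊕ Q ^ˢ suc k ⊗ factorQ l ⊗ factorial n
      -- The solver takes 𝟏 for an atom e, so a difference e - 1 remains, to be removed by `κ-1` in
      -- the next step.
      ≈⟨ solve 4 (λ f u v e → f :* (e :+ :- u) :+ u :* (e :+ :- v) :* f := f :* (e :+ u :* (e :+ :- con 1ℤ) :+ :- (u :* v)))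
           ≋-refl (factorial n) (Q ^ˢ suc k) (Q ^ˢ suc l) 𝟏 ⟩
    factorial n ⊗ (𝟏 ⊕ Q ^ˢ suc k ⊗ (𝟏 ⊕ ⊟ κ 1ℤ) ⊕ ⊟ (Q ^ˢ suc k ⊗ Q ^ˢ suc l))
      ≈⟨ ⊗-cong ≋-refl (⊕-cong (≋-trans (⊕-cong ≋-refl (⊗-cong ≋-refl (⊕-cong (≋-sym κ-1) ≋-refl)))
           (solve 2 (λ e u → e :+ u :* (con 1ℤ :+ :- con 1ℤ) := e) ≋-refl 𝟏 (Q ^ˢ suc k))) (⊟-cong (^ˢ-+ (suc k) (suc l)))) ⟩
    factorial n ⊗ factorQ n ∎
    where
    open ≋-Reasoning
    n = k + suc l

  factorQ-≈𝟏 : ∀ k → factorQ k ≈ 𝟏 [ X^ (suc k) ]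
  factorQ-≈𝟏 k = 𝟏⊕≈𝟏 (⊟-≈𝟎 (^ˢ-≈𝟎 Q-small (suc k)))

  factorial-Cauchy : Cauchy factorial
  factorial-Cauchy = Π-Cauchy λ k → ≈-precision (ℕ.n≤1+n k) (factorQ-≈𝟏 k)

  factorial∞ : Series
  factorial∞ = lim factorial

  factorial∞-coeff₀ : factorial∞ 0 ≡ 1ℤ
  factorial∞-coeff₀ = lim-coeff₀ {factorial} go
    where
    go : ∀ n → factorial n 0 ≡ 1ℤ
    go zero    = X^0-coeff-zero
    go (suc n) = ⊗-coeff₀ (go n) (trans (≈⇒coeff (factorQ-≈𝟏 n) (s≤s z≤n)) X^0-coeff-zero)

  -- Times another (Q;Q)∞ the claim becomes `bin-factorial`, since to precision m the three infinite
  -- products may be replaced by (Q;Q) with k, l and k + l factors.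
  bin-≈ : ∀ k l m → m ≤ k → m ≤ l → factorial∞ ⊗ bin (k + l) k ≈ 𝟏 [ X^ m ]
  bin-≈ k l m m≤k m≤l = ≈-cancelʳ factorial∞-coeff₀
    (≈-trans (≋⇒≈ (solve 2 (λ b f → f :* b :* f := b :* f :* f) ≋-refl (bin (k + l) k) factorial∞))
    (≈-trans (≈-⊗ (≈-⊗ ≈-refl (lim-≈ factorial-Cauchy m≤k)) (lim-≈ factorial-Cauchy m≤l))
    (≈-trans (≋⇒≈ (bin-factorial k l))
    (≈-trans (≈-sym (lim-≈ factorial-Cauchy (ℕ.≤-trans m≤k (ℕ.m≤m+n k l))))
             (≋⇒≈ (≋-sym (⊗-identityˡ _)))))))

  rising : Series → ℕ → Series
  rising x = Π[ (λ i → 𝟏 ⊕ x ⊗ Q ^ˢ i) ]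

  rising-Cauchy : ∀ {x} → x ≈ 𝟎 [ X^ 1 ] → Cauchy (rising x)
  rising-Cauchy p = Π-Cauchy λ k → 𝟏⊕≈𝟏 (≈-precision (ℕ.n≤1+n k) (≈𝟎-X^-⊗ 1 k p (^ˢ-≈𝟎 Q-small k)))

  -- term x t = x^t Q^{t(t-1)/2}
  term : Series → ℕ → Series
  term x zero    = 𝟏
  term x (suc t) = term x t ⊗ x ⊗ Q ^ˢ t

  term-≈𝟎 : ∀ {x} → x ≈ 𝟎 [ X^ 1 ] → ∀ t → term x t ≈ 𝟎 [ X^ t ]
  term-≈𝟎 p zero    = X^≈𝟎 z≤n
  term-≈𝟎 {x} p (suc t) = ≈𝟎-⊗ˡ (subst (λ k → term x t ⊗ x ≈ 𝟎 [ X^ k ]) (ℕ.+-comm t 1) (≈𝟎-X^-⊗ t 1 (term-≈𝟎 p t) p))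

  term-shift : ∀ y t → term (y ⊗ Q) t ≋ Q ^ˢ t ⊗ term y t
  term-shift y zero    = ≋-sym (⊗-identityˡ 𝟏)
  term-shift y (suc t) = begin
    term (y ⊗ Q) t ⊗ (y ⊗ Q) ⊗ Q ^ˢ t      ≈⟨ ⊗-cong (⊗-cong (term-shift y t) ≋-refl) ≋-refl ⟩
    Q ^ˢ t ⊗ term y t ⊗ (y ⊗ Q) ⊗ Q ^ˢ t
      ≈⟨ solve 4 (λ p n y q → p :* n :* (y :* q) :* p := p :* q :* (n :* y :* p)) ≋-refl (Q ^ˢ t) (term y t) y Q ⟩
    Q ^ˢ t ⊗ Q ⊗ (term y t ⊗ y ⊗ Q ^ˢ t)   ∎
    where open ≋-Reasoning

  -- When xy = Q, the term x^t Q^(t(t-1)/2) at t = -s equals y^s Q^(s(s-1)/2). Writing the negative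
  -- half through y keeps the bilateral series free of negative powers.
  theta-partial : Series → Series → ℕ → Series
  theta-partial x y n = 𝟏 ⊕ Σ[ (λ t → term x (suc t) ⊕ term y (suc t)) ] n

  theta-Cauchy : ∀ {x y} → x ≈ 𝟎 [ X^ 1 ] → y ≈ 𝟎 [ X^ 1 ] → Cauchy (theta-partial x y)
  theta-Cauchy p r k = ≈-⊕ ≈-refl (Σ-Cauchy (λ k → ≈-trans
    (≈-precision (ℕ.n≤1+n k) (≈-⊕ (term-≈𝟎 p (suc k)) (term-≈𝟎 r (suc k)))) (≋⇒≈ (⊕-identityʳ 𝟎))) k)

  -- The q-Pascal rule and `term-shift` turn the sum for b + 1 at y into (1 + y) times the sum for b
  -- at yQ, so the induction has to range over all y.
  cauchy-binomial : ∀ y b → Σ[ (λ k → bin b k ⊗ term y k) ] (suc b) ≋ rising y b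
  cauchy-binomial y zero    = ≋-trans (⊕-identityˡ _) (⊗-identityˡ 𝟏)
  cauchy-binomial y (suc b) = begin
    Σ[ (λ k → bin (suc b) k ⊗ term y k) ] (suc (suc b))
      ≈⟨ Σ-suc (λ k → bin (suc b) k ⊗ term y k) (suc b) ⟩
    𝟏 ⊗ 𝟏 ⊕ Σ[ (λ k → (bin b k ⊕ Q ^ˢ suc k ⊗ bin b (suc k)) ⊗ term y (suc k)) ] (suc b)
      ≈⟨ ⊕-cong (≋-sym (⊗-cong (⊗-identityˡ 𝟏) ≋-refl)) (≋-trans (Σ-cong (suc b) (λ k _ → pascal k)) (Σ-⊕ _ _ (suc b))) ⟩
    𝟏 ⊗ 𝟏 ⊗ 𝟏 ⊕ (Σ[ (λ k → y ⊗ (bin b k ⊗ term (y ⊗ Q) k)) ] (suc b)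
      ⊕ Σ[ (λ k → Q ^ˢ suc k ⊗ bin b (suc k) ⊗ term y (suc k)) ] (suc b))
      ≈⟨ solve 3 (λ a s t → a :+ (s :+ t) := s :+ (a :+ t)) ≋-refl _ _ _ ⟩
    Σ[ (λ k → y ⊗ (bin b k ⊗ term (y ⊗ Q) k)) ] (suc b)
      ⊕ (𝟏 ⊗ 𝟏 ⊗ 𝟏 ⊕ Σ[ (λ k → Q ^ˢ suc k ⊗ bin b (suc k) ⊗ term y (suc k)) ] (suc b))
      ≈⟨ ⊕-cong (≋-sym (Σ-⊗ y (λ k → bin b k ⊗ term (y ⊗ Q) k) (suc b)))
           (≋-trans (≋-sym (Σ-suc (λ k → Q ^ˢ k ⊗ bin b k ⊗ term y k) (suc b))) (Σ-cong (suc (suc b)) λ k _ → shift k)) ⟩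
    y ⊗ S ⊕ (S ⊕ bin b (suc b) ⊗ term (y ⊗ Q) (suc b))
      ≈⟨ ⊕-cong ≋-refl (⊕-cong ≋-refl (≋-trans (⊗-cong (bin-vanish (ℕ.n<1+n b)) ≋-refl) (⊗-zeroˡ _))) ⟩
    y ⊗ S ⊕ (S ⊕ 𝟎)
      ≈⟨ ≋-trans (⊕-cong ≋-refl (≋-trans (⊕-identityʳ S) (≋-sym (⊗-identityˡ S))))
           (solve 3 (λ y s e → y :* s :+ e :* s := (e :+ y :* con 1ℤ) :* s) ≋-refl y S 𝟏) ⟩
    (𝟏 ⊕ y ⊗ κ 1ℤ) ⊗ S
      ≈⟨ ⊗-cong (⊕-cong ≋-refl (⊗-cong ≋-refl κ-1)) (cauchy-binomial (y ⊗ Q) b) ⟩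
    (𝟏 ⊕ y ⊗ 𝟏) ⊗ rising (y ⊗ Q) b
      ≈⟨ ⊗-cong ≋-refl (Π-cong b λ k _ → ⊕-cong ≋-refl
           (solve 3 (λ y q p → y :* q :* p := y :* (p :* q)) ≋-refl y Q (Q ^ˢ k))) ⟩
    (𝟏 ⊕ y ⊗ 𝟏) ⊗ Π[ (λ i → 𝟏 ⊕ y ⊗ Q ^ˢ suc i) ] b
      ≈⟨ Π-suc (λ i → 𝟏 ⊕ y ⊗ Q ^ˢ i) b ⟨
    rising y (suc b) ∎
    where
    open ≋-Reasoning
    S = Σ[ (λ k → bin b k ⊗ term (y ⊗ Q) k) ] (suc b)
    pascal : ∀ k → (bin b k ⊕ Q ^ˢ suc k ⊗ bin b (suc k)) ⊗ term y (suc k)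
                 ≋ y ⊗ (bin b k ⊗ term (y ⊗ Q) k) ⊕ Q ^ˢ suc k ⊗ bin b (suc k) ⊗ term y (suc k)
    pascal k = ≋-trans (⊗-distribʳ _ _ _) (⊕-cong (begin
      bin b k ⊗ (term y k ⊗ y ⊗ Q ^ˢ k)
        ≈⟨ solve 4 (λ b n y p → b :* (n :* y :* p) := y :* (b :* (p :* n))) ≋-refl (bin b k) (term y k) y (Q ^ˢ k) ⟩
      y ⊗ (bin b k ⊗ (Q ^ˢ k ⊗ term y k))
        ≈⟨ ⊗-cong ≋-refl (⊗-cong ≋-refl (term-shift y k)) ⟨
      y ⊗ (bin b k ⊗ term (y ⊗ Q) k) ∎) ≋-refl)
    shift : ∀ k → Q ^ˢ k ⊗ bin b k ⊗ term y k ≋ bin b k ⊗ term (y ⊗ Q) k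
    shift k = ≋-trans (solve 3 (λ p b n → p :* b :* n := b :* (p :* n)) ≋-refl (Q ^ˢ k) (bin b k) (term y k))
                      (⊗-cong ≋-refl (≋-sym (term-shift y k)))

  module _ (x y : Series) (xy≋Q : x ⊗ y ≋ Q) (x-small : x ≈ 𝟎 [ X^ 1 ]) (y-small : y ≈ 𝟎 [ X^ 1 ]) where

    -- bilateral a k = x^{(a-k)(a-k+1)/2} y^{(a-k)(a-k-1)/2}
    bilateral : ℕ → ℕ → Series
    bilateral a       zero    = term x a
    bilateral zero    (suc k) = term y (suc k)
    bilateral (suc a) (suc k) = bilateral a k

    bilateral-zero : ∀ k → bilateral 0 k ≡ term y k
    bilateral-zero zero    = refl
    bilateral-zero (suc k) = refl

    bilateral-+ˡ : ∀ k d → bilateral (k + d) k ≡ term x d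
    bilateral-+ˡ zero    d = refl
    bilateral-+ˡ (suc k) d = bilateral-+ˡ k d

    bilateral-+ʳ : ∀ a d → bilateral a (a + d) ≡ term y d
    bilateral-+ʳ zero    d = bilateral-zero d
    bilateral-+ʳ (suc a) d = bilateral-+ʳ a d

    -- With d = a - k, raising a multiplies the term by x^(d+1) y^d = x Q^d. As d may be negative,
    -- Q^k is placed on the left.
    bilateral-step : ∀ a k → Q ^ˢ k ⊗ bilateral (suc a) k ≋ x ⊗ Q ^ˢ a ⊗ bilateral a k
    bilateral-step a zero = ≋-trans (⊗-identityˡ _)
      (solve 3 (λ n x p → n :* x :* p := x :* p :* n) ≋-refl (term x a) x (Q ^ˢ a))
    bilateral-step zero (suc k) = begin
      Q ^ˢ k ⊗ Q ⊗ bilateral 0 k   ≈⟨ ⊗-cong (⊗-cong ≋-refl (≋-sym xy≋Q)) (≡⇒≋ (bilateral-zero k)) ⟩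
      Q ^ˢ k ⊗ (x ⊗ y) ⊗ term y k  ≈⟨ ⊗-identityˡ _ ⟨
      𝟏 ⊗ (Q ^ˢ k ⊗ (x ⊗ y) ⊗ term y k)
        ≈⟨ solve 5 (λ e p x y n → e :* (p :* (x :* y) :* n) := x :* e :* (n :* y :* p)) ≋-refl 𝟏 (Q ^ˢ k) x y (term y k) ⟩
      x ⊗ 𝟏 ⊗ term y (suc k) ∎
      where open ≋-Reasoning
    bilateral-step (suc a) (suc k) = begin
      Q ^ˢ k ⊗ Q ⊗ bilateral (suc a) k       ≈⟨ solve 3 (λ p q z → p :* q :* z := p :* z :* q) ≋-refl _ Q _ ⟩
      Q ^ˢ k ⊗ bilateral (suc a) k ⊗ Q       ≈⟨ ⊗-cong (bilateral-step a k) ≋-refl ⟩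
      x ⊗ Q ^ˢ a ⊗ bilateral a k ⊗ Q         ≈⟨ solve 4 (λ x p z q → x :* p :* z :* q := x :* (p :* q) :* z) ≋-refl x _ _ Q ⟩
      x ⊗ Q ^ˢ suc a ⊗ bilateral a k         ∎
      where open ≋-Reasoning

    S : ℕ → ℕ → ℕ → Series
    S a M = Σ[ (λ k → bin M k ⊗ bilateral a k) ]

    S-step : ∀ a M n → S (suc a) (suc M) (suc n) ≋ S a M n ⊕ x ⊗ Q ^ˢ a ⊗ S a M (suc n)
    S-step a M n = begin
      S (suc a) (suc M) (suc n)
        ≈⟨ Σ-suc (λ k → bin (suc M) k ⊗ bilateral (suc a) k) n ⟩
      𝟏 ⊗ B 0 ⊕ Σ[ (λ k → (bin M k ⊕ Q ^ˢ suc k ⊗ bin M (suc k)) ⊗ bilateral a k) ] n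
        ≈⟨ ⊕-cong (≋-sym (⊗-cong (⊗-identityˡ 𝟏) ≋-refl))
             (≋-trans (Σ-cong n λ k _ → ⊗-distribʳ _ _ _) (Σ-⊕ _ _ n)) ⟩
      𝟏 ⊗ 𝟏 ⊗ B 0 ⊕ (S a M n ⊕ Σ[ (λ k → Q ^ˢ suc k ⊗ bin M (suc k) ⊗ B (suc k)) ] n)
        ≈⟨ solve 3 (λ a s t → a :+ (s :+ t) := s :+ (a :+ t)) ≋-refl _ _ _ ⟩
      S a M n ⊕ (𝟏 ⊗ 𝟏 ⊗ B 0 ⊕ Σ[ (λ k → Q ^ˢ suc k ⊗ bin M (suc k) ⊗ B (suc k)) ] n)
        ≈⟨ ⊕-cong ≋-refl (Σ-suc (λ k → Q ^ˢ k ⊗ bin M k ⊗ B k) n) ⟨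
      S a M n ⊕ Σ[ (λ k → Q ^ˢ k ⊗ bin M k ⊗ B k) ] (suc n)
        ≈⟨ ⊕-cong ≋-refl (Σ-cong (suc n) λ k _ → step k) ⟩
      S a M n ⊕ Σ[ (λ k → x ⊗ Q ^ˢ a ⊗ (bin M k ⊗ bilateral a k)) ] (suc n)
        ≈⟨ ⊕-cong ≋-refl (Σ-⊗ (x ⊗ Q ^ˢ a) _ (suc n)) ⟨
      S a M n ⊕ x ⊗ Q ^ˢ a ⊗ S a M (suc n) ∎
      where
      open ≋-Reasoning
      B = bilateral (suc a)
      step : ∀ k → Q ^ˢ k ⊗ bin M k ⊗ B k ≋ x ⊗ Q ^ˢ a ⊗ (bin M k ⊗ bilateral a k)
      step k = ≋-trans (solve 3 (λ p b z → p :* b :* z := b :* (p :* z)) ≋-refl _ _ _)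
        (≋-trans (⊗-cong ≋-refl (bilateral-step a k))
          (solve 4 (λ b x p z → b :* (x :* p :* z) := x :* p :* (b :* z)) ≋-refl _ _ _ _))

    finite-triple-product : ∀ a b → S a (a + b) (suc (a + b)) ≋ rising x a ⊗ rising y b
    finite-triple-product zero    b = ≋-trans
      (Σ-cong (suc b) λ k _ → ⊗-cong ≋-refl (≡⇒≋ (bilateral-zero k)))
      (≋-trans (cauchy-binomial y b) (≋-sym (⊗-identityˡ _)))
    finite-triple-product (suc a) b = begin
      S (suc a) (suc M) (suc (suc M))
        ≈⟨ S-step a M (suc M) ⟩
      S a M (suc M) ⊕ u ⊗ (S a M (suc M) ⊕ bin M (suc M) ⊗ bilateral a (suc M))
        ≈⟨ ⊕-cong (≋-sym (⊗-identityˡ _)) (⊗-cong ≋-refl (≋-trans (⊕-cong ≋-refl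
             (≋-trans (⊗-cong (bin-vanish (ℕ.n<1+n M)) ≋-refl) (⊗-zeroˡ _))) (⊕-identityʳ _))) ⟩
      𝟏 ⊗ S a M (suc M) ⊕ u ⊗ S a M (suc M)
        ≈⟨ ⊗-distribʳ _ 𝟏 u ⟨
      (𝟏 ⊕ u) ⊗ S a M (suc M)
        ≈⟨ ⊗-cong ≋-refl (finite-triple-product a b) ⟩
      (𝟏 ⊕ u) ⊗ (rising x a ⊗ rising y b)
        ≈⟨ solve 3 (λ u r s → u :* (r :* s) := r :* u :* s) ≋-refl _ _ _ ⟩
      rising x (suc a) ⊗ rising y b ∎
      where
      open ≋-Reasoning
      M = a + b
      u = x ⊗ Q ^ˢ a

    bilateral-sum : ∀ n → Σ[ bilateral n ] (suc (n + n)) ≋ theta-partial x y n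
    bilateral-sum zero    = ⊕-comm 𝟎 𝟏
      where
      ⊕-comm : ∀ f g → f ⊕ g ≋ g ⊕ f
      ⊕-comm = solve 2 (λ f g → f :+ g := g :+ f) ≋-refl
    bilateral-sum (suc n) = begin
      Σ[ bilateral (suc n) ] (suc (suc n + suc n))
        ≈⟨ Σ-suc (bilateral (suc n)) (suc n + suc n) ⟩
      term x (suc n) ⊕ Σ[ bilateral n ] (suc (n + suc n))
        ≈⟨ ⊕-cong ≋-refl (⊕-cong (≋-trans (≡⇒≋ (cong Σ[ bilateral n ] (ℕ.+-suc n n))) (bilateral-sum n))
             (≡⇒≋ (bilateral-+ʳ n (suc n)))) ⟩
      term x (suc n) ⊕ (𝟏 ⊕ Σ[ F ] n ⊕ term y (suc n))
        ≈⟨ solve 4 (λ a e s b → a :+ (e :+ s :+ b) := e :+ (s :+ (a :+ b))) ≋-refl _ 𝟏 _ _ ⟩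
      theta-partial x y (suc n) ∎
      where
      open ≋-Reasoning
      F = λ t → term x (suc t) ⊕ term y (suc t)

    -- Two precisions add up to n. For k ≤ n the normalised binomial is 1 modulo q^k and the theta
    -- term has order at least n - k; for k ≥ n the same holds with 2n - k and k - n.
    normalised-term : ∀ n k → k < suc (n + n) →
      factorial∞ ⊗ (bin (n + n) k ⊗ bilateral n k) ≈ bilateral n k [ X^ n ]
    normalised-term n k (s≤s k≤2n) with ℕ.≤-total k n
    ... | inj₁ k≤n = subst (λ j → factorial∞ ⊗ (bin (n + n) k ⊗ bilateral n k) ≈ bilateral n k [ X^ j ]) k+d≡n
      (≈-trans (≋⇒≈ (≋-sym (⊗-assoc factorial∞ _ _))) (≈-trans
        (≈-⊗-≈𝟎 k (n ∸ k) (subst (λ j → factorial∞ ⊗ bin j k ≈ 𝟏 [ X^ k ]) (ℕ.m+[n∸m]≡n k≤2n)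
            (bin-≈ k (n + n ∸ k) k ℕ.≤-refl (ℕ.≤-trans k≤n (ℕ.m+n≤o⇒m≤o∸n n (ℕ.+-monoʳ-≤ n k≤n)))))
          (subst (_≈ 𝟎 [ X^ (n ∸ k) ]) (sym (trans (cong (λ j → bilateral j k) (sym k+d≡n)) (bilateral-+ˡ k (n ∸ k))))
            (term-≈𝟎 x-small (n ∸ k))))
        (≋⇒≈ (⊗-identityˡ _))))
      where
      k+d≡n : k + (n ∸ k) ≡ n
      k+d≡n = ℕ.m+[n∸m]≡n k≤n
    ... | inj₂ n≤k = subst (λ j → factorial∞ ⊗ (bin (n + n) k ⊗ bilateral n k) ≈ bilateral n k [ X^ j ]) l+d≡n
      (≈-trans (≋⇒≈ (≋-sym (⊗-assoc factorial∞ _ _))) (≈-trans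
        (≈-⊗-≈𝟎 l (k ∸ n) (subst (λ j → factorial∞ ⊗ bin j k ≈ 𝟏 [ X^ l ]) (ℕ.m+[n∸m]≡n k≤2n)
            (bin-≈ k l l (ℕ.≤-trans l≤n n≤k) ℕ.≤-refl))
          (subst (_≈ 𝟎 [ X^ (k ∸ n) ]) (sym (trans (cong (bilateral n) (sym n+d≡k)) (bilateral-+ʳ n (k ∸ n))))
            (term-≈𝟎 y-small (k ∸ n))))
        (≋⇒≈ (⊗-identityˡ _))))
      where
      l = n + n ∸ k
      n+d≡k : n + (k ∸ n) ≡ k
      n+d≡k = ℕ.m+[n∸m]≡n n≤k
      l≤n : l ≤ n
      l≤n = subst (l ≤_) (ℕ.m+n∸n≡m n n) (ℕ.∸-monoʳ-≤ (n + n) n≤k)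
      l+d≡n : l + (k ∸ n) ≡ n
      l+d≡n = ℕ.+-cancelˡ-≡ n (l + (k ∸ n)) n (begin
        n + (l + (k ∸ n))     ≡⟨ cong (_+_ n) (ℕ.+-comm l (k ∸ n)) ⟩
        n + ((k ∸ n) + l)     ≡⟨ ℕ.+-assoc n (k ∸ n) l ⟨
        n + (k ∸ n) + l       ≡⟨ cong (_+ l) n+d≡k ⟩
        k + l                 ≡⟨ ℕ.m+[n∸m]≡n k≤2n ⟩
        n + n                 ∎)
        where open ≡-Reasoning

    triple-product : lim (theta-partial x y) ≋ factorial∞ ⊗ (lim (rising x) ⊗ lim (rising y))
    triple-product = ≈⇒≋ λ n →
      ≈-trans (lim-≈ (theta-Cauchy x-small y-small) {n} ℕ.≤-refl)
      (≈-trans (≋⇒≈ (≋-sym (bilateral-sum n)))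
      (≈-trans (Σ-≈ (suc (n + n)) λ k l → ≈-sym (normalised-term n k l))
      (≈-trans (≋⇒≈ (≋-trans (≋-sym (Σ-⊗ factorial∞ (λ k → bin (n + n) k ⊗ bilateral n k) (suc (n + n))))
                 (⊗-cong ≋-refl (finite-triple-product n n))))
      (≈-⊗ ≈-refl (≈-sym (lim-⊗ (rising-Cauchy x-small) (rising-Cauchy y-small) n))))))

-- The recurrence for G_K

infixl 6 _⊝ˢ_
_⊝ˢ_ : Series → Series → Series
f ⊝ˢ g = f ⊕ ⊟ g

opaque
  unfolding _⊕_
  ⊖-defn : ∀ f g → f ⊖ g ≋ f ⊝ˢ g
  ⊖-defn f g .coeff n = refl

odd : ℕ → ℕ
odd k = suc (k + k)

X^-cong : ∀ {a b} → a ≡ b → X^ a ≋ X^ b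
X^-cong refl = ≋-refl

1-X^-coeff₀ : ∀ k → (𝟏 ⊝ˢ X^ (suc k)) 0 ≡ 1ℤ
1-X^-coeff₀ k = trans (⊕-coeff _ _ 0) (cong₂ ℤ._+_ X^0-coeff-zero
  (trans (⊟-coeff _ 0) (cong ℤ.-_ (X^suc-coeff-zero k))))

-- With p = q² and x = q^(2K+1), summand K m = ∏_{i=1}^{m} (p^{2i-1} + x p^{i-1}) / (1 - x p^{i-1}).
summand : ℕ → ℕ → Series
summand K zero    = 𝟏
summand K (suc m) =
  (summand K m ⊗ (X^ (odd m + odd m) ⊕ X^ (odd (K + m)))) ⊘ (𝟏 ⊝ˢ X^ (odd (K + m)))

summand-suc : ∀ K m → summand K (suc m) ⊗ (𝟏 ⊝ˢ X^ (odd (K + m)))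
                    ≋ summand K m ⊗ (X^ (odd m + odd m) ⊕ X^ (odd (K + m)))
summand-suc K m = ⊘-⊗ _ (1-X^-coeff₀ _)

summand-≈𝟎 : ∀ K m → summand K m ≈ 𝟎 [ X^ m ]
summand-≈𝟎 K zero    = X^≈𝟎 z≤n
summand-≈𝟎 K (suc m) = ≈-cancelʳ (1-X^-coeff₀ _)
  (≈-trans (≋⇒≈ (summand-suc K m))
  (≈-trans (subst (λ k → summand K m ⊗ (X^ (odd m + odd m) ⊕ X^ (odd (K + m))) ≈ 𝟎 [ X^ k ]) (ℕ.+-comm m 1)
    (≈𝟎-X^-⊗ m 1 (summand-≈𝟎 K m)
      (≈-trans (≈-⊕ (X^≈𝟎 (s≤s z≤n)) (X^≈𝟎 (s≤s z≤n))) (≋⇒≈ (⊕-identityʳ 𝟎)))))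
  (≋⇒≈ (≋-sym (⊗-zeroˡ _)))))

partialG : ℕ → ℕ → Series
partialG K = Σ[ summand K ]

partialG-Cauchy : ∀ K → Cauchy (partialG K)
partialG-Cauchy K = Σ-Cauchy (summand-≈𝟎 K)

G : ℕ → Series
G K = lim (partialG K)

module Telescope (K : ℕ) where

  x = X^ (odd K)

  u : ℕ → Series
  u m = X^ (m + m)

  xu : ℕ → Series
  xu m = X^ (odd (K + m))

  xu-defn : ∀ m → x ⊗ u m ≋ xu m
  xu-defn m = ≋-trans (X^-+ (odd K) (m + m)) (X^-cong (exponent K m))
    where
    exponent : ∀ K m → suc (K + K) + (m + m) ≡ suc (K + m + (K + m))
    exponent = solveℕ-∀

  u-suc : ∀ m → X^ 2 ⊗ u m ≋ u (suc m)
  u-suc m = ≋-trans (X^-+ 2 (m + m)) (X^-cong (cong suc (sym (ℕ.+-suc m m))))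

  xu-shift : ∀ m → X^ (odd (suc K + m)) ≋ xu (suc m)
  xu-shift m = X^-cong (cong odd (sym (ℕ.+-suc K m)))

  -- ρ m is p^{-m} times summand (K+1) m, written without negative powers of q.
  ρ : ℕ → Series
  ρ zero    = 𝟏
  ρ (suc m) = (ρ m ⊗ (u m ⊗ (u m ⊕ x))) ⊘ (𝟏 ⊝ˢ xu (suc m))

  ρ-suc : ∀ m → ρ (suc m) ⊗ (𝟏 ⊝ˢ xu (suc m)) ≋ ρ m ⊗ (u m ⊗ (u m ⊕ x))
  ρ-suc m = ⊘-⊗ _ (1-X^-coeff₀ _)

  -- This makes the boundary term of `telescope` vanish in the limit. The step from ρ 0 to ρ 1 has
  -- numerator 1 + x and gains no power of q, for which the factor x compensates; in every later
  -- step `u m` contributes at least one.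
  xρ-≈𝟎 : ∀ m → x ⊗ ρ m ≈ 𝟎 [ X^ m ]
  xρ-≈𝟎 m = ≈-trans (≋⇒≈ (⊗-comm x (ρ m))) (go m)
    where
    step : ∀ m → ρ m ⊗ x ⊗ (u m ⊗ (u m ⊕ x)) ≈ 𝟎 [ X^ (suc m) ] → ρ (suc m) ⊗ x ≈ 𝟎 [ X^ (suc m) ]
    step m p = ≈-cancelʳ (1-X^-coeff₀ (K + suc m + (K + suc m)))
      (≈-trans (≋⇒≈ (begin
        ρ (suc m) ⊗ x ⊗ (𝟏 ⊝ˢ xu (suc m))     ≈⟨ solve 3 (λ r x d → r :* x :* d := r :* d :* x) ≋-refl _ x _ ⟩
        ρ (suc m) ⊗ (𝟏 ⊝ˢ xu (suc m)) ⊗ x     ≈⟨ ⊗-cong (ρ-suc m) ≋-refl ⟩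
        ρ m ⊗ (u m ⊗ (u m ⊕ x)) ⊗ x           ≈⟨ solve 3 (λ r d x → r :* d :* x := r :* x :* d) ≋-refl _ _ x ⟩
        ρ m ⊗ x ⊗ (u m ⊗ (u m ⊕ x))           ∎))
      (≈-trans p (≋⇒≈ (≋-sym (⊗-zeroˡ _)))))
      where open ≋-Reasoning
    go : ∀ m → ρ m ⊗ x ≈ 𝟎 [ X^ m ]
    go zero          = X^≈𝟎′
      where
      X^≈𝟎′ : 𝟏 ⊗ x ≈ 𝟎 [ X^ 0 ]
      X^≈𝟎′ = ≈-trans (≋⇒≈ (⊗-identityˡ x)) (X^≈𝟎 z≤n)
    go (suc zero)    = step 0 (≈𝟎-⊗ˡ (≈-trans (≋⇒≈ (⊗-identityˡ x)) (X^≈𝟎 (s≤s z≤n))))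
    go (suc (suc m)) = step (suc m) (subst (λ k → ρ (suc m) ⊗ x ⊗ (u (suc m) ⊗ (u (suc m) ⊕ x)) ≈ 𝟎 [ X^ k ]) (ℕ.+-comm (suc m) 1)
      (≈𝟎-X^-⊗ (suc m) 1 (go (suc m)) (≈𝟎-⊗ˡ (X^≈𝟎 (s≤s z≤n)))))

  summand-next : ∀ m → summand (suc K) m ≋ u m ⊗ ρ m
  summand-next zero    = ≋-sym (⊗-identityˡ 𝟏)
  summand-next (suc m) = ⊗-cancelʳ (1-X^-coeff₀ (K + suc m + (K + suc m))) (begin
    summand (suc K) (suc m) ⊗ (𝟏 ⊝ˢ xu (suc m))
      ≈⟨ ⊗-cong ≋-refl (⊕-cong ≋-refl (⊟-cong (≋-sym (xu-shift m)))) ⟩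
    summand (suc K) (suc m) ⊗ (𝟏 ⊝ˢ X^ (odd (suc K + m)))
      ≈⟨ summand-suc (suc K) m ⟩
    summand (suc K) m ⊗ (X^ (odd m + odd m) ⊕ X^ (odd (suc K + m)))
      ≈⟨ ⊗-cong (summand-next m) (⊕-cong (square m) (≋-trans (xu-shift m) (≋-trans (≋-sym (xu-defn (suc m))) (⊗-cong ≋-refl (≋-sym (u-suc m)))))) ⟩
    u m ⊗ ρ m ⊗ (X^ 2 ⊗ u m ⊗ u m ⊕ x ⊗ (X^ 2 ⊗ u m))
      ≈⟨ solve 4 (λ u r p x → u :* r :* (p :* u :* u :+ x :* (p :* u)) := p :* u :* (r :* (u :* (u :+ x)))) ≋-refl (u m) (ρ m) (X^ 2) x ⟩
    X^ 2 ⊗ u m ⊗ (ρ m ⊗ (u m ⊗ (u m ⊕ x)))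
      ≈⟨ ⊗-cong (u-suc m) (≋-sym (ρ-suc m)) ⟩
    u (suc m) ⊗ (ρ (suc m) ⊗ (𝟏 ⊝ˢ xu (suc m)))
      ≈⟨ ⊗-assoc _ _ _ ⟨
    u (suc m) ⊗ ρ (suc m) ⊗ (𝟏 ⊝ˢ xu (suc m)) ∎)
    where
    open ≋-Reasoning
    square : ∀ m → X^ (odd m + odd m) ≋ X^ 2 ⊗ u m ⊗ u m
    square m = ≋-sym (≋-trans (⊗-cong (X^-+ 2 (m + m)) ≋-refl) (≋-trans (X^-+ (2 + (m + m)) (m + m)) (X^-cong (exponent m))))
      where
      exponent : ∀ m → 2 + (m + m) + (m + m) ≡ suc (m + m) + suc (m + m)
      exponent = solveℕ-∀

  -- In the quotient of `summand K m` by `summand (suc K) m` the products cancel down to their ends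
  -- and leave (p^m + x) (1 - x p^m) / (p^m (1 + x) (1 - x)). Both summands are therefore simple
  -- multiples of ρ m.
  summand-this : ∀ m → (𝟏 ⊝ˢ x ⊗ x) ⊗ summand K m ≋ ρ m ⊗ ((u m ⊕ x) ⊗ (𝟏 ⊝ˢ xu m))
  summand-this zero = begin
    (𝟏 ⊝ˢ x ⊗ x) ⊗ 𝟏                     ≈⟨ ⊗-cong (⊕-cong (≋-sym κ-1) ≋-refl) (≋-sym κ-1) ⟩
    (κ 1ℤ ⊝ˢ x ⊗ x) ⊗ κ 1ℤ
      ≈⟨ solve 1 (λ x → (con 1ℤ :- x :* x) :* con 1ℤ := con 1ℤ :* ((con 1ℤ :+ x) :* (con 1ℤ :- x))) ≋-refl x ⟩
    κ 1ℤ ⊗ ((κ 1ℤ ⊕ x) ⊗ (κ 1ℤ ⊝ˢ x))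
      ≈⟨ ⊗-cong κ-1 (⊗-cong (⊕-cong κ-1 ≋-refl) (⊕-cong κ-1 (⊟-cong (X^-cong (cong odd (sym (ℕ.+-identityʳ K))))))) ⟩
    𝟏 ⊗ ((u 0 ⊕ x) ⊗ (𝟏 ⊝ˢ xu 0))        ∎
    where open ≋-Reasoning
  summand-this (suc m) = ⊗-cancelʳ (1-X^-coeff₀ (K + m + (K + m))) (begin
    (𝟏 ⊝ˢ x ⊗ x) ⊗ summand K (suc m) ⊗ (𝟏 ⊝ˢ xu m)
      ≈⟨ ≋-trans (⊗-assoc _ _ _) (⊗-cong ≋-refl (≋-trans (summand-suc K m) (⊗-cong ≋-refl (⊕-cong (square m) (≋-sym (xu-defn m)))))) ⟩
    (𝟏 ⊝ˢ x ⊗ x) ⊗ (summand K m ⊗ (u (suc m) ⊗ u m ⊕ x ⊗ u m))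
      ≈⟨ ⊗-assoc _ _ _ ⟨
    (𝟏 ⊝ˢ x ⊗ x) ⊗ summand K m ⊗ (u (suc m) ⊗ u m ⊕ x ⊗ u m)
      ≈⟨ ⊗-cong (summand-this m) ≋-refl ⟩
    ρ m ⊗ ((u m ⊕ x) ⊗ (𝟏 ⊝ˢ xu m)) ⊗ (u (suc m) ⊗ u m ⊕ x ⊗ u m)
      ≈⟨ solve 5 (λ r u x d v → r :* ((u :+ x) :* d) :* (v :* u :+ x :* u) := r :* (u :* (u :+ x)) :* ((v :+ x) :* d))
           ≋-refl (ρ m) (u m) x (𝟏 ⊝ˢ xu m) (u (suc m)) ⟩
    ρ m ⊗ (u m ⊗ (u m ⊕ x)) ⊗ ((u (suc m) ⊕ x) ⊗ (𝟏 ⊝ˢ xu m))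
      ≈⟨ ⊗-cong (ρ-suc m) ≋-refl ⟨
    ρ (suc m) ⊗ (𝟏 ⊝ˢ xu (suc m)) ⊗ ((u (suc m) ⊕ x) ⊗ (𝟏 ⊝ˢ xu m))
      ≈⟨ solve 4 (λ r e v d → r :* e :* (v :* d) := r :* (v :* e) :* d) ≋-refl (ρ (suc m)) (𝟏 ⊝ˢ xu (suc m)) _ _ ⟩
    ρ (suc m) ⊗ ((u (suc m) ⊕ x) ⊗ (𝟏 ⊝ˢ xu (suc m))) ⊗ (𝟏 ⊝ˢ xu m) ∎)
    where
    open ≋-Reasoning
    square : ∀ m → X^ (odd m + odd m) ≋ u (suc m) ⊗ u m
    square m = ≋-sym (≋-trans (X^-+ (suc m + suc m) (m + m)) (X^-cong (exponent m)))
      where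
      exponent : ∀ m → suc m + suc m + (m + m) ≡ suc (m + m) + suc (m + m)
      exponent = solveℕ-∀

  -- Termwise, (1 - x²) summand K m - (1 + x²) summand (K+1) m = g (m+1) - g m
  -- with g m = - x ρ m (1 - x p^m).
  telescope : ∀ M → (𝟏 ⊝ˢ x ⊗ x) ⊗ partialG K M ⊕ x ⊗ ρ M ⊗ (𝟏 ⊝ˢ xu M)
                  ≋ (𝟏 ⊕ x ⊗ x) ⊗ partialG (suc K) M ⊕ x ⊗ (𝟏 ⊝ˢ x)
  telescope zero = ⊕-cong (≋-trans (⊗-zeroʳ _) (≋-sym (⊗-zeroʳ _)))
    (⊗-cong (⊗-identityʳ x) (⊕-cong ≋-refl (⊟-cong (X^-cong (cong odd (ℕ.+-identityʳ K))))))
  telescope (suc M) = begin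
    (𝟏 ⊝ˢ x ⊗ x) ⊗ (S ⊕ summand K M) ⊕ x ⊗ ρ (suc M) ⊗ (𝟏 ⊝ˢ xu (suc M))
      ≈⟨ solve 6 (λ a s t x r d → a :* (s :+ t) :+ x :* r :* d := a :* s :+ a :* t :+ x :* (r :* d)) ≋-refl _ S _ x _ _ ⟩
    (𝟏 ⊝ˢ x ⊗ x) ⊗ S ⊕ (𝟏 ⊝ˢ x ⊗ x) ⊗ summand K M ⊕ x ⊗ (ρ (suc M) ⊗ (𝟏 ⊝ˢ xu (suc M)))
      ≈⟨ ⊕-cong (⊕-cong ≋-refl (≋-trans (summand-this M) (⊗-cong ≋-refl (⊗-cong ≋-refl (⊕-cong (≋-sym κ-1) (⊟-cong (≋-sym (xu-defn M))))))))
           (⊗-cong ≋-refl (ρ-suc M)) ⟩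
    (𝟏 ⊝ˢ x ⊗ x) ⊗ S ⊕ r ⊗ ((v ⊕ x) ⊗ (κ 1ℤ ⊝ˢ x ⊗ v)) ⊕ x ⊗ (r ⊗ (v ⊗ (v ⊕ x)))
      ≈⟨ solve 4 (λ a x v r →
           a :+ r :* ((v :+ x) :* (con 1ℤ :- x :* v)) :+ x :* (r :* (v :* (v :+ x)))
             := a :+ x :* r :* (con 1ℤ :- x :* v) :+ (con 1ℤ :+ x :* x) :* (v :* r)) ≋-refl ((𝟏 ⊝ˢ x ⊗ x) ⊗ S) x v r ⟩
    (𝟏 ⊝ˢ x ⊗ x) ⊗ S ⊕ x ⊗ r ⊗ (κ 1ℤ ⊝ˢ x ⊗ v) ⊕ (κ 1ℤ ⊕ x ⊗ x) ⊗ (v ⊗ r)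
      ≈⟨ ⊕-cong (⊕-cong ≋-refl (⊗-cong ≋-refl (⊕-cong κ-1 (⊟-cong (xu-defn M)))))
                (⊗-cong (⊕-cong κ-1 ≋-refl) (≋-sym (summand-next M))) ⟩
    (𝟏 ⊝ˢ x ⊗ x) ⊗ S ⊕ x ⊗ r ⊗ (𝟏 ⊝ˢ xu M) ⊕ (𝟏 ⊕ x ⊗ x) ⊗ summand (suc K) M
      ≈⟨ ⊕-cong (telescope M) ≋-refl ⟩
    (𝟏 ⊕ x ⊗ x) ⊗ S′ ⊕ x ⊗ (𝟏 ⊝ˢ x) ⊕ (𝟏 ⊕ x ⊗ x) ⊗ summand (suc K) M
      ≈⟨ solve 4 (λ a s c t → a :* s :+ c :+ a :* t := a :* (s :+ t) :+ c) ≋-refl (𝟏 ⊕ x ⊗ x) S′ (x ⊗ (𝟏 ⊝ˢ x)) _ ⟩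
    (𝟏 ⊕ x ⊗ x) ⊗ (S′ ⊕ summand (suc K) M) ⊕ x ⊗ (𝟏 ⊝ˢ x) ∎
    where
    open ≋-Reasoning
    S  = partialG K M
    S′ = partialG (suc K) M
    v  = u M
    r  = ρ M

  G-step : (𝟏 ⊝ˢ x ⊗ x) ⊗ G K ≋ (𝟏 ⊕ x ⊗ x) ⊗ G (suc K) ⊕ x ⊗ (𝟏 ⊝ˢ x)
  G-step = ≈⇒≋ λ N →
    ≈-trans (≈-⊗ ≈-refl (lim-≈ (partialG-Cauchy K) {N} ℕ.≤-refl))
    (≈-trans (≋⇒≈ (≋-sym (⊕-identityʳ _)))
    (≈-trans (≈-⊕ ≈-refl (≈-sym (≈𝟎-⊗ˡ (xρ-≈𝟎 N))))
    (≈-trans (≋⇒≈ (telescope N))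
    (≈-⊕ (≈-⊗ ≈-refl (≈-sym (lim-≈ (partialG-Cauchy (suc K)) ℕ.≤-refl))) ≈-refl))))

-- The even part of the recurrence and its limit

-- φ ε = Σ_{t∈ℤ} ε^t q^{t²}
φ-partial : ℤ → ℕ → Series
φ-partial ε n = 𝟏 ⊕ Σ[ (λ t → κ (+ 2 ℤ.* ε ℤ.^ suc t) ⊗ X^ (suc t * suc t)) ] n

≈𝟎-⊗ʳ : ∀ {f g m} → f ≈ 𝟎 [ m ] → g ⊗ f ≈ 𝟎 [ m ]
≈𝟎-⊗ʳ {f} {g} p = ≈-trans (≋⇒≈ (⊗-comm g f)) (≈𝟎-⊗ˡ p)

φ-Cauchy : ∀ ε → Cauchy (φ-partial ε)
φ-Cauchy ε k = ≈-⊕ ≈-refl (Σ-Cauchy (λ t → ≈𝟎-⊗ʳ (X^≈𝟎 (ℕ.≤-trans (ℕ.n≤1+n t) (ℕ.m≤m*n (suc t) (suc t))))) k)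

φ : ℤ → Series
φ ε = lim (φ-partial ε)

φ₊ φ₋ : Series
φ₊ = φ 1ℤ
φ₋ = φ -1ℤ

-- A = A′ = 1/2 solves (1 - x) A = (1 + x) A′ - x, the recurrence `U-step`. Subtracting this
-- solution, and doubling to stay integral, makes it homogeneous.
E : ℕ → Series
E K = κ (+ 2) ⊗ U 2 0 (G K) ⊝ˢ 𝟏

module _ (K : ℕ) where
  open Telescope K using (x; G-step)

  private
    square-x : x ⊗ x ≋ V 2 x
    square-x = ≋-trans (X^-+ (odd K) (odd K)) (≋-trans (X^-cong (exponent K)) (≋-sym (V-X^ 2 (odd K))))
      where
      exponent : ∀ K → suc (K + K) + suc (K + K) ≡ suc (K + K) * 2
      exponent = solveℕ-∀

    V-1 : V 2 𝟏 ≋ 𝟏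
    V-1 = V-X^ 2 0

    1-x² : 𝟏 ⊝ˢ x ⊗ x ≋ V 2 (𝟏 ⊝ˢ x)
    1-x² = ≋-sym (≋-trans (V-⊕ 2 _ _) (⊕-cong V-1 (≋-trans (V-⊟ 2 x) (⊟-cong (≋-sym square-x)))))

    1+x² : 𝟏 ⊕ x ⊗ x ≋ V 2 (𝟏 ⊕ x)
    1+x² = ≋-sym (≋-trans (V-⊕ 2 _ _) (⊕-cong V-1 (≋-sym square-x)))

    odd≢even : ∀ K n → suc (K + K) ≢ n * 2
    odd≢even zero    (suc zero)    ()
    odd≢even zero    (suc (suc n)) ()
    odd≢even (suc K) (suc n) e =
      odd≢even K n (ℕ.suc-injective (ℕ.suc-injective (trans (cong (λ j → suc (suc j)) (sym (ℕ.+-suc K K))) e)))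

    U-x : U 2 0 x ≋ 𝟎
    U-x .coeff n = trans (U-coeff 2 0 x n) (trans (X^-coeff-off (odd K) _ (odd≢even K n)) (sym (𝟎-coeff n)))

    U-boundary : U 2 0 (x ⊗ (𝟏 ⊝ˢ x)) ≋ ⊟ x
    U-boundary = begin
      U 2 0 (x ⊗ (𝟏 ⊝ˢ x))
        ≈⟨ U-cong 2 0 (≋-trans (solve 2 (λ x e → x :* (e :- x) := x :* e :+ :- (x :* x)) ≋-refl x 𝟏)
             (⊕-cong (⊗-identityʳ x) (⊟-cong square-x))) ⟩
      U 2 0 (x ⊝ˢ V 2 x)        ≈⟨ U-⊕ 2 0 x _ ⟩
      U 2 0 x ⊕ U 2 0 (⊟ V 2 x) ≈⟨ ⊕-cong U-x (≋-trans (U-⊟ 2 0 _) (⊟-cong (U-V 2 x))) ⟩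
      𝟎 ⊝ˢ x                    ≈⟨ ⊕-identityˡ _ ⟩
      ⊟ x                       ∎
      where open ≋-Reasoning

    -- The factors 1 - x² and 1 + x² are even and pass through the extraction with q² becoming q. Of
    -- the inhomogeneous term x - x² only the even part -x² survives.
    U-step : (𝟏 ⊝ˢ x) ⊗ U 2 0 (G K) ≋ (𝟏 ⊕ x) ⊗ U 2 0 (G (suc K)) ⊕ ⊟ x
    U-step = begin
      (𝟏 ⊝ˢ x) ⊗ U 2 0 (G K)
        ≈⟨ U-V-⊗ 2 0 (s≤s z≤n) _ _ ⟨
      U 2 0 (V 2 (𝟏 ⊝ˢ x) ⊗ G K)
        ≈⟨ U-cong 2 0 (≋-trans (⊗-cong (≋-sym 1-x²) ≋-refl) (≋-trans G-step (⊕-cong (⊗-cong 1+x² ≋-refl) ≋-refl))) ⟩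
      U 2 0 (V 2 (𝟏 ⊕ x) ⊗ G (suc K) ⊕ x ⊗ (𝟏 ⊝ˢ x))
        ≈⟨ ≋-trans (U-⊕ 2 0 _ _) (⊕-cong (U-V-⊗ 2 0 (s≤s z≤n) _ _) U-boundary) ⟩
      (𝟏 ⊕ x) ⊗ U 2 0 (G (suc K)) ⊕ ⊟ x ∎
      where open ≋-Reasoning

  E-step : (𝟏 ⊝ˢ X^ (odd K)) ⊗ E K ≋ (𝟏 ⊕ X^ (odd K)) ⊗ E (suc K)
  E-step = begin
    (𝟏 ⊝ˢ x) ⊗ (κ (+ 2) ⊗ A ⊝ˢ 𝟏)
      ≈⟨ ⊗-cong ≋-refl (⊕-cong ≋-refl (⊟-cong (≋-sym κ-1))) ⟩
    (𝟏 ⊝ˢ x) ⊗ (κ (+ 2) ⊗ A ⊝ˢ κ 1ℤ)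
      ≈⟨ solve 2 (λ a d → d :* (con (+ 2) :* a :- con 1ℤ) := con (+ 2) :* (d :* a) :- d) ≋-refl A (𝟏 ⊝ˢ x) ⟩
    κ (+ 2) ⊗ ((𝟏 ⊝ˢ x) ⊗ A) ⊝ˢ (𝟏 ⊝ˢ x)
      ≈⟨ ⊕-cong (⊗-cong ≋-refl (≋-trans U-step (⊕-cong (⊗-cong (⊕-cong (≋-sym κ-1) ≋-refl) ≋-refl) ≋-refl)))
           (⊟-cong (⊕-cong (≋-sym κ-1) ≋-refl)) ⟩
    κ (+ 2) ⊗ ((κ 1ℤ ⊕ x) ⊗ B ⊕ ⊟ x) ⊝ˢ (κ 1ℤ ⊝ˢ x)
      ≈⟨ solve 2 (λ b x → con (+ 2) :* ((con 1ℤ :+ x) :* b :+ :- x) :- (con 1ℤ :- x)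
           := (con 1ℤ :+ x) :* (con (+ 2) :* b :- con 1ℤ)) ≋-refl B x ⟩
    (κ 1ℤ ⊕ x) ⊗ (κ (+ 2) ⊗ B ⊝ˢ κ 1ℤ)
      ≈⟨ ⊗-cong (⊕-cong κ-1 ≋-refl) (⊕-cong ≋-refl (⊟-cong κ-1)) ⟩
    (𝟏 ⊕ x) ⊗ E (suc K) ∎
    where
    open ≋-Reasoning
    A = U 2 0 (G K)
    B = U 2 0 (G (suc K))

oddFactor : ℤ → ℕ → Series
oddFactor ε i = 𝟏 ⊕ κ ε ⊗ X^ (odd i)

oddProduct : ℤ → Series
oddProduct ε = lim Π[ oddFactor ε ]

oddProduct-Cauchy : ∀ ε → Cauchy Π[ oddFactor ε ]
oddProduct-Cauchy ε = Π-Cauchy λ k → 𝟏⊕≈𝟏 (≈𝟎-⊗ʳ (X^≈𝟎 (ℕ.≤-trans (ℕ.m≤m+n k k) (ℕ.n≤1+n _))))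

-1⊗ : ∀ f → κ -1ℤ ⊗ f ≋ ⊟ f
-1⊗ = solve 1 (λ f → con -1ℤ :* f := :- f) ≋-refl

1⊗ : ∀ f → κ 1ℤ ⊗ f ≋ f
1⊗ = solve 1 (λ f → con 1ℤ :* f := f) ≋-refl

E-product : ∀ L → Π[ oddFactor -1ℤ ] L ⊗ E 0 ≋ Π[ oddFactor 1ℤ ] L ⊗ E L
E-product zero    = ≋-refl
E-product (suc L) = begin
  N ⊗ oddFactor -1ℤ L ⊗ E 0
    ≈⟨ solve 3 (λ n o e → n :* o :* e := n :* e :* o) ≋-refl N _ (E 0) ⟩
  N ⊗ E 0 ⊗ oddFactor -1ℤ L
    ≈⟨ ⊗-cong (E-product L) (⊕-cong ≋-refl (-1⊗ _)) ⟩
  P ⊗ E L ⊗ (𝟏 ⊝ˢ X^ (odd L))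
    ≈⟨ solve 3 (λ p e d → p :* e :* d := p :* (d :* e)) ≋-refl P (E L) _ ⟩
  P ⊗ ((𝟏 ⊝ˢ X^ (odd L)) ⊗ E L)
    ≈⟨ ⊗-cong ≋-refl (≋-trans (E-step L) (⊗-cong (⊕-cong ≋-refl (≋-sym (1⊗ _))) ≋-refl)) ⟩
  P ⊗ (oddFactor 1ℤ L ⊗ E (suc L))
    ≈⟨ ⊗-assoc _ _ _ ⟨
  P ⊗ oddFactor 1ℤ L ⊗ E (suc L) ∎
  where
  open ≋-Reasoning
  N = Π[ oddFactor -1ℤ ] L
  P = Π[ oddFactor  1ℤ ] L

-- As x tends to 0, the i-th factor tends to p^(2i-1), and these multiply to p^(m²) = q^(2m²).
summand-≈-square : ∀ L m → summand L m ≈ X^ (m * m + m * m) [ X^ (odd L) ]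
summand-≈-square L zero    = ≈-refl
summand-≈-square L (suc m) = ≈-cancelʳ (1-X^-coeff₀ _)
  (≈-trans (≋⇒≈ (summand-suc L m))
  (≈-trans (≈-⊗ (summand-≈-square L m) (≈-⊕ ≈-refl small))
  (≈-trans (≋⇒≈ (≋-trans (⊗-cong ≋-refl (⊕-identityʳ _)) (≋-trans (X^-+ _ _) (≋-trans (X^-cong (exponent m)) (≋-sym (⊗-identityʳ _))))))
  (≈-⊗ ≈-refl (≈-sym (𝟏⊕≈𝟏 (⊟-≈𝟎 small)))))))
  where
  small : X^ (odd (L + m)) ≈ 𝟎 [ X^ (odd L) ]
  small = X^≈𝟎 (s≤s (ℕ.+-mono-≤ (ℕ.m≤m+n L m) (ℕ.m≤m+n L m)))
  exponent : ∀ m → m * m + m * m + (suc (m + m) + suc (m + m)) ≡ suc m * suc m + suc m * suc m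
  exponent = solveℕ-∀

U-Σ : ∀ k r F n → U k r (Σ[ F ] n) ≋ Σ[ (λ m → U k r (F m)) ] n
U-Σ k r F zero    .coeff n = trans (U-coeff k r 𝟎 n) (trans (𝟎-coeff _) (sym (𝟎-coeff n)))
U-Σ k r F (suc n) = ≋-trans (U-⊕ k r _ _) (⊕-cong (U-Σ k r F n) ≋-refl)

-- Halving the indices halves the precision, so 2L + 1 summands of G L are taken, each known modulo
-- q^(2L+1). The even part is Σ q^(m²) over 0 ≤ m ≤ 2L; doubling and subtracting 1 counts m and -m,
-- as φ does.
E-≈ : ∀ L → E L ≈ φ₊ [ X^ L ]
E-≈ L = ≈-trans (≈-⊕ (≈-⊗ ≈-refl U-G) ≈-refl) (≈-trans (≋⇒≈ reindex) (≈-sym (lim-≈ (φ-Cauchy 1ℤ) (ℕ.m≤m+n L L))))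
  where
  squares : ℕ → Series
  squares = Σ[ (λ m → X^ (m * m)) ]

  U-G : U 2 0 (G L) ≈ squares (odd L) [ X^ L ]
  U-G = coeff⇒≈ L λ n n<L → begin
    U 2 0 (G L) n                                      ≡⟨ U-coeff 2 0 _ n ⟩
    G L (n * 2)                                        ≡⟨ ≈⇒coeff G-≈ (bound n n<L) ⟩
    Σ[ (λ m → X^ (m * m + m * m)) ] (odd L) (n * 2)    ≡⟨ U-coeff 2 0 _ n ⟨
    U 2 0 (Σ[ (λ m → X^ (m * m + m * m)) ] (odd L)) n
      ≡⟨ coeff (≋-trans (U-Σ 2 0 (λ m → X^ (m * m + m * m)) (odd L)) (Σ-cong (odd L) λ m _ →
           ≋-trans (U-cong 2 0 (≋-trans (X^-cong (double m)) (≋-sym (V-X^ 2 (m * m))))) (U-V 2 _))) n ⟩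
    squares (odd L) n ∎
    where
    open ≡-Reasoning
    double : ∀ m → m * m + m * m ≡ m * m * 2
    double = solveℕ-∀
    bound : ∀ n → n < L → n * 2 < odd L
    bound n n<L = s≤s (subst (n * 2 ≤_) (trans (ℕ.*-comm L 2) (cong (_+_ L) (ℕ.+-identityʳ L))) (ℕ.*-monoˡ-≤ 2 (ℕ.<⇒≤ n<L)))
    G-≈ : G L ≈ Σ[ (λ m → X^ (m * m + m * m)) ] (odd L) [ X^ (odd L) ]
    G-≈ = ≈-trans (lim-≈ (partialG-Cauchy L) ℕ.≤-refl) (Σ-≈ (odd L) λ m _ → summand-≈-square L m)

  reindex : κ (+ 2) ⊗ squares (odd L) ⊝ˢ 𝟏 ≋ φ-partial 1ℤ (L + L)
  reindex = begin
    κ (+ 2) ⊗ squares (odd L) ⊝ˢ 𝟏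
      ≈⟨ ⊕-cong (⊗-cong ≋-refl (≋-trans (Σ-suc (λ m → X^ (m * m)) (L + L)) (⊕-cong (≋-sym κ-1) ≋-refl))) (⊟-cong (≋-sym κ-1)) ⟩
    κ (+ 2) ⊗ (κ 1ℤ ⊕ T) ⊝ˢ κ 1ℤ
      ≈⟨ solve 1 (λ t → con (+ 2) :* (con 1ℤ :+ t) :- con 1ℤ := con 1ℤ :+ con (+ 2) :* t) ≋-refl T ⟩
    κ 1ℤ ⊕ κ (+ 2) ⊗ T
      ≈⟨ ⊕-cong κ-1 (≋-trans (Σ-⊗ (κ (+ 2)) (λ t → X^ (suc t * suc t)) (L + L))
           (Σ-cong (L + L) λ t _ → ⊗-cong (≡⇒≋ (cong (λ z → κ (+ 2 ℤ.* z)) (sym (ℤ.^-zeroˡ (suc t))))) ≋-refl)) ⟩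
    φ-partial 1ℤ (L + L) ∎
    where
    open ≋-Reasoning
    T = Σ[ (λ t → X^ (suc t * suc t)) ] (L + L)

even-part : oddProduct -1ℤ ⊗ E 0 ≋ oddProduct 1ℤ ⊗ φ₊
even-part = ≈⇒≋ λ L →
  ≈-trans (≈-⊗ (lim-≈ (oddProduct-Cauchy -1ℤ) {L} ℕ.≤-refl) ≈-refl)
  (≈-trans (≋⇒≈ (E-product L))
  (≈-⊗ (≈-sym (lim-≈ (oddProduct-Cauchy 1ℤ) ℕ.≤-refl)) (E-≈ L)))

-- The generating function of v₀

private
  numerator denominator : ℕ → Series
  numerator   = pochhammer (⊝ q^ 1) (q^ 2)
  denominator = pochhammer (q^ 1) (q^ 2)

q²-power : ∀ m → (q^ 2) ⊛^ m ≋ X^ (m + m)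
q²-power zero    = X^-defn 0
q²-power (suc m) = ≋-trans (⊗-defn _ _) (≋-trans (⊗-cong (q²-power m) (X^-defn 2))
  (≋-trans (X^-+ (m + m) 2) (X^-cong (exponent m))))
  where
  exponent : ∀ m → m + m + 2 ≡ suc m + suc m
  exponent = solveℕ-∀

private
  q-odd : ∀ m → q^ 1 ⊛ (q^ 2) ⊛^ m ≋ X^ (odd m)
  q-odd m = ≋-trans (⊗-defn _ _) (≋-trans (⊗-cong (X^-defn 1) (q²-power m)) (X^-+ 1 (m + m)))

denominator-suc : ∀ m → denominator (suc m) ≋ denominator m ⊗ (𝟏 ⊝ˢ X^ (odd m))
denominator-suc m = ≋-trans (⊗-defn _ _) (⊗-cong ≋-refl (≋-trans (⊖-defn _ _) (⊕-cong (X^-defn 0) (⊟-cong (q-odd m)))))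

numerator-suc : ∀ m → numerator (suc m) ≋ numerator m ⊗ (𝟏 ⊕ X^ (odd m))
numerator-suc m = ≋-trans (⊗-defn _ _) (⊗-cong ≋-refl (begin
  q^ 0 ⊖ ⊝ q^ 1 ⊛ (q^ 2) ⊛^ m          ≈⟨ ⊖-defn _ _ ⟩
  q^ 0 ⊝ˢ ⊝ q^ 1 ⊛ (q^ 2) ⊛^ m         ≈⟨ ⊕-cong (X^-defn 0) (⊟-cong (≋-trans (⊗-defn _ _) (⊗-cong (≋-trans (⊟-defn _) (⊟-cong (X^-defn 1))) (q²-power m)))) ⟩
  𝟏 ⊝ˢ ⊟ X^ 1 ⊗ X^ (m + m)             ≈⟨ solve 3 (λ e x y → e :- (:- x) :* y := e :+ x :* y) ≋-refl 𝟏 (X^ 1) (X^ (m + m)) ⟩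
  𝟏 ⊕ X^ 1 ⊗ X^ (m + m)                ≈⟨ ⊕-cong ≋-refl (X^-+ 1 (m + m)) ⟩
  𝟏 ⊕ X^ (odd m)                       ∎))
  where open ≋-Reasoning

denominator-coeff₀ : ∀ m → denominator m 0 ≡ 1ℤ
denominator-coeff₀ zero    = refl
denominator-coeff₀ (suc m) = trans (coeff (denominator-suc m) 0) (⊗-coeff₀ (denominator-coeff₀ m) (1-X^-coeff₀ (m + m)))

-- With z = q^(2m+1) the new numerator factor at x = q is z² + z = z (1 + z); the factors z
-- accumulate to q^(m²).
summand-ratio : ∀ m → summand 0 m ⊗ denominator m ≋ X^ (m * m) ⊗ numerator m
summand-ratio zero    = ≋-refl
summand-ratio (suc m) = begin
  summand 0 (suc m) ⊗ denominator (suc m)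
    ≈⟨ ⊗-cong ≋-refl (denominator-suc m) ⟩
  summand 0 (suc m) ⊗ (denominator m ⊗ (𝟏 ⊝ˢ z))
    ≈⟨ solve 3 (λ s d z → s :* (d :* z) := s :* z :* d) ≋-refl _ _ _ ⟩
  summand 0 (suc m) ⊗ (𝟏 ⊝ˢ z) ⊗ denominator m
    ≈⟨ ⊗-cong (≋-trans (summand-suc 0 m) (⊗-cong ≋-refl (≋-trans (⊕-cong (≋-sym (X^-+ (odd m) (odd m))) (≋-sym (⊗-identityˡ z)))
         (solve 2 (λ e z → z :* z :+ e :* z := z :* (e :+ z)) ≋-refl 𝟏 z)))) ≋-refl ⟩
  summand 0 m ⊗ (z ⊗ (𝟏 ⊕ z)) ⊗ denominator m
    ≈⟨ solve 4 (λ s z w d → s :* (z :* w) :* d := z :* (s :* d :* w)) ≋-refl _ z _ _ ⟩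
  z ⊗ (summand 0 m ⊗ denominator m ⊗ (𝟏 ⊕ z))
    ≈⟨ ⊗-cong ≋-refl (⊗-cong (summand-ratio m) ≋-refl) ⟩
  z ⊗ (X^ (m * m) ⊗ numerator m ⊗ (𝟏 ⊕ z))
    ≈⟨ solve 4 (λ z x n w → z :* (x :* n :* w) := z :* x :* (n :* w)) ≋-refl z _ _ _ ⟩
  z ⊗ X^ (m * m) ⊗ (numerator m ⊗ (𝟏 ⊕ z))
    ≈⟨ ⊗-cong (≋-trans (X^-+ (odd m) (m * m)) (X^-cong (exponent m))) (≋-sym (numerator-suc m)) ⟩
  X^ (suc m * suc m) ⊗ numerator (suc m) ∎
  where
  open ≋-Reasoning
  z = X^ (odd m)
  exponent : ∀ m → suc (m + m) + m * m ≡ suc m * suc m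
  exponent = solveℕ-∀

Σℤ≡Σ : ∀ F k n → Σℤ {k} (λ m → F (toℕ m) n) ≡ Σ[ F ] k n
Σℤ≡Σ F zero    n = sym (𝟎-coeff n)
Σℤ≡Σ F (suc k) n = trans (cong (ℤ._+_ (F 0 n)) (Σℤ≡Σ (λ m → F (suc m)) k n))
  (sym (trans (coeff (Σ-suc F k) n) (⊕-coeff _ _ n)))

v₀≋G : v₀ ≋ G 0
v₀≋G .coeff n = begin
  v₀ n               ≡⟨ Σℤ≡Σ F (suc n) n ⟩
  Σ[ F ] (suc n) n   ≡⟨ coeff (Σ-cong (suc n) λ m _ → F≋summand m) n ⟩
  -- `lim` reads the coefficient of q^n after `suc n` summands, which is exactly the truncation in
  -- `Σ∞`.
  partialG 0 (suc n) n ≡⟨ lim-coeff (partialG 0) n ⟨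
  G 0 n              ∎
  where
  open ≡-Reasoning
  F : ℕ → Series
  F m = (q^ (m * m) ⊛ numerator m) ⊘ denominator m
  F≋summand : ∀ m → F m ≋ summand 0 m
  F≋summand m = ⊗-cancelʳ (denominator-coeff₀ m)
    (≋-trans (⊘-⊗ _ (denominator-coeff₀ m)) (≋-trans (⊗-defn _ _)
      (≋-trans (⊗-cong (X^-defn _) ≋-refl) (≋-sym (summand-ratio m)))))

-- Infinite products over arithmetic progressions

Σ-split₂ : ∀ F n → Σ[ F ] (n * 2) ≋ Σ[ (λ i → F (i * 2)) ] n ⊕ Σ[ (λ i → F (suc (i * 2))) ] n
Σ-split₂ F zero    = ≋-sym (⊕-identityʳ 𝟎)
Σ-split₂ F (suc n) = ≋-trans (⊕-cong (⊕-cong (Σ-split₂ F n) ≋-refl) ≋-refl)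
  (solve 4 (λ a b c d → a :+ b :+ c :+ d := a :+ c :+ (b :+ d)) ≋-refl _ _ _ _)

Σ-split₃ : ∀ F n → Σ[ F ] (n * 3) ≋
  Σ[ (λ i → F (i * 3)) ] n ⊕ Σ[ (λ i → F (suc (i * 3))) ] n ⊕ Σ[ (λ i → F (suc (suc (i * 3)))) ] n
Σ-split₃ F zero    = ≋-sym (≋-trans (⊕-identityʳ _) (⊕-identityʳ 𝟎))
Σ-split₃ F (suc n) = ≋-trans (⊕-cong (⊕-cong (⊕-cong (Σ-split₃ F n) ≋-refl) ≋-refl) ≋-refl)
  (solve 6 (λ a b c d e f → a :+ b :+ c :+ d :+ e :+ f := a :+ d :+ (b :+ e) :+ (c :+ f)) ≋-refl _ _ _ _ _ _)

Π-split₂ : ∀ F n → Π[ F ] (n * 2) ≋ Π[ (λ i → F (i * 2)) ] n ⊗ Π[ (λ i → F (suc (i * 2))) ] n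
Π-split₂ F zero    = ≋-sym (⊗-identityʳ 𝟏)
Π-split₂ F (suc n) = ≋-trans (⊗-cong (⊗-cong (Π-split₂ F n) ≋-refl) ≋-refl)
  (solve 4 (λ a b c d → a :* b :* c :* d := a :* c :* (b :* d)) ≋-refl _ _ _ _)

Π-split₃ : ∀ F n → Π[ F ] (n * 3) ≋
  Π[ (λ i → F (i * 3)) ] n ⊗ Π[ (λ i → F (suc (i * 3))) ] n ⊗ Π[ (λ i → F (suc (suc (i * 3)))) ] n
Π-split₃ F zero    = ≋-sym (≋-trans (⊗-identityʳ _) (⊗-identityʳ 𝟏))
Π-split₃ F (suc n) = ≋-trans (⊗-cong (⊗-cong (⊗-cong (Π-split₃ F n) ≋-refl) ≋-refl) ≋-refl)
  (solve 6 (λ a b c d e f → a :* b :* c :* d :* e :* f := a :* d :* (b :* e) :* (c :* f)) ≋-refl _ _ _ _ _ _)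

module _ (k : ℕ) .{{_ : NonZero k}} where

  V-𝟏 : V k 𝟏 ≋ 𝟏
  V-𝟏 = V-X^ k 0

  V-Σ : ∀ F n → V k (Σ[ F ] n) ≋ Σ[ (λ i → V k (F i)) ] n
  V-Σ F zero    = ≋-trans (V-cong k (≋-sym κ-0≋𝟎)) (≋-trans (V-κ k 0ℤ) κ-0≋𝟎)
  V-Σ F (suc n) = ≋-trans (V-⊕ k _ _) (⊕-cong (V-Σ F n) ≋-refl)

  V-Π : ∀ F n → V k (Π[ F ] n) ≋ Π[ (λ i → V k (F i)) ] n
  V-Π F zero    = V-𝟏
  V-Π F (suc n) = ≋-trans (V-⊗ k _ _) (⊗-cong (V-Π F n) ≋-refl)

  V-monomial : ∀ a e → V k (κ a ⊗ X^ e) ≋ κ a ⊗ X^ (e * k)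
  V-monomial a e = ≋-trans (V-κ⊗ k a _) (⊗-cong ≋-refl (V-X^ k e))

factor : ℤ → ℕ → ℕ → ℕ → Series
factor ε a d i = 𝟏 ⊕ κ ε ⊗ X^ (a + i * d)

factor-cong : ∀ {ε m n} → m ≡ n → 𝟏 ⊕ κ ε ⊗ X^ m ≋ 𝟏 ⊕ κ ε ⊗ X^ n
factor-cong e = ⊕-cong ≋-refl (⊗-cong ≋-refl (X^-cong e))

-- In Pochhammer notation (-ε q^a; q^d)∞.
progression : ℤ → (a d : ℕ) → Series
progression ε a d = lim Π[ factor ε a d ]

module _ (ε : ℤ) (a d : ℕ) .{{_ : NonZero a}} .{{_ : NonZero d}} where

  factor-≈𝟏 : ∀ i → factor ε a d i ≈ 𝟏 [ X^ (suc i) ]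
  factor-≈𝟏 i = 𝟏⊕≈𝟏 (≈𝟎-⊗ʳ (X^≈𝟎 (ℕ.+-mono-≤ (>-nonZero⁻¹ a) (ℕ.m≤m*n i d))))

  progression-Cauchy : Cauchy Π[ factor ε a d ]
  progression-Cauchy = Π-Cauchy λ k → ≈-precision (ℕ.n≤1+n k) (factor-≈𝟏 k)

  progression-coeff₀ : progression ε a d 0 ≡ 1ℤ
  progression-coeff₀ = lim-coeff₀ {Π[ factor ε a d ]} go
    where
    go : ∀ n → Π[ factor ε a d ] n 0 ≡ 1ℤ
    go zero    = X^0-coeff-zero
    go (suc n) = ⊗-coeff₀ (go n) (trans (≈⇒coeff (factor-≈𝟏 n) (s≤s z≤n)) X^0-coeff-zero)

  progression-≈ : ∀ {N M} → N ≤ M → progression ε a d ≈ Π[ factor ε a d ] M [ X^ N ]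
  progression-≈ = lim-≈ progression-Cauchy

V-progression : ∀ k .{{_ : NonZero k}} ε a d .{{_ : NonZero a}} .{{_ : NonZero d}} →
  V k (progression ε a d) ≋ progression ε (a * k) (d * k)
V-progression k ε a d = lim-unique (progression-Cauchy ε (a * k) (d * k)) λ N →
  ≈-trans (V-≈ k (progression-≈ ε a d {N} ℕ.≤-refl))
    (≋⇒≈ (≋-trans (V-Π k (factor ε a d) N) (Π-cong N λ i _ →
      ≋-trans (V-⊕ k _ _) (⊕-cong (V-𝟏 k) (≋-trans (V-monomial k ε _) (⊗-cong ≋-refl (X^-cong (exponent a i d k))))))))
  where
  instance
    _ = ℕ.m*n≢0 a k
    _ = ℕ.m*n≢0 d k
  exponent : ∀ a i d k → (a + i * d) * k ≡ a * k + i * (d * k)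
  exponent = solveℕ-∀

progression-split₂ : ∀ ε a d .{{_ : NonZero a}} .{{_ : NonZero d}} →
  progression ε a d ≋ progression ε a (2 * d) ⊗ progression ε (a + d) (2 * d)
progression-split₂ ε a d = ≈⇒≋ λ N →
  ≈-trans (progression-≈ ε a d (ℕ.m≤m*n N 2))
  (≈-trans (≋⇒≈ (≋-trans (Π-split₂ _ N) (⊗-cong
     (Π-cong N λ i _ → factor-cong (exponent₀ a i d))
     (Π-cong N λ i _ → factor-cong (exponent₁ a i d)))))
  (≈-⊗ (≈-sym (progression-≈ ε a (2 * d) ℕ.≤-refl)) (≈-sym (progression-≈ ε (a + d) (2 * d) ℕ.≤-refl))))
  where
  instance
    _ = ℕ.m*n≢0 2 d
    _ = >-nonZero (ℕ.<-≤-trans (>-nonZero⁻¹ a) (ℕ.m≤m+n a d))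
  exponent₀ : ∀ a i d → a + i * 2 * d ≡ a + i * (2 * d)
  exponent₀ = solveℕ-∀
  exponent₁ : ∀ a i d → a + suc (i * 2) * d ≡ a + d + i * (2 * d)
  exponent₁ = solveℕ-∀

progression-split₃ : ∀ ε a d .{{_ : NonZero a}} .{{_ : NonZero d}} →
  progression ε a d ≋ progression ε a (3 * d) ⊗ progression ε (a + d) (3 * d) ⊗ progression ε (a + 2 * d) (3 * d)
progression-split₃ ε a d = ≈⇒≋ λ N →
  ≈-trans (progression-≈ ε a d (ℕ.m≤m*n N 3))
  (≈-trans (≋⇒≈ (≋-trans (Π-split₃ _ N) (⊗-cong (⊗-cong
     (Π-cong N λ i _ → factor-cong (exponent₀ a i d))
     (Π-cong N λ i _ → factor-cong (exponent₁ a i d)))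
     (Π-cong N λ i _ → factor-cong (exponent₂ a i d)))))
  (≈-⊗ (≈-⊗ (≈-sym (progression-≈ ε a (3 * d) ℕ.≤-refl)) (≈-sym (progression-≈ ε (a + d) (3 * d) ℕ.≤-refl)))
    (≈-sym (progression-≈ ε (a + 2 * d) (3 * d) ℕ.≤-refl))))
  where
  instance
    _ = ℕ.m*n≢0 3 d
    _ = >-nonZero (ℕ.<-≤-trans (>-nonZero⁻¹ a) (ℕ.m≤m+n a d))
    _ = >-nonZero (ℕ.<-≤-trans (>-nonZero⁻¹ a) (ℕ.m≤m+n a (2 * d)))
  exponent₀ : ∀ a i d → a + i * 3 * d ≡ a + i * (3 * d)
  exponent₀ = solveℕ-∀
  exponent₁ : ∀ a i d → a + suc (i * 3) * d ≡ a + d + i * (3 * d)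
  exponent₁ = solveℕ-∀
  exponent₂ : ∀ a i d → a + suc (suc (i * 3)) * d ≡ a + 2 * d + i * (3 * d)
  exponent₂ = solveℕ-∀

progression-conjugate : ∀ a d .{{_ : NonZero a}} .{{_ : NonZero d}} →
  progression 1ℤ a d ⊗ progression -1ℤ a d ≋ V 2 (progression -1ℤ a d)
progression-conjugate a d = ≈⇒≋ λ N →
  ≈-trans (≈-⊗ (progression-≈ 1ℤ a d {N} ℕ.≤-refl) (progression-≈ -1ℤ a d ℕ.≤-refl))
  (≈-trans (≋⇒≈ (≋-trans (≋-sym (Π-⊗ (factor 1ℤ a d) (factor -1ℤ a d) N)) (≋-trans (Π-cong N λ i _ → conjugate (a + i * d))
     (≋-sym (V-Π 2 (factor -1ℤ a d) N)))))
  (V-≈ 2 (≈-sym (progression-≈ -1ℤ a d ℕ.≤-refl))))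
  where
  conjugate : ∀ e → (𝟏 ⊕ κ 1ℤ ⊗ X^ e) ⊗ (𝟏 ⊕ κ -1ℤ ⊗ X^ e) ≋ V 2 (𝟏 ⊕ κ -1ℤ ⊗ X^ e)
  conjugate e = begin
    (𝟏 ⊕ κ 1ℤ ⊗ X^ e) ⊗ (𝟏 ⊕ κ -1ℤ ⊗ X^ e)
      ≈⟨ ⊗-cong (⊕-cong (≋-sym κ-1) ≋-refl) (⊕-cong (≋-sym κ-1) ≋-refl) ⟩
    (κ 1ℤ ⊕ κ 1ℤ ⊗ X^ e) ⊗ (κ 1ℤ ⊕ κ -1ℤ ⊗ X^ e)
      ≈⟨ solve 1 (λ x → (con 1ℤ :+ con 1ℤ :* x) :* (con 1ℤ :+ con -1ℤ :* x) := con 1ℤ :+ con -1ℤ :* (x :* x)) ≋-refl (X^ e) ⟩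
    κ 1ℤ ⊕ κ -1ℤ ⊗ (X^ e ⊗ X^ e)
      ≈⟨ ⊕-cong κ-1 (⊗-cong ≋-refl (≋-trans (X^-+ e e) (X^-cong (double e)))) ⟩
    𝟏 ⊕ κ -1ℤ ⊗ X^ (e * 2)
      ≈⟨ ≋-trans (V-⊕ 2 _ _) (⊕-cong (V-𝟏 2) (V-monomial 2 -1ℤ e)) ⟨
    V 2 (𝟏 ⊕ κ -1ℤ ⊗ X^ e) ∎
    where
    open ≋-Reasoning
    double : ∀ e → e + e ≡ e * 2
    double = solveℕ-∀

-- f = (q;q)∞, b = (q;q²)∞, c = (-q;q)∞, P = (-q;q²)∞
f∞ b∞ c∞ P∞ : Series
f∞ = progression -1ℤ 1 1
b∞ = progression -1ℤ 1 2
c∞ = progression 1ℤ 1 1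
P∞ = progression 1ℤ 1 2

f₀ : f∞ 0 ≡ 1ℤ
f₀ = progression-coeff₀ -1ℤ 1 1

b₀ : b∞ 0 ≡ 1ℤ
b₀ = progression-coeff₀ -1ℤ 1 2

V-coeff₀ : ∀ k .{{_ : NonZero k}} {f} → f 0 ≡ 1ℤ → V k f 0 ≡ 1ℤ
V-coeff₀ k {f} e = trans (V-coeff-zero k f) e

b⊗V₂f : b∞ ⊗ V 2 f∞ ≋ f∞
b⊗V₂f = ≋-sym (≋-trans (progression-split₂ -1ℤ 1 1) (⊗-cong ≋-refl (≋-sym (V-progression 2 -1ℤ 1 1))))

c⊗f : c∞ ⊗ f∞ ≋ V 2 f∞
c⊗f = progression-conjugate 1 1

P⊗b : P∞ ⊗ b∞ ≋ V 2 b∞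
P⊗b = progression-conjugate 1 2

-- Euler's identity behind partitions into distinct and into odd parts. Both b (q²;q²)∞ = (q;q)∞ and
-- c (q;q)∞ = (q²;q²)∞ hold, and (q²;q²)∞ cancels.
c⊗b : c∞ ⊗ b∞ ≋ 𝟏
c⊗b = ⊗-cancelʳ (V-coeff₀ 2 f₀) (≋-trans (⊗-assoc c∞ b∞ _) (≋-trans (⊗-cong ≋-refl b⊗V₂f)
  (≋-trans c⊗f (≋-sym (⊗-identityˡ _)))))

oddProduct≋progression : ∀ ε → oddProduct ε ≋ progression ε 1 2
oddProduct≋progression ε = lim-cong (oddProduct-Cauchy ε) (progression-Cauchy ε 1 2) λ N →
  Π-cong N λ i _ → ⊕-cong ≋-refl (⊗-cong ≋-refl (X^-cong (exponent i)))
  where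
  exponent : ∀ i → suc (i + i) ≡ 1 + i * 2
  exponent = solveℕ-∀

-- Theta series and their products

tri : ℕ → ℕ
tri zero    = 0
tri (suc n) = suc n + tri n

tri-double : ∀ n → tri n * 2 ≡ n * suc n
tri-double zero    = refl
tri-double (suc n) = trans (ℕ.*-distribʳ-+ 2 (suc n) (tri n)) (trans (cong (_+_ (suc n * 2)) (tri-double n)) (expand n))
  where
  expand : ∀ n → suc n * 2 + n * suc n ≡ suc n * suc (suc n)
  expand = solveℕ-∀

-- theta ε a b = Σ_{t∈ℤ} ε^t q^(at + (a+b) t(t-1)/2)
theta-series : ℤ → ℕ → ℕ → ℕ → Series
theta-series ε a b n = 𝟏 ⊕ Σ[ (λ t → κ (ε ℤ.^ suc t) ⊗ X^ (a * suc t + tri t * (a + b))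
                                   ⊕ κ (ε ℤ.^ suc t) ⊗ X^ (b * suc t + tri t * (a + b))) ] n

theta : ℤ → ℕ → ℕ → Series
theta ε a b = lim (theta-series ε a b)

module _ (ε : ℤ) (ε² : ε ℤ.* ε ≡ 1ℤ) (a b : ℕ) .{{_ : NonZero a}} .{{_ : NonZero b}} where
  private
    instance
      a+b≢0 = >-nonZero (ℕ.<-≤-trans (>-nonZero⁻¹ a) (ℕ.m≤m+n a b))
    d = a + b

    small : ∀ e .{{_ : NonZero e}} → X^ e ≈ 𝟎 [ X^ 1 ]
    small e = X^≈𝟎 (>-nonZero⁻¹ e)

    open TripleProduct (X^ d) (small d)

    power : ∀ i → (X^ d) ^ˢ i ≋ X^ (i * d)
    power zero    = ≋-refl
    power (suc i) = ≋-trans (⊗-cong (power i) ≋-refl) (≋-trans (X^-+ (i * d) d) (X^-cong (ℕ.+-comm (i * d) d)))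

    monomial : ℕ → Series
    monomial e = κ ε ⊗ X^ e

    monomials : monomial a ⊗ monomial b ≋ X^ d
    monomials = begin
      κ ε ⊗ X^ a ⊗ (κ ε ⊗ X^ b)     ≈⟨ solve 3 (λ e x y → e :* x :* (e :* y) := e :* e :* (x :* y)) ≋-refl (κ ε) _ _ ⟩
      κ ε ⊗ κ ε ⊗ (X^ a ⊗ X^ b)     ≈⟨ ⊗-cong (≋-trans (≋-sym (κ-* ε ε)) (≋-trans (≡⇒≋ (cong κ ε²)) κ-1)) (X^-+ a b) ⟩
      𝟏 ⊗ X^ d                      ≈⟨ ⊗-identityˡ _ ⟩
      X^ d                          ∎
      where open ≋-Reasoning

    term-monomial : ∀ e t → term (monomial e) (suc t) ≋ κ (ε ℤ.^ suc t) ⊗ X^ (e * suc t + tri t * d)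
    term-monomial e zero = begin
      𝟏 ⊗ (κ ε ⊗ X^ e) ⊗ 𝟏    ≈⟨ ≋-trans (⊗-identityʳ _) (⊗-identityˡ _) ⟩
      κ ε ⊗ X^ e              ≈⟨ ⊗-cong (≡⇒≋ (cong κ (sym (ℤ.*-identityʳ ε)))) (X^-cong (sym (trans (ℕ.+-identityʳ _) (ℕ.*-identityʳ e)))) ⟩
      κ (ε ℤ.^ 1) ⊗ X^ (e * 1 + 0) ∎
      where open ≋-Reasoning
    term-monomial e (suc t) = begin
      term (monomial e) (suc t) ⊗ (κ ε ⊗ X^ e) ⊗ (X^ d) ^ˢ suc t
        ≈⟨ ⊗-cong (⊗-cong (term-monomial e t) ≋-refl) (power (suc t)) ⟩
      κ (ε ℤ.^ suc t) ⊗ X^ (e * suc t + tri t * d) ⊗ (κ ε ⊗ X^ e) ⊗ X^ (suc t * d)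
        ≈⟨ solve 5 (λ s x e y z → s :* x :* (e :* y) :* z := e :* s :* (x :* y :* z)) ≋-refl _ _ (κ ε) _ _ ⟩
      κ ε ⊗ κ (ε ℤ.^ suc t) ⊗ (X^ (e * suc t + tri t * d) ⊗ X^ e ⊗ X^ (suc t * d))
        ≈⟨ ⊗-cong (≋-sym (κ-* ε _)) (≋-trans (⊗-cong (X^-+ _ e) ≋-refl) (≋-trans (X^-+ _ (suc t * d)) (X^-cong (exponent e t (tri t) d)))) ⟩
      κ (ε ℤ.^ suc (suc t)) ⊗ X^ (e * suc (suc t) + tri (suc t) * d) ∎
      where
      open ≋-Reasoning
      exponent : ∀ e t τ d → e * suc t + τ * d + e + suc t * d ≡ e * suc (suc t) + (suc t + τ) * d
      exponent = solveℕ-∀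

    partial-≋ : ∀ n → theta-partial (monomial a) (monomial b) n ≋ theta-series ε a b n
    partial-≋ n = ⊕-cong ≋-refl (Σ-cong n λ t _ → ⊕-cong (term-monomial a t) (term-monomial b t))

    rising-≋ : ∀ e .{{_ : NonZero e}} → lim (rising (monomial e)) ≋ progression ε e d
    rising-≋ e = lim-cong (rising-Cauchy (≈𝟎-⊗ʳ (small e))) (progression-Cauchy ε e d) λ n →
      Π-cong n λ i _ → ⊕-cong ≋-refl (≋-trans (⊗-assoc _ _ _) (⊗-cong ≋-refl
        (≋-trans (⊗-cong ≋-refl (power i)) (X^-+ e (i * d)))))

    factorial-≋ : factorial∞ ≋ V d f∞
    factorial-≋ = ≋-trans (lim-cong factorial-Cauchy (progression-Cauchy -1ℤ d d) (λ n →
        Π-cong n λ i _ → ⊕-cong ≋-refl (≋-trans (⊟-cong (power (suc i))) (≋-sym (-1⊗ _)))))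
      (≋-trans (≡⇒≋ (cong₂ (progression -1ℤ) (sym (ℕ.*-identityˡ d)) (sym (ℕ.*-identityˡ d))))
        (≋-sym (V-progression d -1ℤ 1 1)))

    partial-Cauchy : Cauchy (theta-partial (monomial a) (monomial b))
    partial-Cauchy = theta-Cauchy (≈𝟎-⊗ʳ (small a)) (≈𝟎-⊗ʳ (small b))

  theta-series-Cauchy : Cauchy (theta-series ε a b)
  theta-series-Cauchy k = ≈-trans (≋⇒≈ (≋-sym (partial-≋ (suc k)))) (≈-trans (partial-Cauchy k) (≋⇒≈ (partial-≋ k)))

  -- The triple product at x = ε q^a and y = ε q^b, where ε² = 1 ensures xy = Q = q^(a+b).
  theta-product : theta ε a b ≋ V (a + b) f∞ ⊗ (progression ε a (a + b) ⊗ progression ε b (a + b))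
  theta-product = ≋-trans (≋-sym (lim-cong partial-Cauchy theta-series-Cauchy partial-≋))
    (≋-trans (triple-product (monomial a) (monomial b) monomials (≈𝟎-⊗ʳ (small a)) (≈𝟎-⊗ʳ (small b)))
      (⊗-cong factorial-≋ (⊗-cong (rising-≋ a) (rising-≋ b))))

n≤tri : ∀ n → n ≤ tri n
n≤tri zero    = z≤n
n≤tri (suc n) = ℕ.m≤m+n (suc n) (tri n)

ψ-partial : ℕ → Series
ψ-partial = Σ[ (λ k → X^ (tri k)) ]

ψ-Cauchy : Cauchy ψ-partial
ψ-Cauchy = Σ-Cauchy λ k → X^≈𝟎 (n≤tri k)

ψ : Series
ψ = lim ψ-partial

-- Doubling turns tri t into the polynomial t(t+1).
by-doubling : ∀ {m n} → m * 2 ≡ n * 2 → m ≡ n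
by-doubling {m} {n} = ℕ.*-cancelʳ-≡ m n 2

φ-product : ∀ ε → ε ℤ.* ε ≡ 1ℤ → φ ε ≋ V 2 f∞ ⊗ (progression ε 1 2 ⊗ progression ε 1 2)
φ-product ε ε² = ≋-trans (lim-cong (φ-Cauchy ε) (theta-series-Cauchy ε ε² 1 1) λ n →
    ⊕-cong ≋-refl (Σ-cong n λ t _ → begin
      κ (+ 2 ℤ.* ε ℤ.^ suc t) ⊗ X^ (suc t * suc t)
        ≈⟨ ⊗-cong (κ-* (+ 2) (ε ℤ.^ suc t)) (X^-cong (exponent t)) ⟩
      κ (+ 2) ⊗ κ (ε ℤ.^ suc t) ⊗ X^ (1 * suc t + tri t * 2)
        ≈⟨ solve 2 (λ e x → con (+ 2) :* e :* x := e :* x :+ e :* x) ≋-refl _ _ ⟩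
      κ (ε ℤ.^ suc t) ⊗ X^ (1 * suc t + tri t * 2) ⊕ κ (ε ℤ.^ suc t) ⊗ X^ (1 * suc t + tri t * 2) ∎))
  (theta-product ε ε² 1 1)
  where
  open ≋-Reasoning
  exponent : ∀ t → suc t * suc t ≡ 1 * suc t + tri t * 2
  exponent t = sym (trans (cong (_+_ (1 * suc t)) (tri-double t)) (expand t))
    where
    expand : ∀ t → 1 * suc t + t * suc t ≡ suc t * suc t
    expand = solveℕ-∀

-- The bilateral series with (a, b) = (1, 3) meets each triangular number once: its two wings at t
-- give those of index 2t - 1 and 2t. The progressions 1 and 3 modulo 4 in its product merge into P.
ψ-product : ψ ≋ V 2 (V 2 f∞) ⊗ P∞
ψ-product = ≋-trans (≋-sym (lim-unique ψ-Cauchy λ N →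
    ≈-trans (lim-≈ (theta-series-Cauchy 1ℤ refl 1 3) {N} ℕ.≤-refl)
    (≈-trans (≋⇒≈ (pairing N))
    (≈-trans (≈-sym (lim-≈ ψ-Cauchy (ℕ.≤-trans (ℕ.m≤m*n N 2) (ℕ.n≤1+n _)))) (lim-≈ ψ-Cauchy ℕ.≤-refl)))))
  (≋-trans (theta-product 1ℤ refl 1 3)
    (⊗-cong (≋-trans (V-progression 4 -1ℤ 1 1) (≋-sym (≋-trans (V-cong 2 (V-progression 2 -1ℤ 1 1)) (V-progression 2 -1ℤ 2 2))))
            (≋-sym (progression-split₂ 1ℤ 1 2))))
  where
  pairing : ∀ n → theta-series 1ℤ 1 3 n ≋ ψ-partial (suc (n * 2))
  pairing n = begin
    theta-series 1ℤ 1 3 n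
      ≈⟨ ⊕-cong ≋-refl (≋-trans (Σ-cong n λ t _ → ⊕-cong (simplify t (exponent₁ t)) (simplify t (exponent₂ t))) (Σ-⊕ _ _ n)) ⟩
    𝟏 ⊕ (Σ[ (λ i → X^ (tri (suc (i * 2)))) ] n ⊕ Σ[ (λ i → X^ (tri (suc (suc (i * 2))))) ] n)
      ≈⟨ ⊕-cong ≋-refl (Σ-split₂ (λ k → X^ (tri (suc k))) n) ⟨
    𝟏 ⊕ Σ[ (λ k → X^ (tri (suc k))) ] (n * 2)
      ≈⟨ Σ-suc (λ k → X^ (tri k)) (n * 2) ⟨
    ψ-partial (suc (n * 2)) ∎
    where
    open ≋-Reasoning
    simplify : ∀ t {m n} → m ≡ n → κ (1ℤ ℤ.^ suc t) ⊗ X^ m ≋ X^ n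
    simplify t e = ≋-trans (⊗-cong (≡⇒≋ (cong κ (ℤ.^-zeroˡ (suc t)))) (X^-cong e)) (1⊗ _)
    exponent₁ : ∀ t → 1 * suc t + tri t * 4 ≡ tri (suc (t * 2))
    exponent₁ t = by-doubling (trans (regroup t (tri t)) (trans (cong (λ s → (suc t + s * 2) * 2) (tri-double t))
      (trans (expand t) (sym (tri-double (suc (t * 2)))))))
      where
      regroup : ∀ t τ → (1 * suc t + τ * 4) * 2 ≡ (suc t + τ * 2 * 2) * 2
      regroup = solveℕ-∀
      expand : ∀ t → (suc t + t * suc t * 2) * 2 ≡ suc (t * 2) * suc (suc (t * 2))
      expand = solveℕ-∀
    exponent₂ : ∀ t → 3 * suc t + tri t * 4 ≡ tri (suc (suc (t * 2)))
    exponent₂ t = by-doubling (trans (regroup t (tri t)) (trans (cong (λ s → (3 * suc t + s * 2) * 2) (tri-double t))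
      (trans (expand t) (sym (tri-double (suc (suc (t * 2))))))))
      where
      regroup : ∀ t τ → (3 * suc t + τ * 4) * 2 ≡ (3 * suc t + τ * 2 * 2) * 2
      regroup = solveℕ-∀
      expand : ∀ t → (3 * suc t + t * suc t * 2) * 2 ≡ suc (suc (t * 2)) * suc (suc (suc (t * 2)))
      expand = solveℕ-∀

-- Ramanujan's theta functions f(q, q²) and f(-q, -q⁵), which occur in the 3-dissections of ψ and
-- φ(-q).
A∞ Ω∞ : Series
A∞ = theta 1ℤ 1 2
Ω∞ = theta -1ℤ 1 5

-- Product identities between theta functions

φ₋-product : φ₋ ≋ f∞ ⊗ b∞
φ₋-product = ≋-trans (φ-product -1ℤ refl) (≋-trans
  (solve 2 (λ g b → g :* (b :* b) := b :* g :* b) ≋-refl (V 2 f∞) b∞) (⊗-cong b⊗V₂f ≋-refl))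

φ₊-product : φ₊ ≋ V 2 f∞ ⊗ (P∞ ⊗ P∞)
φ₊-product = φ-product 1ℤ refl

V₂b⊗V₄f : V 2 b∞ ⊗ V 2 (V 2 f∞) ≋ V 2 f∞
V₂b⊗V₄f = ≋-trans (≋-sym (V-⊗ 2 _ _)) (V-cong 2 b⊗V₂f)

φ₊φ₋ : φ₊ ⊗ φ₋ ≋ V 2 φ₋ ⊗ V 2 φ₋
φ₊φ₋ = begin
  φ₊ ⊗ φ₋
    ≈⟨ ⊗-cong φ₊-product (φ-product -1ℤ refl) ⟩
  V 2 f∞ ⊗ (P∞ ⊗ P∞) ⊗ (V 2 f∞ ⊗ (b∞ ⊗ b∞))
    ≈⟨ solve 3 (λ f p b → f :* (p :* p) :* (f :* (b :* b)) := f :* (p :* b) :* (f :* (p :* b))) ≋-refl (V 2 f∞) P∞ b∞ ⟩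
  V 2 f∞ ⊗ (P∞ ⊗ b∞) ⊗ (V 2 f∞ ⊗ (P∞ ⊗ b∞))
    ≈⟨ ⊗-cong fold fold ⟩
  V 2 φ₋ ⊗ V 2 φ₋ ∎
  where
  open ≋-Reasoning
  fold : V 2 f∞ ⊗ (P∞ ⊗ b∞) ≋ V 2 φ₋
  fold = ≋-sym (≋-trans (V-cong 2 φ₋-product) (≋-trans (V-⊗ 2 _ _) (⊗-cong ≋-refl (≋-sym P⊗b))))

even-part-φ : V 2 φ₋ ⊗ E 0 ≋ φ₊ ⊗ φ₊
even-part-φ = ⊗-cancelʳ b₀ (begin
  V 2 φ₋ ⊗ E 0 ⊗ b∞
    ≈⟨ ⊗-assoc _ _ _ ⟩
  V 2 φ₋ ⊗ (E 0 ⊗ b∞)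
    ≈⟨ ⊗-cong (≋-trans (V-cong 2 φ₋-product) (≋-trans (V-⊗ 2 _ _) (⊗-cong ≋-refl (≋-sym P⊗b))))
         (≋-trans (⊗-comm _ _) (≋-trans (⊗-cong (≋-sym (oddProduct≋progression -1ℤ)) ≋-refl)
           (≋-trans even-part (⊗-cong (oddProduct≋progression 1ℤ) ≋-refl)))) ⟩
  V 2 f∞ ⊗ (P∞ ⊗ b∞) ⊗ (P∞ ⊗ φ₊)
    ≈⟨ solve 4 (λ f p b x → f :* (p :* b) :* (p :* x) := f :* (p :* p) :* x :* b) ≋-refl (V 2 f∞) P∞ b∞ φ₊ ⟩
  V 2 f∞ ⊗ (P∞ ⊗ P∞) ⊗ φ₊ ⊗ b∞
    ≈⟨ ⊗-cong (⊗-cong φ₊-product ≋-refl) ≋-refl ⟨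
  φ₊ ⊗ φ₊ ⊗ b∞ ∎)
  where open ≋-Reasoning

ψ-via-c : ψ ≋ c∞ ⊗ V 2 f∞
ψ-via-c = begin
  ψ                                 ≈⟨ ≋-trans ψ-product (≋-trans (≋-sym (⊗-identityʳ _)) (⊗-cong ≋-refl (≋-sym c⊗b))) ⟩
  V 2 (V 2 f∞) ⊗ P∞ ⊗ (c∞ ⊗ b∞)     ≈⟨ solve 4 (λ f p c b → f :* p :* (c :* b) := c :* (p :* b :* f)) ≋-refl (V 2 (V 2 f∞)) P∞ c∞ b∞ ⟩
  c∞ ⊗ (P∞ ⊗ b∞ ⊗ V 2 (V 2 f∞))     ≈⟨ ⊗-cong ≋-refl (≋-trans (⊗-cong P⊗b ≋-refl) V₂b⊗V₄f) ⟩
  c∞ ⊗ V 2 f∞                       ∎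
  where open ≋-Reasoning

-- φ₋ = (q²;q²)∞ b² and ψ = c (q²;q²)∞, while cb = 1 reduces c³ b² to c. Consequently ψ⁹ / φ₋⁸
-- becomes φ₋ c²⁷, whose exponent suits the modulus 27.
c³φ₋ : c∞ ³ ⊗ φ₋ ≋ ψ
c³φ₋ = begin
  c∞ ³ ⊗ φ₋
    ≈⟨ ⊗-cong ≋-refl (φ-product -1ℤ refl) ⟩
  c∞ ³ ⊗ (V 2 f∞ ⊗ (b∞ ⊗ b∞))
    ≈⟨ solve 3 (λ c f b → c :* c :* c :* (f :* (b :* b)) := c :* b :* (c :* b) :* (c :* f)) ≋-refl c∞ (V 2 f∞) b∞ ⟩
  c∞ ⊗ b∞ ⊗ (c∞ ⊗ b∞) ⊗ (c∞ ⊗ V 2 f∞)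
    ≈⟨ ≋-trans (⊗-cong (≋-trans (⊗-cong c⊗b c⊗b) (⊗-identityˡ 𝟏)) (≋-sym ψ-via-c)) (⊗-identityˡ ψ) ⟩
  ψ ∎
  where open ≋-Reasoning

V₃c⊗V₃b : V 3 c∞ ⊗ V 3 b∞ ≋ 𝟏
V₃c⊗V₃b = ≋-trans (≋-sym (V-⊗ 3 _ _)) (≋-trans (V-cong 3 c⊗b) (V-𝟏 3))

-- Completing (-q;q³)∞ (-q²;q³)∞ to c costs (-q³;q³)∞, whose inverse is `V 3 b∞`; together with
-- `V 3 f∞` that gives `V 3 φ₋`.
A-via-c : A∞ ≋ c∞ ⊗ V 3 φ₋
A-via-c = begin
  A∞
    ≈⟨ ≋-trans (theta-product 1ℤ refl 1 2) (≋-trans (≋-sym (⊗-identityʳ _)) (⊗-cong ≋-refl (≋-sym V₃c⊗V₃b))) ⟩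
  V 3 f∞ ⊗ (p₁ ⊗ p₂) ⊗ (V 3 c∞ ⊗ V 3 b∞)
    ≈⟨ solve 5 (λ f p r c b → f :* (p :* r) :* (c :* b) := p :* r :* c :* (f :* b)) ≋-refl (V 3 f∞) p₁ p₂ (V 3 c∞) (V 3 b∞) ⟩
  p₁ ⊗ p₂ ⊗ V 3 c∞ ⊗ (V 3 f∞ ⊗ V 3 b∞)
    ≈⟨ ⊗-cong (≋-sym (≋-trans (progression-split₃ 1ℤ 1 1) (⊗-cong ≋-refl (≋-sym (V-progression 3 1ℤ 1 1)))))
         (≋-sym (≋-trans (V-cong 3 φ₋-product) (V-⊗ 3 _ _))) ⟩
  c∞ ⊗ V 3 φ₋ ∎
  where
  open ≋-Reasoning
  p₁ = progression 1ℤ 1 3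
  p₂ = progression 1ℤ 2 3

-- Multiplication by `V 3 b∞`, the missing progression 3 modulo 6, completes the product to b; then
-- (q²;q²)∞ = ψ b at q³ restores the factor.
Ω-via-b : Ω∞ ≋ b∞ ⊗ V 3 ψ
Ω-via-b = ⊗-cancelʳ (V-coeff₀ 3 b₀) (begin
  Ω∞ ⊗ V 3 b∞
    ≈⟨ ⊗-cong (theta-product -1ℤ refl 1 5) (V-progression 3 -1ℤ 1 2) ⟩
  V 6 f∞ ⊗ (p₁ ⊗ p₅) ⊗ p₃
    ≈⟨ solve 4 (λ f p r s → f :* (p :* r) :* s := p :* s :* r :* f) ≋-refl (V 6 f∞) p₁ p₅ p₃ ⟩
  p₁ ⊗ p₃ ⊗ p₅ ⊗ V 6 f∞
    ≈⟨ ⊗-cong (≋-sym (progression-split₃ -1ℤ 1 2))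
         (≋-trans (V-progression 6 -1ℤ 1 1) (≋-sym (≋-trans (V-cong 3 (V-progression 2 -1ℤ 1 1)) (V-progression 3 -1ℤ 2 2)))) ⟩
  b∞ ⊗ V 3 (V 2 f∞)
    ≈⟨ ⊗-cong ≋-refl (V-cong 3 (≋-trans (≋-sym (⊗-identityˡ _)) (⊗-cong (≋-sym c⊗b) ≋-refl))) ⟩
  b∞ ⊗ V 3 (c∞ ⊗ b∞ ⊗ V 2 f∞)
    ≈⟨ ⊗-cong ≋-refl (≋-trans (V-cong 3 (≋-trans (solve 3 (λ c b f → c :* b :* f := c :* f :* b) ≋-refl c∞ b∞ (V 2 f∞))
         (⊗-cong (≋-sym ψ-via-c) ≋-refl))) (V-⊗ 3 ψ b∞)) ⟩
  b∞ ⊗ (V 3 ψ ⊗ V 3 b∞)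
    ≈⟨ ⊗-assoc _ _ _ ⟨
  b∞ ⊗ V 3 ψ ⊗ V 3 b∞ ∎)
  where
  open ≋-Reasoning
  p₁ = progression -1ℤ 1 6
  p₃ = progression -1ℤ 3 6
  p₅ = progression -1ℤ 5 6

-- Dissections

X-V-monomial : ∀ k .{{_ : NonZero k}} r e {m} → r + e * k ≡ m → X^ r ⊗ V k (X^ e) ≋ X^ m
X-V-monomial k r e p = ≋-trans (⊗-cong ≋-refl (V-X^ k e)) (≋-trans (X^-+ r (e * k)) (X^-cong p))

⊗-Σ-V : ∀ h k .{{_ : NonZero k}} F n → h ⊗ V k (Σ[ F ] n) ≋ Σ[ (λ i → h ⊗ V k (F i)) ] n
⊗-Σ-V h k F n = ≋-trans (⊗-cong ≋-refl (V-Σ k F n)) (Σ-⊗ h _ n)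

-- Even squares give φ(q⁴); odd squares are 1 + 8 `tri i` and give q ψ(q⁸).
φ-dissect₂ : ∀ ε → ε ℤ.* ε ≡ 1ℤ →
  φ ε ≋ V 2 (V 2 φ₊) ⊕ κ (+ 2 ℤ.* ε) ⊗ (X^ 1 ⊗ V 2 (V 2 (V 2 ψ)))
φ-dissect₂ ε ε² = ≈⇒≋ λ N →
  ≈-trans (lim-≈ (φ-Cauchy ε) (ℕ.m≤m*n N 2))
  (≈-trans (≋⇒≈ (finite N))
  (≈-⊕ (V-≈ 2 (V-≈ 2 (≈-sym (lim-≈ (φ-Cauchy 1ℤ) ℕ.≤-refl))))
    (≈-⊗ ≈-refl (≈-⊗ ≈-refl (V-≈ 2 (V-≈ 2 (V-≈ 2 (≈-sym (lim-≈ ψ-Cauchy ℕ.≤-refl)))))))))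
  where
  even-power : ∀ i → ε ℤ.^ (i * 2) ≡ 1ℤ
  even-power zero    = refl
  even-power (suc i) = trans (sym (ℤ.*-assoc ε ε _)) (trans (cong₂ ℤ._*_ ε² (even-power i)) refl)

  F = λ t → κ (+ 2 ℤ.* ε ℤ.^ suc t) ⊗ X^ (suc t * suc t)

  -- `F t` carries the square of t + 1, so its even indices are the odd squares.
  odd-term : ∀ i → F (i * 2) ≋ κ (+ 2 ℤ.* ε) ⊗ (X^ 1 ⊗ V 2 (V 2 (V 2 (X^ (tri i)))))
  odd-term i = ⊗-cong (≡⇒≋ (cong (λ z → κ (+ 2 ℤ.* z)) (trans (cong (ε ℤ.*_) (even-power i)) (ℤ.*-identityʳ ε))))
    (≋-sym (≋-trans (⊗-cong ≋-refl (V-cong 2 (≋-trans (V-cong 2 (V-X^ 2 (tri i))) (V-X^ 2 (tri i * 2)))))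
      (X-V-monomial 2 1 (tri i * 2 * 2) (trans (cong (λ s → 1 + s * 2 * 2) (tri-double i)) (expand i)))))
    where
    expand : ∀ i → 1 + i * suc i * 2 * 2 ≡ suc (i * 2) * suc (i * 2)
    expand = solveℕ-∀

  even-term : ∀ i → F (suc (i * 2)) ≋ V 2 (V 2 (κ (+ 2 ℤ.* 1ℤ ℤ.^ suc i) ⊗ X^ (suc i * suc i)))
  even-term i = ≋-sym (≋-trans (V-cong 2 (V-monomial 2 _ _)) (≋-trans (V-monomial 2 _ _)
    (⊗-cong (≡⇒≋ (cong (λ z → κ (+ 2 ℤ.* z)) (trans (ℤ.^-zeroˡ (suc i)) (sym (even-power (suc i))))))
      (X^-cong (expand i)))))
    where
    expand : ∀ i → suc i * suc i * 2 * 2 ≡ suc (suc (i * 2)) * suc (suc (i * 2))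
    expand = solveℕ-∀

  finite : ∀ n → φ-partial ε (n * 2) ≋
    V 2 (V 2 (φ-partial 1ℤ n)) ⊕ κ (+ 2 ℤ.* ε) ⊗ (X^ 1 ⊗ V 2 (V 2 (V 2 (ψ-partial n))))
  finite n = begin
    𝟏 ⊕ Σ[ F ] (n * 2)
      ≈⟨ ⊕-cong ≋-refl (≋-trans (Σ-split₂ F n) (⊕-cong (Σ-cong n λ i _ → odd-term i) (Σ-cong n λ i _ → even-term i))) ⟩
    𝟏 ⊕ (Σ[ O ] n ⊕ Σ[ (λ i → V 2 (V 2 (F₁ i))) ] n)
      ≈⟨ solve 3 (λ e o v → e :+ (o :+ v) := e :+ v :+ o) ≋-refl 𝟏 _ _ ⟩
    𝟏 ⊕ Σ[ (λ i → V 2 (V 2 (F₁ i))) ] n ⊕ Σ[ O ] n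
      ≈⟨ ⊕-cong
           (≋-trans (V-cong 2 (≋-trans (V-⊕ 2 _ _) (⊕-cong (V-𝟏 2) (V-Σ 2 F₁ n))))
             (≋-trans (V-⊕ 2 _ _) (⊕-cong (V-𝟏 2) (V-Σ 2 (λ i → V 2 (F₁ i)) n))))
           (≋-trans (⊗-cong ≋-refl (≋-trans (⊗-cong ≋-refl (V-cong 2 (≋-trans (V-cong 2 (V-Σ 2 _ n)) (V-Σ 2 _ n))))
             (⊗-Σ-V (X^ 1) 2 _ n))) (Σ-⊗ _ _ n)) ⟨
    V 2 (V 2 (φ-partial 1ℤ n)) ⊕ κ (+ 2 ℤ.* ε) ⊗ (X^ 1 ⊗ V 2 (V 2 (V 2 (ψ-partial n)))) ∎
    where
    open ≋-Reasoning
    F₁ = λ t → κ (+ 2 ℤ.* 1ℤ ℤ.^ suc t) ⊗ X^ (suc t * suc t)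
    O  = λ i → κ (+ 2 ℤ.* ε) ⊗ (X^ 1 ⊗ V 2 (V 2 (V 2 (X^ (tri i)))))

-- Triangular numbers of index 3i + 1 are 1 + 9 `tri i`. All others are multiples of 3, and their
-- thirds are the exponents of f(q, q²), one wing for each of the two remaining classes of indices.
ψ-dissect₃ : ψ ≋ V 3 A∞ ⊕ X^ 1 ⊗ V 3 (V 3 ψ)
ψ-dissect₃ = ≈⇒≋ λ N →
  ≈-trans (lim-≈ ψ-Cauchy (ℕ.≤-trans (ℕ.m≤m*n N 3) (ℕ.n≤1+n _)))
  (≈-trans (≋⇒≈ (finite N))
  (≈-⊕ (V-≈ 3 (≈-sym (lim-≈ (theta-series-Cauchy 1ℤ refl 1 2) ℕ.≤-refl)))
    (≈-⊗ ≈-refl (V-≈ 3 (V-≈ 3 (≈-sym (lim-≈ ψ-Cauchy ℕ.≤-refl)))))))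
  where
  F = λ k → X^ (tri (suc k))

  tri-expand : ∀ m {e} → m * suc m ≡ e * 2 → tri m ≡ e
  tri-expand m p = by-doubling (trans (tri-double m) p)

  first : ∀ i → F (i * 3) ≋ X^ 1 ⊗ V 3 (V 3 (X^ (tri i)))
  first i = ≋-sym (≋-trans (⊗-cong ≋-refl (V-cong 3 (V-X^ 3 (tri i)))) (X-V-monomial 3 1 (tri i * 3)
    (sym (tri-expand (suc (i * 3)) (trans (expand i) (trans (cong (λ s → 2 + s * 3 * 3) (sym (tri-double i))) (regroup (tri i))))))))
    where
    expand : ∀ i → suc (i * 3) * suc (suc (i * 3)) ≡ 2 + i * suc i * 3 * 3
    expand = solveℕ-∀
    regroup : ∀ τ → 2 + τ * 2 * 3 * 3 ≡ (1 + τ * 3 * 3) * 2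
    regroup = solveℕ-∀

  monomial : ∀ i {m n} → n ≡ m * 3 → X^ n ≋ V 3 (κ (1ℤ ℤ.^ suc i) ⊗ X^ m)
  monomial i {m} e = ≋-sym (≋-trans (V-monomial 3 _ m) (≋-trans
    (⊗-cong (≡⇒≋ (cong κ (ℤ.^-zeroˡ (suc i)))) (X^-cong (sym e))) (1⊗ _)))

  second : ∀ i → F (suc (i * 3)) ≋ V 3 (κ (1ℤ ℤ.^ suc i) ⊗ X^ (1 * suc i + tri i * 3))
  second i = monomial i (tri-expand (suc (suc (i * 3))) (trans (expand i)
    (trans (cong (λ s → (suc i * 2 + s * 3) * 3) (sym (tri-double i))) (regroup i (tri i)))))
    where
    expand : ∀ i → suc (suc (i * 3)) * suc (suc (suc (i * 3))) ≡ (suc i * 2 + i * suc i * 3) * 3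
    expand = solveℕ-∀
    regroup : ∀ i τ → (suc i * 2 + τ * 2 * 3) * 3 ≡ (1 * suc i + τ * 3) * 3 * 2
    regroup = solveℕ-∀

  third : ∀ i → F (suc (suc (i * 3))) ≋ V 3 (κ (1ℤ ℤ.^ suc i) ⊗ X^ (2 * suc i + tri i * 3))
  third i = monomial i (tri-expand (suc (suc (suc (i * 3)))) (trans (expand i)
    (trans (cong (λ s → (suc i * 4 + s * 3) * 3) (sym (tri-double i))) (regroup i (tri i)))))
    where
    expand : ∀ i → suc (suc (suc (i * 3))) * suc (suc (suc (suc (i * 3)))) ≡ (suc i * 4 + i * suc i * 3) * 3
    expand = solveℕ-∀
    regroup : ∀ i τ → (suc i * 4 + τ * 2 * 3) * 3 ≡ (2 * suc i + τ * 3) * 3 * 2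
    regroup = solveℕ-∀

  finite : ∀ n → ψ-partial (suc (n * 3)) ≋ V 3 (theta-series 1ℤ 1 2 n) ⊕ X^ 1 ⊗ V 3 (V 3 (ψ-partial n))
  finite n = begin
    ψ-partial (suc (n * 3))
      ≈⟨ ≋-trans (Σ-suc (λ k → X^ (tri k)) (n * 3)) (⊕-cong ≋-refl (Σ-split₃ F n)) ⟩
    𝟏 ⊕ (Σ[ (λ i → F (i * 3)) ] n ⊕ Σ[ (λ i → F (suc (i * 3))) ] n ⊕ Σ[ (λ i → F (suc (suc (i * 3)))) ] n)
      ≈⟨ ⊕-cong ≋-refl (⊕-cong (⊕-cong (Σ-cong n λ i _ → first i) (Σ-cong n λ i _ → second i)) (Σ-cong n λ i _ → third i)) ⟩
    𝟏 ⊕ (Σ[ (λ i → X^ 1 ⊗ V 3 (V 3 (X^ (tri i)))) ] n ⊕ Σ[ G₁ ] n ⊕ Σ[ G₂ ] n)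
      ≈⟨ solve 4 (λ e a b c → e :+ (a :+ b :+ c) := e :+ (b :+ c) :+ a) ≋-refl 𝟏 _ _ _ ⟩
    𝟏 ⊕ (Σ[ G₁ ] n ⊕ Σ[ G₂ ] n) ⊕ Σ[ (λ i → X^ 1 ⊗ V 3 (V 3 (X^ (tri i)))) ] n
      ≈⟨ ⊕-cong
           (≋-trans (V-⊕ 3 _ _) (⊕-cong (V-𝟏 3) (≋-trans (V-Σ 3 _ n)
             (≋-trans (Σ-cong n λ i _ → V-⊕ 3 _ _) (Σ-⊕ G₁ G₂ n)))))
           (≋-trans (⊗-cong ≋-refl (V-cong 3 (V-Σ 3 _ n))) (⊗-Σ-V (X^ 1) 3 _ n)) ⟨
    V 3 (theta-series 1ℤ 1 2 n) ⊕ X^ 1 ⊗ V 3 (V 3 (ψ-partial n)) ∎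
    where
    open ≋-Reasoning
    G₁ = λ i → V 3 (κ (1ℤ ℤ.^ suc i) ⊗ X^ (1 * suc i + tri i * 3))
    G₂ = λ i → V 3 (κ (1ℤ ℤ.^ suc i) ⊗ X^ (2 * suc i + tri i * 3))

-- Multiples of 3 contribute φ(-q⁹). The remaining integers are ±(3t + 1) with t in ℤ, so their
-- squares form one bilateral series, counted twice and with sign -(-1)^t.
φ₋-dissect₃ : φ₋ ≋ V 3 (V 3 φ₋) ⊕ κ (ℤ.- + 2) ⊗ (X^ 1 ⊗ V 3 Ω∞)
φ₋-dissect₃ = ≈⇒≋ λ N →
  ≈-trans (lim-≈ (φ-Cauchy -1ℤ) (ℕ.≤-trans (ℕ.m≤m*n N 3) (ℕ.n≤1+n _)))
  (≈-trans (≋⇒≈ (finite N))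
  (≈-⊕ (V-≈ 3 (V-≈ 3 (≈-sym (lim-≈ (φ-Cauchy -1ℤ) ℕ.≤-refl))))
    (≈-⊗ ≈-refl (≈-⊗ ≈-refl (V-≈ 3 (≈-sym (lim-≈ (theta-series-Cauchy -1ℤ refl 1 5) ℕ.≤-refl)))))))
  where
  F = λ t → κ (+ 2 ℤ.* -1ℤ ℤ.^ suc t) ⊗ X^ (suc t * suc t)

  sgn-3 : ∀ i → -1ℤ ℤ.^ (i * 3) ≡ -1ℤ ℤ.^ i
  sgn-3 zero    = refl
  sgn-3 (suc i) = trans (cong (λ z → -1ℤ ℤ.* (-1ℤ ℤ.* (-1ℤ ℤ.* z))) (sgn-3 i)) (collapse (-1ℤ ℤ.^ i))
    where
    collapse : ∀ z → -1ℤ ℤ.* (-1ℤ ℤ.* (-1ℤ ℤ.* z)) ≡ -1ℤ ℤ.* z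
    collapse = solve-∀

  κ-merge : ∀ a b f → κ a ⊗ (κ b ⊗ f) ≋ κ (a ℤ.* b) ⊗ f
  κ-merge a b f = ≋-trans (≋-sym (⊗-assoc _ _ f)) (⊗-cong (≋-sym (κ-* a b)) ≋-refl)

  outer : ∀ i {a m n} → 1 + m * 3 ≡ n → (ℤ.- + 2) ℤ.* -1ℤ ℤ.^ suc i ≡ a →
    κ a ⊗ X^ n ≋ κ (ℤ.- + 2) ⊗ (X^ 1 ⊗ V 3 (κ (-1ℤ ℤ.^ suc i) ⊗ X^ m))
  outer i {a} {m} {n} p r = ≋-sym (begin
    κ (ℤ.- + 2) ⊗ (X^ 1 ⊗ V 3 (κ s ⊗ X^ m))
      ≈⟨ ⊗-cong ≋-refl (⊗-cong ≋-refl (V-κ⊗ 3 s _)) ⟩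
    κ (ℤ.- + 2) ⊗ (X^ 1 ⊗ (κ s ⊗ V 3 (X^ m)))
      ≈⟨ solve 4 (λ k x s v → k :* (x :* (s :* v)) := k :* (s :* (x :* v))) ≋-refl _ _ _ _ ⟩
    κ (ℤ.- + 2) ⊗ (κ s ⊗ (X^ 1 ⊗ V 3 (X^ m)))
      ≈⟨ ≋-trans (κ-merge _ s _) (⊗-cong (≡⇒≋ (cong κ r)) (X-V-monomial 3 1 m p)) ⟩
    κ a ⊗ X^ n ∎)
    where
    open ≋-Reasoning
    s = -1ℤ ℤ.^ suc i

  sign₁ : ∀ z → (ℤ.- + 2) ℤ.* (-1ℤ ℤ.* z) ≡ + 2 ℤ.* z
  sign₁ = solve-∀

  sign₂ : ∀ z → + 2 ℤ.* z ≡ + 2 ℤ.* (-1ℤ ℤ.* (-1ℤ ℤ.* z))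
  sign₂ = solve-∀

  tri-cong : ∀ i {p} → ∀ a b → a + tri i * 2 * b ≡ p → a + i * suc i * b ≡ p
  tri-cong i a b e = trans (cong (λ s → a + s * b) (sym (tri-double i))) e

  first : ∀ i → F (suc i * 3) ≋ κ (ℤ.- + 2) ⊗ (X^ 1 ⊗ V 3 (κ (-1ℤ ℤ.^ suc i) ⊗ X^ (5 * suc i + tri i * 6)))
  first i = outer i (sym (trans (expand i) (tri-cong i (16 + 15 * i) 9 (regroup i (tri i)))))
    (trans (cong (λ z → (ℤ.- + 2) ℤ.* z) (sym (sgn-3 (suc i)))) (sign (-1ℤ ℤ.^ (suc i * 3))))
    where
    sign : ∀ z → (ℤ.- + 2) ℤ.* z ≡ + 2 ℤ.* (-1ℤ ℤ.* z)
    sign = solve-∀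
    expand : ∀ i → suc (suc i * 3) * suc (suc i * 3) ≡ 16 + 15 * i + i * suc i * 9
    expand = solveℕ-∀
    regroup : ∀ i τ → 16 + 15 * i + τ * 2 * 9 ≡ 1 + (5 * suc i + τ * 6) * 3
    regroup = solveℕ-∀

  second : ∀ i → F (suc (i * 3)) ≋ κ (ℤ.- + 2) ⊗ (X^ 1 ⊗ V 3 (κ (-1ℤ ℤ.^ suc i) ⊗ X^ (1 * suc i + tri i * 6)))
  second i = outer i (sym (trans (expand i) (tri-cong i (4 + 3 * i) 9 (regroup i (tri i)))))
    (trans (sign₁ _) (trans (cong (+ 2 ℤ.*_) (sym (sgn-3 i))) (sign₂ _)))
    where
    expand : ∀ i → suc (suc (i * 3)) * suc (suc (i * 3)) ≡ 4 + 3 * i + i * suc i * 9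
    expand = solveℕ-∀
    regroup : ∀ i τ → 4 + 3 * i + τ * 2 * 9 ≡ 1 + (1 * suc i + τ * 6) * 3
    regroup = solveℕ-∀

  third : ∀ i → F (suc (suc (i * 3))) ≋ V 3 (V 3 (κ (+ 2 ℤ.* -1ℤ ℤ.^ suc i) ⊗ X^ (suc i * suc i)))
  third i = ≋-sym (≋-trans (V-cong 3 (V-monomial 3 _ _)) (≋-trans (V-monomial 3 _ _)
    (⊗-cong (≡⇒≋ (cong (λ z → κ (+ 2 ℤ.* z)) (sym (sgn-3 (suc i))))) (X^-cong (expand i)))))
    where
    expand : ∀ i → suc i * suc i * 3 * 3 ≡ suc i * 3 * (suc i * 3)
    expand = solveℕ-∀

  finite : ∀ n → φ-partial -1ℤ (suc (n * 3)) ≋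
    V 3 (V 3 (φ-partial -1ℤ n)) ⊕ κ (ℤ.- + 2) ⊗ (X^ 1 ⊗ V 3 (theta-series -1ℤ 1 5 n))
  finite n = begin
    𝟏 ⊕ (Σ[ F ] (n * 3) ⊕ F (n * 3))
      ≈⟨ ⊕-cong ≋-refl (⊕-cong (Σ-split₃ F n) ≋-refl) ⟩
    𝟏 ⊕ (Σ[ (λ i → F (i * 3)) ] n ⊕ Σ[ (λ i → F (suc (i * 3))) ] n ⊕ Σ[ (λ i → F (suc (suc (i * 3)))) ] n ⊕ F (n * 3))
      -- The extra summand `F (n * 3)` joins its class, which then has n + 1 members: the first
      -- becomes the constant term of Ω, the other n its second wing.
      ≈⟨ solve 5 (λ e a b c d → e :+ (a :+ b :+ c :+ d) := e :+ c :+ ((a :+ d) :+ b)) ≋-refl 𝟏 _ _ _ _ ⟩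
    𝟏 ⊕ Σ[ (λ i → F (suc (suc (i * 3)))) ] n ⊕ (Σ[ (λ i → F (i * 3)) ] (suc n) ⊕ Σ[ (λ i → F (suc (i * 3))) ] n)
      ≈⟨ ⊕-cong (⊕-cong ≋-refl (Σ-cong n λ i _ → third i))
           (⊕-cong (≋-trans (Σ-suc (λ i → F (i * 3)) n) (⊕-cong ≋-refl (Σ-cong n λ i _ → first i))) (Σ-cong n λ i _ → second i)) ⟩
    𝟏 ⊕ Σ[ (λ i → V 3 (V 3 (F i))) ] n ⊕ (F 0 ⊕ Σ[ G₅ ] n ⊕ Σ[ G₁ ] n)
      ≈⟨ ⊕-cong ≋-refl (≋-trans (⊕-cong (⊕-cong constant ≋-refl) ≋-refl)
           (solve 3 (λ e a b → e :+ a :+ b := e :+ (b :+ a)) ≋-refl _ _ _)) ⟩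
    𝟏 ⊕ Σ[ (λ i → V 3 (V 3 (F i))) ] n ⊕ (κ (ℤ.- + 2) ⊗ (X^ 1 ⊗ V 3 𝟏) ⊕ (Σ[ G₁ ] n ⊕ Σ[ G₅ ] n))
      ≈⟨ ⊕-cong
           (≋-trans (V-cong 3 (≋-trans (V-⊕ 3 _ _) (⊕-cong (V-𝟏 3) (V-Σ 3 F n))))
             (≋-trans (V-⊕ 3 _ _) (⊕-cong (V-𝟏 3) (V-Σ 3 (λ i → V 3 (F i)) n))))
           (≋-trans (distribute _ _)
             (⊕-cong ≋-refl (≋-trans (⊗-cong ≋-refl (⊗-Σ-V (X^ 1) 3 _ n)) (≋-trans (Σ-⊗ _ _ n)
               (≋-trans (Σ-cong n λ i _ → distribute _ _) (Σ-⊕ G₁ G₅ n)))))) ⟨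
    V 3 (V 3 (φ-partial -1ℤ n)) ⊕ κ (ℤ.- + 2) ⊗ (X^ 1 ⊗ V 3 (theta-series -1ℤ 1 5 n)) ∎
    where
    open ≋-Reasoning
    G₁ = λ i → κ (ℤ.- + 2) ⊗ (X^ 1 ⊗ V 3 (κ (-1ℤ ℤ.^ suc i) ⊗ X^ (1 * suc i + tri i * 6)))
    G₅ = λ i → κ (ℤ.- + 2) ⊗ (X^ 1 ⊗ V 3 (κ (-1ℤ ℤ.^ suc i) ⊗ X^ (5 * suc i + tri i * 6)))
    constant : F 0 ≋ κ (ℤ.- + 2) ⊗ (X^ 1 ⊗ V 3 𝟏)
    constant = ⊗-cong ≋-refl (≋-sym (≋-trans (⊗-cong ≋-refl (V-𝟏 3)) (⊗-identityʳ _)))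
    distribute : ∀ f g → κ (ℤ.- + 2) ⊗ (X^ 1 ⊗ V 3 (f ⊕ g))
                       ≋ κ (ℤ.- + 2) ⊗ (X^ 1 ⊗ V 3 f) ⊕ κ (ℤ.- + 2) ⊗ (X^ 1 ⊗ V 3 g)
    distribute f g = ≋-trans (⊗-cong ≋-refl (⊗-cong ≋-refl (V-⊕ 3 f g)))
      (solve 4 (λ k x f g → k :* (x :* (f :+ g)) := k :* (x :* f) :+ k :* (x :* g)) ≋-refl _ _ _ _)

κ-cancelˡ : ∀ a .{{_ : ℤ.NonZero a}} {f g} → κ a ⊗ f ≋ κ a ⊗ g → f ≋ g
κ-cancelˡ a {f} {g} e .coeff n = ℤ.*-cancelˡ-≡ a (f n) (g n)
  (trans (sym (κ-coeff a f n)) (trans (coeff e n) (κ-coeff a g n)))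

V-injective : ∀ k .{{_ : NonZero k}} {f g} → V k f ≋ V k g → f ≋ g
V-injective k {f} {g} e = ≋-trans (≋-sym (U-V k f)) (≋-trans (U-cong k 0 e) (U-V k g))

_² : Series → Series
f ² = f ⊗ f

²-cong : ∀ {f g} → f ≋ g → f ² ≋ g ²
²-cong e = ⊗-cong e e

V-² : ∀ k .{{_ : NonZero k}} f → V k (f ²) ≋ V k f ²
V-² k f = V-⊗ k f f

q : Series
q = X^ 1

V₂q : V 2 q ≋ q ²
V₂q = ≋-trans (V-X^ 2 1) (≋-sym (X^-+ 1 1))

φ₋₀ : φ₋ 0 ≡ 1ℤ
φ₋₀ = trans (coeff φ₋-product 0) (⊗-coeff₀ f₀ b₀)

-- 2-dissections

private
  a₁ = V 2 φ₊
  w₁ = V 2 (V 2 ψ)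
  a₂ = V 2 a₁
  w₂ = V 2 w₁

φ₊-dissect₂ : φ₊ ≋ a₂ ⊕ κ (+ 2) ⊗ (q ⊗ w₂)
φ₊-dissect₂ = φ-dissect₂ 1ℤ refl

φ₋-dissect₂ : φ₋ ≋ a₂ ⊕ κ (ℤ.- + 2) ⊗ (q ⊗ w₂)
φ₋-dissect₂ = φ-dissect₂ -1ℤ refl

V₂-combination : ∀ k → V 2 (a₁ ² ⊕ κ k ⊗ (q ⊗ w₁ ²)) ≋ a₂ ² ⊕ κ k ⊗ (q ² ⊗ w₂ ²)
V₂-combination k = ≋-trans (V-⊕ 2 _ _) (⊕-cong (V-² 2 a₁)
  (≋-trans (V-κ⊗ 2 k _) (⊗-cong ≋-refl (≋-trans (V-⊗ 2 q _) (⊗-cong V₂q (V-² 2 w₁))))))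

-- Proved with q² for q: there the left side is φ(q) φ(-q), a product of conjugate dissections and
-- hence a difference of squares.
φ₋² : φ₋ ² ≋ a₁ ² ⊕ κ (ℤ.- + 4) ⊗ (q ⊗ w₁ ²)
φ₋² = V-injective 2 (begin
  V 2 (φ₋ ²)
    ≈⟨ ≋-trans (V-² 2 φ₋) (≋-sym φ₊φ₋) ⟩
  φ₊ ⊗ φ₋
    ≈⟨ ⊗-cong φ₊-dissect₂ φ₋-dissect₂ ⟩
  (a₂ ⊕ κ (+ 2) ⊗ (q ⊗ w₂)) ⊗ (a₂ ⊕ κ (ℤ.- + 2) ⊗ (q ⊗ w₂))
    ≈⟨ solve 3 (λ a q w → (a :+ con (+ 2) :* (q :* w)) :* (a :+ con (ℤ.- + 2) :* (q :* w))
         := a :* a :+ con (ℤ.- + 4) :* (q :* q :* (w :* w))) ≋-refl a₂ q w₂ ⟩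
  a₂ ² ⊕ κ (ℤ.- + 4) ⊗ (q ² ⊗ w₂ ²)
    ≈⟨ V₂-combination (ℤ.- + 4) ⟨
  V 2 (a₁ ² ⊕ κ (ℤ.- + 4) ⊗ (q ⊗ w₁ ²)) ∎)
  where open ≋-Reasoning

-- φ(-q)² is dissected in two ways, by φ₋² and by squaring the dissection of φ(-q);
-- comparing even and odd parts gives φ₊² and ψ².
private
  even₁ odd₁ even₂ odd₂ : Series
  even₁ = φ₊ ²
  odd₁  = κ (ℤ.- + 4) ⊗ V 2 ψ ²
  even₂ = a₁ ² ⊕ κ (+ 4) ⊗ (q ⊗ w₁ ²)
  odd₂  = κ (ℤ.- + 4) ⊗ (a₁ ⊗ w₁)

  φ₋²-parts₁ : φ₋ ² ≋ V 2 even₁ ⊕ q ⊗ V 2 odd₁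
  φ₋²-parts₁ = ≋-trans φ₋² (⊕-cong (≋-sym (V-² 2 φ₊)) (≋-sym (≋-trans
    (⊗-cong ≋-refl (≋-trans (V-κ⊗ 2 _ _) (⊗-cong ≋-refl (V-² 2 (V 2 ψ)))))
    (solve 3 (λ q k w → q :* (k :* w) := k :* (q :* w)) ≋-refl q _ _))))

  φ₋²-parts₂ : φ₋ ² ≋ V 2 even₂ ⊕ q ⊗ V 2 odd₂
  φ₋²-parts₂ = begin
    φ₋ ²
      ≈⟨ ²-cong φ₋-dissect₂ ⟩
    (a₂ ⊕ κ (ℤ.- + 2) ⊗ (q ⊗ w₂)) ²
      ≈⟨ solve 3 (λ a q w → let f = a :+ con (ℤ.- + 2) :* (q :* w) in f :* f
           := a :* a :+ con (+ 4) :* (q :* q :* (w :* w)) :+ q :* (con (ℤ.- + 4) :* (a :* w))) ≋-refl a₂ q w₂ ⟩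
    a₂ ² ⊕ κ (+ 4) ⊗ (q ² ⊗ w₂ ²) ⊕ q ⊗ (κ (ℤ.- + 4) ⊗ (a₂ ⊗ w₂))
      ≈⟨ ⊕-cong (V₂-combination (+ 4)) (⊗-cong ≋-refl (≋-trans (V-κ⊗ 2 _ _) (⊗-cong ≋-refl (V-⊗ 2 a₁ w₁)))) ⟨
    V 2 even₂ ⊕ q ⊗ V 2 odd₂ ∎
    where open ≋-Reasoning

  parts≋ : V 2 even₁ ⊕ q ⊗ V 2 odd₁ ≋ V 2 even₂ ⊕ q ⊗ V 2 odd₂
  parts≋ = ≋-trans (≋-sym φ₋²-parts₁) φ₋²-parts₂

φ₊² : φ₊ ² ≋ a₁ ² ⊕ κ (+ 4) ⊗ (q ⊗ w₁ ²)
φ₊² = ≋-trans (≋-sym (U₂₀ even₁ odd₁)) (≋-trans (U-cong 2 0 parts≋) (U₂₀ even₂ odd₂))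

ψ² : ψ ² ≋ φ₊ ⊗ V 2 ψ
ψ² = V-injective 2 (≋-trans (V-² 2 ψ) (≋-trans
  (κ-cancelˡ (ℤ.- + 4) (≋-trans (≋-sym (U₂₁ even₁ odd₁)) (≋-trans (U-cong 2 1 parts≋) (U₂₁ even₂ odd₂))))
  (≋-sym (V-⊗ 2 φ₊ (V 2 ψ)))))

-- Jacobi's identity. With A = φ(q²)² and B = 4 q ψ(q⁴)² it is (A + B)² = (A - B)² + 4AB, where
-- φ(q²) ψ(q⁴) = ψ(q²)² by `ψ²`.
φ⁴-difference : φ₊ ² ² ≋ φ₋ ² ² ⊕ κ (+ 16) ⊗ (q ⊗ V 2 ψ ² ²)
φ⁴-difference = begin
  φ₊ ² ²
    ≈⟨ ²-cong φ₊² ⟩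
  (a₁ ² ⊕ κ (+ 4) ⊗ (q ⊗ w₁ ²)) ²
    ≈⟨ solve 3 (λ a q w → let f = a :* a :+ con (+ 4) :* (q :* (w :* w)); g = a :* a :+ con (ℤ.- + 4) :* (q :* (w :* w)) in
         f :* f := g :* g :+ con (+ 16) :* (q :* ((a :* w) :* (a :* w)))) ≋-refl a₁ q w₁ ⟩
  (a₁ ² ⊕ κ (ℤ.- + 4) ⊗ (q ⊗ w₁ ²)) ² ⊕ κ (+ 16) ⊗ (q ⊗ (a₁ ⊗ w₁) ²)
    ≈⟨ ⊕-cong (²-cong φ₋²) (⊗-cong ≋-refl (⊗-cong ≋-refl (²-cong (≋-trans (≋-sym (V-² 2 ψ)) (≋-trans (V-cong 2 ψ²) (V-⊗ 2 _ _)))))) ⟨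
  φ₋ ² ² ⊕ κ (+ 16) ⊗ (q ⊗ V 2 ψ ² ²) ∎
  where open ≋-Reasoning

-- The progression 32n + 4

-- Subscripts name progressions of v₀: E₁₆₊₄ generates 2 v₀(16n + 4), and D generates 2 v₀(32n + 4).
-- The -1 in `E 0` affects only E₄.
E₄ E₈₊₄ E₁₆₊₄ D : Series
E₄    = U 2 0 (E 0)
E₈₊₄  = U 2 1 E₄
E₁₆₊₄ = U 2 0 E₈₊₄
D     = U 2 0 E₁₆₊₄

-- The even part of φ(q)² is φ(q²)², by the 2-dissection of φ together with `φ₊²`.
φ₋⊗E₄ : φ₋ ⊗ E₄ ≋ φ₊ ²
φ₋⊗E₄ = begin
  φ₋ ⊗ E₄
    ≈⟨ U-V-⊗ 2 0 (s≤s z≤n) φ₋ (E 0) ⟨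
  U 2 0 (V 2 φ₋ ⊗ E 0)
    ≈⟨ U-cong 2 0 (≋-trans even-part-φ (²-cong φ₊-dissect₂)) ⟩
  U 2 0 ((a₂ ⊕ κ (+ 2) ⊗ (q ⊗ w₂)) ²)
    ≈⟨ U-cong 2 0 (≋-trans
         (solve 3 (λ a q w → let f = a :+ con (+ 2) :* (q :* w) in f :* f
           := a :* a :+ con (+ 4) :* (q :* q :* (w :* w)) :+ q :* (con (+ 4) :* (a :* w))) ≋-refl a₂ q w₂)
         (≋-sym (⊕-cong (V₂-combination (+ 4)) (⊗-cong ≋-refl (≋-trans (V-κ⊗ 2 _ _) (⊗-cong ≋-refl (V-⊗ 2 a₁ w₁))))))) ⟩
  U 2 0 (V 2 even₂ ⊕ q ⊗ V 2 (κ (+ 4) ⊗ (a₁ ⊗ w₁)))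
    ≈⟨ ≋-trans (U₂₀ _ _) (≋-sym φ₊²) ⟩
  φ₊ ² ∎
  where open ≋-Reasoning

private
  -- With the 2 absorbed, the 2-dissection of φ(q) reads a₂ + q y₂.
  y₀ = κ (+ 2) ⊗ V 2 ψ
  y₁ = κ (+ 2) ⊗ w₁
  y₂ = κ (+ 2) ⊗ w₂

  V₂y₀ : V 2 y₀ ≋ y₁
  V₂y₀ = V-κ⊗ 2 _ _
  V₂y₁ : V 2 y₁ ≋ y₂
  V₂y₁ = V-κ⊗ 2 _ _

-- Expanding E₄ = φ(q)² / φ(-q) by φ(q) φ(q²)² turns the denominator into φ(-q⁴)⁴, which passes
-- through the next two extractions. The numerator φ(q)³ φ(q²)² is a polynomial in a₂ and q y₂.
V₂φ₋⁴⊗E₄ : V 2 (V 2 φ₋) ² ² ⊗ E₄ ≋ (a₂ ⊕ q ⊗ y₂) ³ ⊗ (a₂ ² ⊕ (q ⊗ y₂) ²)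
V₂φ₋⁴⊗E₄ = begin
  V 2 (V 2 φ₋) ² ² ⊗ E₄
    ≈⟨ ⊗-cong (≋-trans (≋-sym (≋-trans (V-² 2 _) (²-cong (V-² 2 _)))) (V-cong 2 (²-cong (≋-sym φ₊φ₋)))) ≋-refl ⟩
  V 2 ((φ₊ ⊗ φ₋) ²) ⊗ E₄
    ≈⟨ ⊗-cong (≋-trans (V-² 2 _) (²-cong (V-⊗ 2 φ₊ φ₋))) ≋-refl ⟩
  (a₁ ⊗ V 2 φ₋) ² ⊗ E₄
    ≈⟨ solve 3 (λ a v e → a :* v :* (a :* v) :* e := v :* v :* (e :* (a :* a))) ≋-refl a₁ (V 2 φ₋) E₄ ⟩
  V 2 φ₋ ² ⊗ (E₄ ⊗ a₁ ²)
    ≈⟨ ⊗-cong φ₊φ₋ ≋-refl ⟨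
  φ₊ ⊗ φ₋ ⊗ (E₄ ⊗ a₁ ²)
    ≈⟨ solve 4 (λ p m e a → p :* m :* (e :* a) := p :* (m :* e) :* a) ≋-refl φ₊ φ₋ E₄ (a₁ ²) ⟩
  φ₊ ⊗ (φ₋ ⊗ E₄) ⊗ a₁ ²
    ≈⟨ ⊗-cong (⊗-cong ≋-refl φ₋⊗E₄) ≋-refl ⟩
  φ₊ ⊗ φ₊ ² ⊗ a₁ ²
    ≈⟨ ⊗-cong (≋-trans (≋-sym (⊗-assoc _ _ _)) (³-cong (≋-trans φ₊-dissect₂ (⊕-cong ≋-refl shuffle))))
         (≋-trans (≋-sym (V-² 2 φ₊)) (≋-trans (V-cong 2 φ₊²) (≋-trans (V₂-combination (+ 4)) (⊕-cong ≋-refl shuffle²)))) ⟩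
  (a₂ ⊕ q ⊗ y₂) ³ ⊗ (a₂ ² ⊕ (q ⊗ y₂) ²) ∎
  where
  open ≋-Reasoning
  shuffle : κ (+ 2) ⊗ (q ⊗ w₂) ≋ q ⊗ y₂
  shuffle = solve 2 (λ q w → con (+ 2) :* (q :* w) := q :* (con (+ 2) :* w)) ≋-refl q w₂
  shuffle² : κ (+ 4) ⊗ (q ² ⊗ w₂ ²) ≋ (q ⊗ y₂) ²
  shuffle² = solve 2 (λ q w → con (+ 4) :* (q :* q :* (w :* w)) := q :* (con (+ 2) :* w) :* (q :* (con (+ 2) :* w))) ≋-refl q w₂

private
  -- Odd and even part of (x + q y)³ (x² + q² y²) in q. The third argument stands for q².
  quintic-odd : Series → Series → Series → Series
  quintic-odd x y q = κ (+ 3) ⊗ (x ² ² ⊗ y) ⊕ κ (+ 4) ⊗ (q ⊗ (x ² ⊗ y ³)) ⊕ q ² ⊗ (y ² ² ⊗ y)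

  quintic-even : Series → Series → Series → Series
  quintic-even x y q = x ² ² ⊗ x ⊕ κ (+ 4) ⊗ (q ⊗ (x ³ ⊗ y ²)) ⊕ κ (+ 3) ⊗ (q ² ⊗ (x ⊗ y ² ²))

  V-quintic-odd : ∀ x y q → V 2 (quintic-odd x y q) ≋ quintic-odd (V 2 x) (V 2 y) (V 2 q)
  V-quintic-odd x y q = ≋-trans (V-⊕ 2 _ _) (⊕-cong (≋-trans (V-⊕ 2 _ _) (⊕-cong
    (≋-trans (V-κ⊗ 2 _ _) (⊗-cong ≋-refl (≋-trans (V-⊗ 2 _ _) (⊗-cong (≋-trans (V-² 2 _) (²-cong (V-² 2 x))) ≋-refl))))
    (≋-trans (V-κ⊗ 2 _ _) (⊗-cong ≋-refl (≋-trans (V-⊗ 2 _ _) (⊗-cong ≋-refl (≋-trans (V-⊗ 2 _ _) (⊗-cong (V-² 2 x) (V-³ 2 y)))))))))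
    (≋-trans (V-⊗ 2 _ _) (⊗-cong (V-² 2 q) (≋-trans (V-⊗ 2 _ _) (⊗-cong (≋-trans (V-² 2 _) (²-cong (V-² 2 y))) ≋-refl)))))

  V-quintic-even : ∀ x y q → V 2 (quintic-even x y q) ≋ quintic-even (V 2 x) (V 2 y) (V 2 q)
  V-quintic-even x y q = ≋-trans (V-⊕ 2 _ _) (⊕-cong (≋-trans (V-⊕ 2 _ _) (⊕-cong
    (≋-trans (V-⊗ 2 _ _) (⊗-cong (≋-trans (V-² 2 _) (²-cong (V-² 2 x))) ≋-refl))
    (≋-trans (V-κ⊗ 2 _ _) (⊗-cong ≋-refl (≋-trans (V-⊗ 2 _ _) (⊗-cong ≋-refl (≋-trans (V-⊗ 2 _ _) (⊗-cong (V-³ 2 x) (V-² 2 y)))))))))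
    (≋-trans (V-κ⊗ 2 _ _) (⊗-cong ≋-refl (≋-trans (V-⊗ 2 _ _) (⊗-cong (V-² 2 q) (≋-trans (V-⊗ 2 _ _)
      (⊗-cong ≋-refl (≋-trans (V-² 2 _) (²-cong (V-² 2 y))))))))))

  quintic-expand : ∀ x y q → (x ⊕ q ⊗ y) ³ ⊗ (x ² ⊕ (q ⊗ y) ²) ≋ quintic-even x y (q ²) ⊕ q ⊗ quintic-odd x y (q ²)
  quintic-expand = solve 3 (λ x y q → let s = λ z → z :* z; c = λ z → z :* z :* z in
    c (x :+ q :* y) :* (s x :+ s (q :* y)) :=
      (s (s x) :* x :+ con (+ 4) :* (s q :* (c x :* s y)) :+ con (+ 3) :* (s (s q) :* (x :* s (s y)))) :+
      q :* (con (+ 3) :* (s (s x) :* y) :+ con (+ 4) :* (s q :* (s x :* c y)) :+ s (s q) :* (s (s y) :* y))) ≋-refl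

φ₋⁴⊗E₈₊₄ : V 2 φ₋ ² ² ⊗ E₈₊₄ ≋ quintic-odd a₁ y₁ q
φ₋⁴⊗E₈₊₄ = begin
  V 2 φ₋ ² ² ⊗ E₈₊₄
    ≈⟨ U-V-⊗ 2 1 (s≤s (s≤s z≤n)) _ _ ⟨
  U 2 1 (V 2 (V 2 φ₋ ² ²) ⊗ E₄)
    ≈⟨ U-cong 2 1 (≋-trans (⊗-cong (≋-trans (V-² 2 _) (²-cong (V-² 2 _))) ≋-refl)
         (≋-trans V₂φ₋⁴⊗E₄ (quintic-expand a₂ y₂ q))) ⟩
  U 2 1 (quintic-even a₂ y₂ (q ²) ⊕ q ⊗ quintic-odd a₂ y₂ (q ²))
    ≈⟨ U-cong 2 1 (⊕-cong (≋-trans (V-quintic-even a₁ y₁ q) (even-cong V₂y₁ V₂q)) (⊗-cong ≋-refl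
         (≋-trans (V-quintic-odd a₁ y₁ q) (odd-cong V₂y₁ V₂q)))) ⟨
  U 2 1 (V 2 (quintic-even a₁ y₁ q) ⊕ q ⊗ V 2 (quintic-odd a₁ y₁ q))
    ≈⟨ U₂₁ _ _ ⟩
  quintic-odd a₁ y₁ q ∎
  where
  open ≋-Reasoning
  odd-cong : ∀ {x y y′ q q′} → y ≋ y′ → q ≋ q′ → quintic-odd x y q ≋ quintic-odd x y′ q′
  odd-cong e d = ⊕-cong (⊕-cong (⊗-cong ≋-refl (⊗-cong ≋-refl e)) (⊗-cong ≋-refl (⊗-cong d (⊗-cong ≋-refl (³-cong e)))))
    (⊗-cong (²-cong d) (⊗-cong (²-cong (²-cong e)) e))
  even-cong : ∀ {x y y′ q q′} → y ≋ y′ → q ≋ q′ → quintic-even x y q ≋ quintic-even x y′ q′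
  even-cong e d = ⊕-cong (⊕-cong ≋-refl (⊗-cong ≋-refl (⊗-cong d (⊗-cong ≋-refl (²-cong e)))))
    (⊗-cong ≋-refl (⊗-cong (²-cong d) (⊗-cong ≋-refl (²-cong (²-cong e)))))

φ₋⁴⊗E₁₆₊₄ : φ₋ ² ² ⊗ E₁₆₊₄ ≋ κ (+ 3) ⊗ (φ₊ ² ² ⊗ y₀) ⊕ q ⊗ (y₀ ² ² ⊗ y₀)
φ₋⁴⊗E₁₆₊₄ = begin
  φ₋ ² ² ⊗ E₁₆₊₄
    ≈⟨ U-V-⊗ 2 0 (s≤s z≤n) _ _ ⟨
  U 2 0 (V 2 (φ₋ ² ²) ⊗ E₈₊₄)
    ≈⟨ U-cong 2 0 (≋-trans (⊗-cong (≋-trans (V-² 2 _) (²-cong (V-² 2 _))) ≋-refl)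
         (≋-trans φ₋⁴⊗E₈₊₄ (solve 3 (λ x y q → let s = λ z → z :* z; c = λ z → z :* z :* z in
           con (+ 3) :* (s (s x) :* y) :+ con (+ 4) :* (q :* (s x :* c y)) :+ s q :* (s (s y) :* y)
             := con (+ 3) :* (s (s x) :* y) :+ s q :* (s (s y) :* y) :+ q :* (con (+ 4) :* (s x :* c y))) ≋-refl a₁ y₁ q))) ⟩
  U 2 0 (κ (+ 3) ⊗ (a₁ ² ² ⊗ y₁) ⊕ q ² ⊗ (y₁ ² ² ⊗ y₁) ⊕ q ⊗ (κ (+ 4) ⊗ (a₁ ² ⊗ y₁ ³)))
    ≈⟨ U-cong 2 0 (⊕-cong
         (≋-trans (V-⊕ 2 _ _) (⊕-cong
           (≋-trans (V-κ⊗ 2 _ _) (⊗-cong ≋-refl (≋-trans (V-⊗ 2 _ _) (⊗-cong (≋-trans (V-² 2 _) (²-cong (V-² 2 φ₊))) V₂y₀))))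
           (≋-trans (V-⊗ 2 _ _) (⊗-cong V₂q (≋-trans (V-⊗ 2 _ _) (⊗-cong (≋-trans (V-² 2 _) (²-cong (≋-trans (V-² 2 y₀) (²-cong V₂y₀)))) V₂y₀))))))
         (⊗-cong ≋-refl (≋-trans (V-κ⊗ 2 _ _) (⊗-cong ≋-refl (≋-trans (V-⊗ 2 _ _) (⊗-cong (V-² 2 φ₊) (≋-trans (V-³ 2 y₀) (³-cong V₂y₀)))))))) ⟨
  U 2 0 (V 2 (κ (+ 3) ⊗ (φ₊ ² ² ⊗ y₀) ⊕ q ⊗ (y₀ ² ² ⊗ y₀)) ⊕ q ⊗ V 2 (κ (+ 4) ⊗ (φ₊ ² ⊗ y₀ ³)))
    ≈⟨ U₂₀ _ _ ⟩
  κ (+ 3) ⊗ (φ₊ ² ² ⊗ y₀) ⊕ q ⊗ (y₀ ² ² ⊗ y₀) ∎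
  where open ≋-Reasoning

-- By `φ⁴-difference` the quintic term 32 q ψ(q²)⁵ is 2 ψ(q²) (φ(q)⁴ - φ(-q)⁴). The shift by 2 ψ(q²)
-- absorbs the part with φ(-q)⁴ and leaves a single product, 6 + 2 = 8.
shifted-E₁₆₊₄ : φ₋ ² ² ⊗ (E₁₆₊₄ ⊕ κ (+ 2) ⊗ V 2 ψ) ≋ κ (+ 8) ⊗ (V 2 ψ ⊗ φ₊ ² ²)
shifted-E₁₆₊₄ = begin
  φ₋ ² ² ⊗ (E₁₆₊₄ ⊕ κ (+ 2) ⊗ s)
    ≈⟨ solve 3 (λ v e s → v :* (e :+ con (+ 2) :* s) := v :* e :+ con (+ 2) :* (v :* s)) ≋-refl (φ₋ ² ²) E₁₆₊₄ s ⟩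
  φ₋ ² ² ⊗ E₁₆₊₄ ⊕ κ (+ 2) ⊗ (φ₋ ² ² ⊗ s)
    ≈⟨ ⊕-cong φ₋⁴⊗E₁₆₊₄ ≋-refl ⟩
  κ (+ 3) ⊗ (φ₊ ² ² ⊗ (κ (+ 2) ⊗ s)) ⊕ q ⊗ ((κ (+ 2) ⊗ s) ² ² ⊗ (κ (+ 2) ⊗ s)) ⊕ κ (+ 2) ⊗ (φ₋ ² ² ⊗ s)
    ≈⟨ solve 4 (λ u v q s → let y = con (+ 2) :* s in
         con (+ 3) :* (u :* y) :+ q :* (y :* y :* (y :* y) :* y) :+ con (+ 2) :* (v :* s)
           := con (+ 6) :* (u :* s) :+ con (+ 2) :* (s :* (v :+ con (+ 16) :* (q :* (s :* s :* (s :* s))))))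
         ≋-refl (φ₊ ² ²) (φ₋ ² ²) q s ⟩
  κ (+ 6) ⊗ (φ₊ ² ² ⊗ s) ⊕ κ (+ 2) ⊗ (s ⊗ (φ₋ ² ² ⊕ κ (+ 16) ⊗ (q ⊗ s ² ²)))
    ≈⟨ ⊕-cong ≋-refl (⊗-cong ≋-refl (⊗-cong ≋-refl φ⁴-difference)) ⟨
  κ (+ 6) ⊗ (φ₊ ² ² ⊗ s) ⊕ κ (+ 2) ⊗ (s ⊗ φ₊ ² ²)
    ≈⟨ solve 2 (λ u s → con (+ 6) :* (u :* s) :+ con (+ 2) :* (s :* u) := con (+ 8) :* (s :* u)) ≋-refl (φ₊ ² ²) s ⟩
  κ (+ 8) ⊗ (s ⊗ φ₊ ² ²) ∎
  where
  open ≋-Reasoning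
  s = V 2 ψ

-- Put u = φ(q)⁴, v = φ(-q)⁴, t = q ψ(q²)⁴, so that u = v + 16t. The even part is u² + 96ut + 256t²
-- = v² + 128ut, and ut = q ψ⁸ by `ψ²`.
φ₊⁸-even : U 2 0 (φ₊ ² ² ²) ≋ φ₋ ² ² ² ⊕ κ (+ 128) ⊗ (q ⊗ ψ ² ² ²)
φ₊⁸-even = begin
  U 2 0 (φ₊ ² ² ²)
    ≈⟨ U-cong 2 0 (²-cong (²-cong (≋-trans φ₊² (⊕-cong ≋-refl
         (solve 2 (λ q w → con (+ 4) :* (q :* w) := q :* (con (+ 4) :* w)) ≋-refl q (w₁ ²)))))) ⟩
  U 2 0 ((a₁ ² ⊕ q ⊗ (κ (+ 4) ⊗ w₁ ²)) ² ²)
    ≈⟨ U-cong 2 0 (solve 3 (λ a q b → let s = λ z → z :* z in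
         s (s (a :+ q :* b)) := s (s a) :+ con (+ 6) :* (s q :* (s a :* s b)) :+ s (s q) :* s (s b)
           :+ q :* (con (+ 4) :* (s a :* a :* b) :+ con (+ 4) :* (s q :* (a :* (s b :* b))))) ≋-refl (a₁ ²) q (κ (+ 4) ⊗ w₁ ²)) ⟩
  U 2 0 (quartic (a₁ ²) (κ (+ 4) ⊗ w₁ ²) (q ²) ⊕ q ⊗ quartic-odd (a₁ ²) (κ (+ 4) ⊗ w₁ ²) (q ²))
    ≈⟨ U-cong 2 0 (⊕-cong
         (≋-trans (V-⊕ 2 _ _) (⊕-cong (≋-trans (V-⊕ 2 _ _) (⊕-cong
           (≋-trans (V-² 2 _) (²-cong (V-α²)))
           (≋-trans (V-κ⊗ 2 _ _) (⊗-cong ≋-refl (≋-trans (V-⊗ 2 _ _) (⊗-cong V₂q (≋-trans (V-⊗ 2 _ _) (⊗-cong V-α² V-β²))))))))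
           (≋-trans (V-⊗ 2 _ _) (⊗-cong (≋-trans (V-² 2 q) (²-cong V₂q)) (≋-trans (V-² 2 _) (²-cong V-β²))))))
         (⊗-cong ≋-refl (≋-trans (V-⊕ 2 _ _) (⊕-cong
           (≋-trans (V-κ⊗ 2 _ _) (⊗-cong ≋-refl (≋-trans (V-⊗ 2 _ _) (⊗-cong (≋-trans (V-⊗ 2 _ _) (⊗-cong V-α² V-α)) V-β))))
           (≋-trans (V-κ⊗ 2 _ _) (⊗-cong ≋-refl (≋-trans (V-⊗ 2 _ _) (⊗-cong V₂q (≋-trans (V-⊗ 2 _ _) (⊗-cong V-α (≋-trans (V-⊗ 2 _ _) (⊗-cong V-β² V-β))))))))))
         )) ⟨
  U 2 0 (V 2 (quartic α β q) ⊕ q ⊗ V 2 (quartic-odd α β q))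
    ≈⟨ U₂₀ _ _ ⟩
  α ² ² ⊕ κ (+ 6) ⊗ (q ⊗ (α ² ⊗ β ²)) ⊕ q ² ⊗ β ² ²
    ≈⟨ solve 3 (λ a q s → let sq = λ z → z :* z; b = con (+ 4) :* sq s; t = q :* sq (sq s) in
         sq (sq a) :+ con (+ 6) :* (q :* (sq a :* sq b)) :+ sq q :* sq (sq b)
           := sq (sq a) :+ con (+ 96) :* (sq a :* t) :+ sq (con (+ 16) :* t)) ≋-refl α q s ⟩
  α ² ² ⊕ κ (+ 96) ⊗ (α ² ⊗ t) ⊕ (κ (+ 16) ⊗ t) ²
    ≈⟨ ⊕-cong (⊕-cong (²-cong φ⁴-difference) (⊗-cong ≋-refl (⊗-cong φ⁴-difference ≋-refl))) ≋-refl ⟩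
  (v ⊕ κ (+ 16) ⊗ t) ² ⊕ κ (+ 96) ⊗ ((v ⊕ κ (+ 16) ⊗ t) ⊗ t) ⊕ (κ (+ 16) ⊗ t) ²
    ≈⟨ solve 2 (λ v t → let s = λ z → z :* z; u = v :+ con (+ 16) :* t in
         s u :+ con (+ 96) :* (u :* t) :+ s (con (+ 16) :* t) := s v :+ con (+ 128) :* (u :* t)) ≋-refl v t ⟩
  v ² ⊕ κ (+ 128) ⊗ ((v ⊕ κ (+ 16) ⊗ t) ⊗ t)
    ≈⟨ ⊕-cong ≋-refl (⊗-cong ≋-refl (⊗-cong φ⁴-difference ≋-refl)) ⟨
  v ² ⊕ κ (+ 128) ⊗ (φ₊ ² ² ⊗ t)
    ≈⟨ ⊕-cong ≋-refl (⊗-cong ≋-refl (solve 3 (λ p q s → let sq = λ z → z :* z in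
         sq (sq p) :* (q :* sq (sq s)) := q :* sq (sq (p :* s))) ≋-refl φ₊ q s)) ⟩
  v ² ⊕ κ (+ 128) ⊗ (q ⊗ (φ₊ ⊗ s) ² ²)
    ≈⟨ ⊕-cong ≋-refl (⊗-cong ≋-refl (⊗-cong ≋-refl (²-cong (²-cong ψ²)))) ⟨
  φ₋ ² ² ² ⊕ κ (+ 128) ⊗ (q ⊗ ψ ² ² ²) ∎
  where
  open ≋-Reasoning
  s = V 2 ψ
  t = q ⊗ s ² ²
  v = φ₋ ² ²
  α = φ₊ ²
  β = κ (+ 4) ⊗ s ²
  quartic : Series → Series → Series → Series
  quartic a b q = a ² ² ⊕ κ (+ 6) ⊗ (q ⊗ (a ² ⊗ b ²)) ⊕ q ² ⊗ b ² ²
  quartic-odd : Series → Series → Series → Series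
  quartic-odd a b q = κ (+ 4) ⊗ (a ² ⊗ a ⊗ b) ⊕ κ (+ 4) ⊗ (q ⊗ (a ⊗ (b ² ⊗ b)))
  V-α : V 2 α ≋ a₁ ²
  V-α = V-² 2 φ₊
  V-α² : V 2 (α ²) ≋ a₁ ² ²
  V-α² = ≋-trans (V-² 2 α) (²-cong V-α)
  V-β : V 2 β ≋ κ (+ 4) ⊗ w₁ ²
  V-β = ≋-trans (V-κ⊗ 2 _ _) (⊗-cong ≋-refl (V-² 2 s))
  V-β² : V 2 (β ²) ≋ (κ (+ 4) ⊗ w₁ ²) ²
  V-β² = ≋-trans (V-² 2 β) (²-cong V-β)

-- Multiplying `shifted-E₁₆₊₄` by φ(q)⁴ turns its factor φ(-q)⁴ into φ(-q²)⁸, which the extraction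
-- lets through.
D-shifted : (D ⊕ κ (+ 2) ⊗ ψ) ⊗ φ₋ ² ² ² ≋ κ (+ 8) ⊗ (ψ ⊗ (φ₋ ² ² ² ⊕ κ (+ 128) ⊗ (q ⊗ ψ ² ² ²)))
D-shifted = begin
  (D ⊕ κ (+ 2) ⊗ ψ) ⊗ φ₋ ² ² ²
    ≈⟨ ≋-trans (⊗-comm _ _) (⊗-cong ≋-refl (≋-sym (≋-trans (U-⊕ 2 0 _ _) (⊕-cong ≋-refl (≋-trans (U-κ 2 0 _ _) (⊗-cong ≋-refl (U-V 2 ψ))))))) ⟩
  φ₋ ² ² ² ⊗ U 2 0 F
    ≈⟨ U-V-⊗ 2 0 (s≤s z≤n) _ _ ⟨
  U 2 0 (V 2 (φ₋ ² ² ²) ⊗ F)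
    ≈⟨ U-cong 2 0 (begin
         V 2 (φ₋ ² ² ²) ⊗ F
           ≈⟨ ⊗-cong (≋-trans (V-² 2 _) (²-cong (≋-trans (V-² 2 _) (²-cong (≋-trans (V-² 2 φ₋) (≋-sym φ₊φ₋)))))) ≋-refl ⟩
         (φ₊ ⊗ φ₋) ² ² ⊗ F
           ≈⟨ solve 3 (λ p m f → let s = λ z → z :* z in s (s (p :* m)) :* f := s (s m) :* f :* s (s p)) ≋-refl φ₊ φ₋ F ⟩
         φ₋ ² ² ⊗ F ⊗ φ₊ ² ²
           ≈⟨ ⊗-cong shifted-E₁₆₊₄ ≋-refl ⟩
         κ (+ 8) ⊗ (V 2 ψ ⊗ φ₊ ² ²) ⊗ φ₊ ² ²
           ≈⟨ solve 3 (λ k s u → k :* (s :* u) :* u := k :* (s :* (u :* u))) ≋-refl (κ (+ 8)) (V 2 ψ) (φ₊ ² ²) ⟩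
         κ (+ 8) ⊗ (V 2 ψ ⊗ φ₊ ² ² ²) ∎) ⟩
  U 2 0 (κ (+ 8) ⊗ (V 2 ψ ⊗ φ₊ ² ² ²))
    ≈⟨ ≋-trans (U-κ 2 0 _ _) (⊗-cong ≋-refl (≋-trans (U-V-⊗ 2 0 (s≤s z≤n) ψ _) (⊗-cong ≋-refl φ₊⁸-even))) ⟩
  κ (+ 8) ⊗ (ψ ⊗ (φ₋ ² ² ² ⊕ κ (+ 128) ⊗ (q ⊗ ψ ² ² ²))) ∎
  where
  open ≋-Reasoning
  F = E₁₆₊₄ ⊕ κ (+ 2) ⊗ V 2 ψ

-- 6 = 8 - 2 undoes the shift, and 1024 = 8 · 128. Replacing ψ by c³ φ₋ in ψ⁹ allows φ₋⁸ to be
-- cancelled.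
D-formula : D ≋ κ (+ 6) ⊗ ψ ⊕ κ (+ 1024) ⊗ (q ⊗ (φ₋ ⊗ c∞ ³ ³ ³))
D-formula = ⊗-cancelʳ {φ₋ ² ² ²} (⊗-coeff₀ e₄ e₄) (begin
  D ⊗ w
    ≈⟨ solve 3 (λ d s w → d :* w := (d :+ con (+ 2) :* s) :* w :+ con (ℤ.- + 2) :* (s :* w)) ≋-refl D ψ w ⟩
  (D ⊕ κ (+ 2) ⊗ ψ) ⊗ w ⊕ κ (ℤ.- + 2) ⊗ (ψ ⊗ w)
    ≈⟨ ⊕-cong D-shifted ≋-refl ⟩
  κ (+ 8) ⊗ (ψ ⊗ (w ⊕ κ (+ 128) ⊗ (q ⊗ ψ ² ² ²))) ⊕ κ (ℤ.- + 2) ⊗ (ψ ⊗ w)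
    ≈⟨ solve 4 (λ s w q t → con (+ 8) :* (s :* (w :+ con (+ 128) :* (q :* t))) :+ con (ℤ.- + 2) :* (s :* w)
         := con (+ 6) :* s :* w :+ con (+ 1024) :* (q :* (s :* t))) ≋-refl ψ w q (ψ ² ² ²) ⟩
  κ (+ 6) ⊗ ψ ⊗ w ⊕ κ (+ 1024) ⊗ (q ⊗ (ψ ⊗ ψ ² ² ²))
    ≈⟨ ⊕-cong ≋-refl (⊗-cong ≋-refl (⊗-cong ≋-refl (⊗-cong (≋-sym c³φ₋) (²-cong (²-cong (²-cong (≋-sym c³φ₋))))))) ⟩
  κ (+ 6) ⊗ ψ ⊗ w ⊕ κ (+ 1024) ⊗ (q ⊗ (c³ ⊗ φ₋ ⊗ (c³ ⊗ φ₋) ² ² ²))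
    ≈⟨ ⊕-cong ≋-refl (solve 4 (λ k q c p → let s = λ z → z :* z; u = λ z → z :* z :* z in
         k :* (q :* (c :* p :* s (s (s (c :* p))))) := k :* (q :* (p :* u (u c))) :* s (s (s p))) ≋-refl (κ (+ 1024)) q c³ φ₋) ⟩
  κ (+ 6) ⊗ ψ ⊗ w ⊕ κ (+ 1024) ⊗ (q ⊗ (φ₋ ⊗ c³ ³ ³)) ⊗ w
    ≈⟨ ⊗-distribʳ w _ _ ⟨
  (κ (+ 6) ⊗ ψ ⊕ κ (+ 1024) ⊗ (q ⊗ (φ₋ ⊗ c³ ³ ³))) ⊗ w ∎)
  where
  open ≋-Reasoning
  c³ = c∞ ³
  w = φ₋ ² ² ²
  e₂ : (φ₋ ²) 0 ≡ 1ℤ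
  e₂ = ⊗-coeff₀ φ₋₀ φ₋₀
  e₄ : (φ₋ ² ²) 0 ≡ 1ℤ
  e₄ = ⊗-coeff₀ e₂ e₂

≈-κ-scale : ∀ a b → f ≈ g [ κ b ] → κ a ⊗ f ≈ κ a ⊗ g [ κ (a ℤ.* b) ]
≈-κ-scale a b e = ≈-weaken {h = 𝟏} (≋-trans (≋-sym (κ-* a b)) (≋-sym (⊗-identityʳ _))) (≈-scale (κ a) e)

multiple-≈𝟎 : ∀ a → κ a ⊗ f ≈ 𝟎 [ κ a ]
multiple-≈𝟎 {f} a = by f (≋-sym (⊕-identityˡ _))

-- Cubing `frobenius` twice raises the modulus from 3 to 9 and 27.
frobenius-27 : ∀ f → f ³ ³ ³ ≈ V 3 (f ³ ³) [ κ (+ 27) ]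
frobenius-27 f = ≈-trans (³-≈ (+ 3) (³-≈ (+ 1) (frobenius f)))
  (≋⇒≈ (≋-sym (≋-trans (V-³ 3 (f ³)) (³-cong (V-³ 3 f)))))

-- 3-dissections

private
  w P S : Series
  w = V 3 c∞
  P = V 3 (V 3 φ₋)
  S = q ⊗ V 3 (V 3 ψ)

ψ-dissection : ψ ≋ w ⊗ P ⊕ S
ψ-dissection = ≋-trans ψ-dissect₃ (⊕-cong (≋-trans (V-cong 3 A-via-c) (V-⊗ 3 _ _)) ≋-refl)

-- The factor w = c(q³) cancels the b(q³) inside Ω, so that ψ and w φ₋ are combinations of the same
-- two series w P and S.
φ₋-dissection : w ⊗ φ₋ ≋ w ⊗ P ⊕ κ (ℤ.- + 2) ⊗ S
φ₋-dissection = begin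
  w ⊗ φ₋
    ≈⟨ ⊗-cong ≋-refl (≋-trans φ₋-dissect₃ (⊕-cong ≋-refl (⊗-cong ≋-refl (⊗-cong ≋-refl
         (≋-trans (V-cong 3 Ω-via-b) (V-⊗ 3 _ _)))))) ⟩
  w ⊗ (P ⊕ κ (ℤ.- + 2) ⊗ (q ⊗ (V 3 b∞ ⊗ V 3 (V 3 ψ))))
    ≈⟨ solve 6 (λ w p k q b s → w :* (p :+ k :* (q :* (b :* s))) := w :* p :+ k :* (q :* (w :* b :* s)))
         ≋-refl w P (κ (ℤ.- + 2)) q (V 3 b∞) (V 3 (V 3 ψ)) ⟩
  w ⊗ P ⊕ κ (ℤ.- + 2) ⊗ (q ⊗ (w ⊗ V 3 b∞ ⊗ V 3 (V 3 ψ)))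
    ≈⟨ ⊕-cong ≋-refl (⊗-cong ≋-refl (⊗-cong ≋-refl (≋-trans (⊗-cong V₃c⊗V₃b ≋-refl) (⊗-identityˡ _)))) ⟩
  w ⊗ P ⊕ κ (ℤ.- + 2) ⊗ S ∎
  where open ≋-Reasoning

U₃₀φ₋ : U 3 0 φ₋ ≋ V 3 φ₋
U₃₀φ₋ = begin
  U 3 0 φ₋
    ≈⟨ U-cong 3 0 (≋-trans φ₋-dissect₃ (⊕-cong ≋-refl (≋-trans
         (solve 3 (λ k q o → k :* (q :* o) := q :* (k :* o)) ≋-refl (κ (ℤ.- + 2)) q (V 3 Ω∞))
         (⊗-cong ≋-refl (≋-sym (V-κ⊗ 3 _ Ω∞)))))) ⟩
  U 3 0 (V 3 (V 3 φ₋) ⊕ q ⊗ V 3 (κ (ℤ.- + 2) ⊗ Ω∞))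
    ≈⟨ ≋-trans (U-⊕ 3 0 _ _) (⊕-cong (U-V 3 _) (U-X^V-off 3 0 1 (s≤s z≤n) (s≤s (s≤s z≤n)) (λ ()) _)) ⟩
  V 3 φ₋ ⊕ 𝟎
    ≈⟨ ⊕-identityʳ _ ⟩
  V 3 φ₋ ∎
  where open ≋-Reasoning

U₃₁ψ : U 3 1 ψ ≋ V 3 ψ
U₃₁ψ = ≋-trans (U-cong 3 1 ψ-dissect₃) (≋-trans (U-⊕ 3 1 _ _) (≋-trans
  (⊕-cong (U-V-suc 3 A∞ 0 (s≤s (s≤s z≤n))) (U-X^V-diag 3 1 (s≤s (s≤s z≤n)) _)) (⊕-identityˡ _)))

-- c³ = w + 3 S/φ₋ refines Frobenius' congruence c³ ≡ V 3 c; its cube is the next congruence.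
c⁹-expansion : c∞ ³ ³ ⊗ V 3 φ₋ ≈ V 3 ψ ⊕ κ (+ 9) ⊗ (S ⊗ (w ⊗ P ⊕ κ (ℤ.- + 2) ⊗ S) ²) [ κ (+ 27) ]
c⁹-expansion = ≈-trans (≋⇒≈ (≋-trans (⊗-cong (³-cong c³) ≋-refl) expand))
  -- Beside the coefficient 9 only the residue of `V 3 φ₋` modulo 3 matters, and that is φ₋³: one
  -- factor clears the denominator of Y, the other two turn w² into (w φ₋)².
  (≈-trans (≈-⊕ (≈-⊕ ≈-refl (≈-κ-scale (+ 9) (+ 3) (≈-⊗ ≈-refl (≈-⊗ ≈-refl (≈-sym (frobenius φ₋))))))
                (multiple-≈𝟎 (+ 27)))
  (≋⇒≈ collect))
  where
  open ≋-Reasoning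
  Y = S ⊘ φ₋
  Yφ₋ : Y ⊗ φ₋ ≋ S
  Yφ₋ = ⊘-⊗ S φ₋₀
  c³ : c∞ ³ ≋ w ⊕ κ (+ 3) ⊗ Y
  c³ = ⊗-cancelʳ φ₋₀ (begin
    c∞ ³ ⊗ φ₋                           ≈⟨ ≋-trans c³φ₋ ψ-dissection ⟩
    w ⊗ P ⊕ S                           ≈⟨ solve 2 (λ a s → a :+ s := a :+ con (ℤ.- + 2) :* s :+ con (+ 3) :* s) ≋-refl (w ⊗ P) S ⟩
    w ⊗ P ⊕ κ (ℤ.- + 2) ⊗ S ⊕ κ (+ 3) ⊗ S ≈⟨ ⊕-cong φ₋-dissection (⊗-cong ≋-refl Yφ₋) ⟨
    w ⊗ φ₋ ⊕ κ (+ 3) ⊗ (Y ⊗ φ₋)         ≈⟨ solve 3 (λ w p y → w :* p :+ con (+ 3) :* (y :* p) := (w :+ con (+ 3) :* y) :* p) ≋-refl w φ₋ Y ⟩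
    (w ⊕ κ (+ 3) ⊗ Y) ⊗ φ₋              ∎)
  expand : (w ⊕ κ (+ 3) ⊗ Y) ³ ⊗ V 3 φ₋
         ≋ w ³ ⊗ V 3 φ₋ ⊕ κ (+ 9) ⊗ (w ² ⊗ Y ⊗ (𝟏 ⊗ V 3 φ₋)) ⊕ κ (+ 27) ⊗ ((w ⊗ Y ² ⊕ Y ³) ⊗ V 3 φ₋)
  expand = ≋-trans (solve 3 (λ w y p → let c = λ z → z :* z :* z in
      c (w :+ con (+ 3) :* y) :* p := c w :* p :+ con (+ 9) :* (w :* w :* y :* p) :+ con (+ 27) :* ((w :* (y :* y) :+ c y) :* p)) ≋-refl w Y (V 3 φ₋))
    (⊕-cong (⊕-cong ≋-refl (⊗-cong ≋-refl (⊗-cong ≋-refl (≋-sym (⊗-identityˡ _))))) ≋-refl)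
  collect : w ³ ⊗ V 3 φ₋ ⊕ κ (+ 9) ⊗ (w ² ⊗ Y ⊗ (𝟏 ⊗ φ₋ ³)) ⊕ 𝟎
          ≋ V 3 ψ ⊕ κ (+ 9) ⊗ (S ⊗ (w ⊗ P ⊕ κ (ℤ.- + 2) ⊗ S) ²)
  collect = ≋-trans (⊕-identityʳ _) (⊕-cong
    (≋-trans (⊗-cong (≋-sym (V-³ 3 c∞)) ≋-refl) (≋-trans (≋-sym (V-⊗ 3 _ _)) (V-cong 3 c³φ₋)))
    (⊗-cong ≋-refl (begin
      w ² ⊗ Y ⊗ (𝟏 ⊗ φ₋ ³)        ≈⟨ ⊗-cong ≋-refl (⊗-identityˡ _) ⟩
      w ² ⊗ Y ⊗ φ₋ ³              ≈⟨ solve 3 (λ w y p → w :* w :* y :* (p :* p :* p) := y :* p :* (w :* p :* (w :* p))) ≋-refl w Y φ₋ ⟩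
      Y ⊗ φ₋ ⊗ (w ⊗ φ₋) ²         ≈⟨ ⊗-cong Yφ₋ (²-cong φ₋-dissection) ⟩
      S ⊗ (w ⊗ P ⊕ κ (ℤ.- + 2) ⊗ S) ² ∎)))

-- S is q times a series in q³, and w P is a series in q³. Of 9 S (w P - 2S)² only 9 · 4 S³ = 36 q³
-- ψ(q⁹)³ therefore lies in the class 0 modulo 3.
U₃₀c⁹ : U 3 0 (c∞ ³ ³ ⊗ V 3 φ₋) ≈ ψ ⊕ κ (+ 36) ⊗ (q ⊗ V 3 ψ ³) [ κ (+ 27) ]
U₃₀c⁹ = ≈-trans (U-≈ 3 0 c⁹-expansion) (≋⇒≈ (≋-trans (U-cong 3 0 parts) (U₃₀ _ _ _)))
  where
  open ≋-Reasoning
  s = V 3 ψ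
  p = V 3 φ₋
  X²≋ : q ² ≋ X^ 2
  X²≋ = X^-+ 1 1
  V₃q : q ³ ≋ V 3 q
  V₃q = ≋-trans (⊗-cong (X^-+ 1 1) ≋-refl) (≋-trans (X^-+ 2 1) (≋-sym (V-X^ 3 1)))
  parts : V 3 ψ ⊕ κ (+ 9) ⊗ (S ⊗ (w ⊗ P ⊕ κ (ℤ.- + 2) ⊗ S) ²)
    ≋ V 3 (ψ ⊕ κ (+ 36) ⊗ (q ⊗ s ³)) ⊕ q ⊗ V 3 (κ (+ 9) ⊗ (s ⊗ (c∞ ⊗ p) ²)) ⊕ X^ 2 ⊗ V 3 (κ (ℤ.- + 36) ⊗ (s ² ⊗ (c∞ ⊗ p)))
  parts = begin
    V 3 ψ ⊕ κ (+ 9) ⊗ (q ⊗ V 3 s ⊗ (w ⊗ P ⊕ κ (ℤ.- + 2) ⊗ (q ⊗ V 3 s)) ²)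
      ≈⟨ solve 4 (λ ψ q s m → let t = q :* s; d = m :+ con (ℤ.- + 2) :* t in
           ψ :+ con (+ 9) :* (t :* (d :* d)) :=
           ψ :+ con (+ 36) :* (q :* q :* q :* (s :* s :* s)) :+ q :* (con (+ 9) :* (s :* (m :* m)))
             :+ q :* q :* (con (ℤ.- + 36) :* (s :* s :* m))) ≋-refl (V 3 ψ) q (V 3 s) (w ⊗ P) ⟩
    V 3 ψ ⊕ κ (+ 36) ⊗ (q ³ ⊗ V 3 s ³) ⊕ q ⊗ (κ (+ 9) ⊗ (V 3 s ⊗ (w ⊗ P) ²)) ⊕ q ² ⊗ (κ (ℤ.- + 36) ⊗ (V 3 s ² ⊗ (w ⊗ P)))
      ≈⟨ ⊕-cong (⊕-cong
           (⊕-cong ≋-refl (⊗-cong ≋-refl (⊗-cong V₃q ≋-refl))) ≋-refl) (⊗-cong X²≋ ≋-refl) ⟩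
    V 3 ψ ⊕ κ (+ 36) ⊗ (V 3 q ⊗ V 3 s ³) ⊕ q ⊗ (κ (+ 9) ⊗ (V 3 s ⊗ (w ⊗ P) ²)) ⊕ X^ 2 ⊗ (κ (ℤ.- + 36) ⊗ (V 3 s ² ⊗ (w ⊗ P)))
      ≈⟨ ⊕-cong (⊕-cong
           (≋-trans (V-⊕ 3 _ _) (⊕-cong ≋-refl (≋-trans (V-κ⊗ 3 _ _) (⊗-cong ≋-refl (≋-trans (V-⊗ 3 _ _) (⊗-cong ≋-refl (V-³ 3 s)))))))
           (⊗-cong ≋-refl (≋-trans (V-κ⊗ 3 _ _) (⊗-cong ≋-refl (≋-trans (V-⊗ 3 _ _) (⊗-cong ≋-refl (≋-trans (V-² 3 _) (²-cong (V-⊗ 3 _ _)))))))))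
           (⊗-cong ≋-refl (≋-trans (V-κ⊗ 3 _ _) (⊗-cong ≋-refl (≋-trans (V-⊗ 3 _ _) (⊗-cong (V-² 3 s) (V-⊗ 3 _ _)))))) ⟨
    V 3 (ψ ⊕ κ (+ 36) ⊗ (q ⊗ s ³)) ⊕ q ⊗ V 3 (κ (+ 9) ⊗ (s ⊗ (c∞ ⊗ p) ²)) ⊕ X^ 2 ⊗ V 3 (κ (ℤ.- + 36) ⊗ (s ² ⊗ (c∞ ⊗ p))) ∎

U-linear : ∀ k r a b f g → U k r (κ a ⊗ f ⊕ κ b ⊗ g) ≋ κ a ⊗ U k r f ⊕ κ b ⊗ U k r g
U-linear k r a b f g = ≋-trans (U-⊕ k r _ _) (⊕-cong (U-κ k r a f) (U-κ k r b g))

-- D₁, D₂, D₃, D₄ : the progressions 3n + 1, 9n + 1, 27n + 10 and 81n + 10 of D.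
D₁ D₂ D₃ D₄ : Series
D₁ = U 3 1 D
D₂ = U 3 0 D₁
D₃ = U 3 1 D₂
D₄ = U 3 0 D₃

-- The factor q in `D-formula` moves the class 1 to the class 0, where c(q³)⁹ passes through and
-- φ(-q) contributes φ(-q³).
D₁-≈ : D₁ ≈ κ (+ 6) ⊗ V 3 ψ ⊕ κ (+ 1024) ⊗ (c∞ ³ ³ ⊗ V 3 φ₋) [ κ (+ 27) ]
D₁-≈ = ≈-trans
  (U-≈ 3 1 (≈-trans (≋⇒≈ D-formula) (≈-⊕ ≈-refl (≈-⊗ ≈-refl (≈-⊗ ≈-refl (≈-⊗ ≈-refl (frobenius-27 c∞)))))))
  (≋⇒≈ (≋-trans (U-linear 3 1 _ _ _ _) (⊕-cong (⊗-cong ≋-refl U₃₁ψ) (⊗-cong ≋-refl (begin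
    U 3 1 (q ⊗ (φ₋ ⊗ V 3 (c∞ ³ ³)))  ≈⟨ U₃₁-X _ ⟩
    U 3 0 (φ₋ ⊗ V 3 (c∞ ³ ³))        ≈⟨ U-cong 3 0 (⊗-comm _ _) ⟩
    U 3 0 (V 3 (c∞ ³ ³) ⊗ φ₋)        ≈⟨ U-V-⊗ 3 0 (s≤s z≤n) _ _ ⟩
    c∞ ³ ³ ⊗ U 3 0 φ₋                ≈⟨ ⊗-cong ≋-refl U₃₀φ₋ ⟩
    c∞ ³ ³ ⊗ V 3 φ₋                  ∎)))))
  where open ≋-Reasoning

D₂-≈ : D₂ ≈ κ (+ 1030) ⊗ ψ ⊕ κ (+ 36864) ⊗ (q ⊗ V 3 ψ ³) [ κ (+ 27) ]
D₂-≈ = ≈-trans (U-≈ 3 0 D₁-≈) (≈-trans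
  (≋⇒≈ (≋-trans (U-linear 3 0 _ _ _ _) (⊕-cong (⊗-cong ≋-refl (U-V 3 ψ)) ≋-refl)))
  (≈-trans (≈-⊕ ≈-refl (≈-⊗ ≈-refl U₃₀c⁹))
  (≋⇒≈ (solve 2 (λ s t → con (+ 6) :* s :+ con (+ 1024) :* (s :+ con (+ 36) :* t)
    := con (+ 1030) :* s :+ con (+ 36864) :* t) ≋-refl ψ (q ⊗ V 3 ψ ³)))))

-- As 36864 = 4096 · 9, the remaining ψ³ is needed only modulo 3, where it is ψ(q³). Both terms then
-- become multiples of ψ, and 1030 + 36864 = 37894.
D₄-≈ : D₄ ≈ κ (+ 37894) ⊗ ψ [ κ (+ 27) ]
D₄-≈ = ≈-trans (U-≈ 3 0 (≈-trans (U-≈ 3 1 D₂-≈) (≋⇒≈ (≋-trans (U-linear 3 1 _ _ _ _)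
    (⊕-cong (⊗-cong ≋-refl U₃₁ψ) (⊗-cong ≋-refl
      (≋-trans (U₃₁-X _) (≋-trans (U-cong 3 0 (≋-sym (V-³ 3 ψ))) (U-V 3 _)))))))))
  (≈-trans (≋⇒≈ (≋-trans (U-linear 3 0 _ _ _ _) (⊕-cong (⊗-cong ≋-refl (U-V 3 ψ))
     (≋-trans (⊗-cong (κ-* (+ 4096) (+ 9)) ≋-refl) (⊗-assoc _ _ _)))))
  (≈-trans (≈-⊕ ≈-refl (≈-⊗ ≈-refl (≈-κ-scale (+ 9) (+ 3) (≈-trans (U-≈ 3 0 (frobenius ψ)) (≋⇒≈ (U-V 3 ψ))))))
  (≋⇒≈ (solve 1 (λ s → con (+ 1030) :* s :+ con (+ 4096) :* (con (+ 9) :* s) := con (+ 37894) :* s) ≋-refl ψ))))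

-- The coefficients v₀(2592n + 324)

private
  U-chain : ∀ k r f n N → r + n * k ≡ N → U k r f n ≡ f N
  U-chain k r f n N e = trans (U-coeff k r f n) (cong f e)

D₄-coeff : ∀ n → D₄ n ≡ + 2 ℤ.* v₀ (2592 * n + 324)
D₄-coeff n = begin
  D₄ n                         ≡⟨ U-chain 3 0 D₃ n (3 * n) (i₁ n) ⟩
  D₃ (3 * n)                   ≡⟨ U-chain 3 1 D₂ _ (9 * n + 1) (i₂ n) ⟩
  D₂ (9 * n + 1)               ≡⟨ U-chain 3 0 D₁ _ (27 * n + 3) (i₃ n) ⟩
  D₁ (27 * n + 3)              ≡⟨ U-chain 3 1 D _ (81 * n + 10) (i₄ n) ⟩
  D (81 * n + 10)              ≡⟨ U-chain 2 0 E₁₆₊₄ _ (162 * n + 20) (i₅ n) ⟩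
  E₁₆₊₄ (162 * n + 20)         ≡⟨ U-chain 2 0 E₈₊₄ _ (324 * n + 40) (i₆ n) ⟩
  E₈₊₄ (324 * n + 40)          ≡⟨ U-chain 2 1 E₄ _ (648 * n + 81) (i₇ n) ⟩
  E₄ (648 * n + 81)            ≡⟨ U-chain 2 0 (E 0) _ (1296 * n + 162) (i₈ n) ⟩
  E 0 (1296 * n + 162)         ≡⟨ constant-term ⟩
  + 2 ℤ.* U 2 0 (G 0) (1296 * n + 162) ≡⟨ cong (+ 2 ℤ.*_) (trans (U-chain 2 0 (G 0) _ (2592 * n + 324) (i₉ n)) (sym (coeff v₀≋G _))) ⟩
  + 2 ℤ.* v₀ (2592 * n + 324)  ∎
  where
  open ≡-Reasoning
  i₁ : ∀ n → 0 + n * 3 ≡ 3 * n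
  i₁ = solveℕ-∀
  i₂ : ∀ n → 1 + 3 * n * 3 ≡ 9 * n + 1
  i₂ = solveℕ-∀
  i₃ : ∀ n → 0 + (9 * n + 1) * 3 ≡ 27 * n + 3
  i₃ = solveℕ-∀
  i₄ : ∀ n → 1 + (27 * n + 3) * 3 ≡ 81 * n + 10
  i₄ = solveℕ-∀
  i₅ : ∀ n → 0 + (81 * n + 10) * 2 ≡ 162 * n + 20
  i₅ = solveℕ-∀
  i₆ : ∀ n → 0 + (162 * n + 20) * 2 ≡ 324 * n + 40
  i₆ = solveℕ-∀
  i₇ : ∀ n → 1 + (324 * n + 40) * 2 ≡ 648 * n + 81
  i₇ = solveℕ-∀
  i₈ : ∀ n → 0 + (648 * n + 81) * 2 ≡ 1296 * n + 162
  i₈ = solveℕ-∀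
  i₉ : ∀ n → 0 + (1296 * n + 162) * 2 ≡ 2592 * n + 324
  i₉ = solveℕ-∀
  -- The index is at least 162, out of reach of the -1 in `E 0`.
  constant-term : E 0 (1296 * n + 162) ≡ + 2 ℤ.* U 2 0 (G 0) (1296 * n + 162)
  constant-term = trans (⊕-coeff _ _ _) (trans (cong₂ ℤ._+_ (κ-coeff (+ 2) _ _)
    (trans (⊟-coeff 𝟏 _) (cong ℤ.-_ (trans (cong 𝟏 (ℕ.+-suc (1296 * n) 161)) (X^0-coeff-suc _))))) (ℤ.+-identityʳ _))

ψ-coeff-zero : ∀ n → (∀ k → n ≢ tri k) → ψ n ≡ 0ℤ
ψ-coeff-zero n n≢tri = trans (lim-coeff ψ-partial n) (go (suc n))
  where
  go : ∀ k → ψ-partial k n ≡ 0ℤ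
  go zero    = 𝟎-coeff n
  go (suc k) = trans (⊕-coeff _ _ n) (cong₂ ℤ._+_ (go k) (X^-coeff-off (tri k) n λ e → n≢tri k (sym e)))

v₀-multiple : ∀ n → (∀ k → n ≢ tri k) → ∃ λ d → v₀ (2592 * n + 324) ≡ + 27 ℤ.* d
-- 2 · 14 - 27 = 1: the 14 inverts 2 modulo 27.
v₀-multiple n n≢tri = + 14 ℤ.* r n ℤ.- v , (begin
  v                                           ≡⟨ spread v ⟩
  + 14 ℤ.* (+ 2 ℤ.* v) ℤ.- + 27 ℤ.* v         ≡⟨ cong (λ z → + 14 ℤ.* z ℤ.- + 27 ℤ.* v) doubled ⟩
  + 14 ℤ.* (+ 27 ℤ.* r n) ℤ.- + 27 ℤ.* v      ≡⟨ collect (r n) v ⟩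
  + 27 ℤ.* (+ 14 ℤ.* r n ℤ.- v)               ∎)
  where
  open ≡-Reasoning
  open _≈_[_] D₄-≈ renaming (multiplier to r)
  v = v₀ (2592 * n + 324)
  doubled : + 2 ℤ.* v ≡ + 27 ℤ.* r n
  doubled = begin
    + 2 ℤ.* v                              ≡⟨ D₄-coeff n ⟨
    D₄ n                                   ≡⟨ trans (coeff equation n) (⊕-coeff _ _ n) ⟩
    (κ (+ 37894) ⊗ ψ) n ℤ.+ (κ (+ 27) ⊗ r) n ≡⟨ cong₂ ℤ._+_ (trans (κ-coeff _ ψ n) (cong (+ 37894 ℤ.*_) (ψ-coeff-zero n n≢tri))) (κ-coeff _ r n) ⟩
    0ℤ ℤ.+ + 27 ℤ.* r n                    ≡⟨ ℤ.+-identityˡ _ ⟩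
    + 27 ℤ.* r n                           ∎
  spread : ∀ v → v ≡ + 14 ℤ.* (+ 2 ℤ.* v) ℤ.- + 27 ℤ.* v
  spread = solve-∀
  collect : ∀ h v → + 14 ℤ.* (+ 27 ℤ.* h) ℤ.- + 27 ℤ.* v ≡ + 27 ℤ.* (+ 14 ℤ.* h ℤ.- v)
  collect = solve-∀

-- Squares, triangular numbers and the three families

parity : ∀ n → ∃ λ k → n ≡ k * 2 ⊎ n ≡ suc (k * 2)
parity zero    = 0 , inj₁ refl
parity (suc n) with parity n
... | k , inj₁ e = k , inj₂ (cong suc e)
... | k , inj₂ e = suc k , inj₁ (cong suc e)

odd-square : ∀ k → suc (k * 2) * suc (k * 2) ≡ 8 * tri k + 1
odd-square k = trans (expand k) (trans (cong (λ s → 4 * s + 1) (sym (tri-double k))) (regroup (tri k)))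
  where
  expand : ∀ k → suc (k * 2) * suc (k * 2) ≡ 4 * (k * suc k) + 1
  expand = solveℕ-∀
  regroup : ∀ τ → 4 * (τ * 2) + 1 ≡ 8 * τ + 1
  regroup = solveℕ-∀

-- 8n + 1 is odd, hence so is z, and an odd square has the form 8 `tri k` + 1.
square⇒triangular : ∀ n z → 8 * n + 1 ≡ z * z → ∃ λ k → n ≡ tri k
square⇒triangular n z e with parity z
... | k , inj₂ refl = k , ℕ.*-cancelˡ-≡ n (tri k) 8 (ℕ.+-cancelʳ-≡ 1 (8 * n) (8 * tri k) (trans e (odd-square k)))
... | k , inj₁ refl = contradiction (trans (sym (left n)) (trans e (right k))) (odd≢even (4 * n) (k * k * 2))
  where
  left : ∀ n → 8 * n + 1 ≡ suc (4 * n * 2)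
  left = solveℕ-∀
  right : ∀ k → k * 2 * (k * 2) ≡ k * k * 2 * 2
  right = solveℕ-∀
  odd≢even : ∀ m n → suc (m * 2) ≢ n * 2
  odd≢even m       zero    ()
  odd≢even zero    (suc n) ()
  odd≢even (suc m) (suc n) e = odd≢even m n (ℕ.suc-injective (ℕ.suc-injective e))

tri-triangular : ∀ k → Triangular (tri k)
tri-triangular k = k , sym (trans (cong (_/ 2) (trans (cong (k *_) (ℕ.+-comm k 1)) (sym (tri-double k)))) (m*n/n≡m (tri k) 2))

v₀-vanishes : ∀ {N} m → N ≡ 324 * (8 * m + 1) → (∀ z → 8 * m + 1 ≢ z * z) → v₀ N ≡ 0ℤ [mod 27 ]
v₀-vanishes {N} m N≡ nonsquare = ∣⇒∣ᵤ (divides d (begin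
  v₀ N ℤ.- 0ℤ             ≡⟨ ℤ.+-identityʳ _ ⟩
  v₀ N                    ≡⟨ cong v₀ (trans N≡ (expand m)) ⟩
  v₀ (2592 * m + 324)     ≡⟨ proj₂ multiple ⟩
  + 27 ℤ.* d              ≡⟨ ℤ.*-comm (+ 27) d ⟩
  d ℤ.* + 27              ∎))
  where
  open ≡-Reasoning
  multiple = v₀-multiple m λ k e → nonsquare (suc (k * 2)) (trans (cong (λ m → 8 * m + 1) e) (sym (odd-square k)))
  d = proj₁ multiple
  expand : ∀ m → 324 * (8 * m + 1) ≡ 2592 * m + 324
  expand = solveℕ-∀

module _ (p : ℕ) (p-prime : Prime p) (3≤p : 3 ≤ p) where
  private
    instance
      p≢0 : NonZero p
      p≢0 = prime⇒nonZero p-prime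

  p∤2 : ¬ p ∣ 2
  p∤2 p∣2 = contradiction (ℕ.≤-trans 3≤p (∣⇒≤ p∣2)) λ { (s≤s (s≤s ())) }

  p-odd : ∃ λ k → p ≡ suc (k * 2)
  p-odd with parity p
  ... | k , inj₂ e = k , e
  ... | k , inj₁ e with prime⇒irreducible p-prime (ℕ.divides k e)
  ...   | inj₂ 2≡p = contradiction (subst (p ∣_) (sym 2≡p) ℕ.∣-refl) p∤2

  p²≡1 : ∃ λ t → p * p ≡ 8 * t + 1
  p²≡1 with k , e ← p-odd = tri k , trans (cong₂ _*_ e e) (odd-square k)

  power-suc : ∀ α → p ^ (2 * suc α) ≡ p * p * p ^ (2 * α)
  power-suc α = trans (cong (p ^_) (ℕ.*-suc 2 α)) (sym (ℕ.*-assoc p p _))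

  p²ᵅ≡1 : ∀ α → ∃ λ t → p ^ (2 * α) ≡ 8 * t + 1
  p²ᵅ≡1 zero = 0 , refl
  p²ᵅ≡1 (suc α) with s , d ← p²≡1 | t , e ← p²ᵅ≡1 α =
    8 * s * t + s + t , trans (power-suc α) (trans (cong₂ _*_ d e) (expand s t))
    where
    expand : ∀ s t → (8 * s + 1) * (8 * t + 1) ≡ 8 * (8 * s * t + s + t) + 1
    expand = solveℕ-∀

  p∣square : ∀ z → p ∣ z * z → ∃ λ w → z ≡ w * p
  p∣square z d with euclidsLemma z z p-prime d
  ... | inj₁ (ℕ.divides w e) = w , e
  ... | inj₂ (ℕ.divides w e) = w , e

  p∣multiple : ∀ α K → p ∣ p ^ (2 * suc α) * K
  p∣multiple α K = ℕ.divides (p * (p ^ (2 * α) * K)) (trans (cong (_* K) (power-suc α)) (regroup p (p ^ (2 * α)) K))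
    where
    regroup : ∀ p u K → p * p * u * K ≡ p * (u * K) * p
    regroup = solveℕ-∀

  -- If p² divides a square z², then p divides z by Euclid's lemma and p² cancels; the even exponent
  -- lets this go on down to K.
  strip-powers : ∀ α {K} z → p ^ (2 * α) * K ≡ z * z → ∃ λ w → K ≡ w * w
  strip-powers zero    {K} z e = z , trans (sym (ℕ.*-identityˡ K)) e
  strip-powers (suc α) {K} z e with w , refl ← p∣square z (subst (p ∣_) e (p∣multiple α K)) =
    strip-powers α w (ℕ.*-cancelˡ-≡ _ _ (p * p) ⦃ ℕ.m*n≢0 p p ⦄
      (trans (sym (ℕ.*-assoc (p * p) (p ^ (2 * α)) K)) (trans (cong (_* K) (sym (power-suc α))) (trans e (square p w)))))
    where
    square : ∀ p w → w * p * (w * p) ≡ p * p * (w * w)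
    square = solveℕ-∀

  vanishes-at : ∀ {N} α r → N ≡ 324 * (p ^ (2 * α) * (8 * r + 1)) → (∀ w → 8 * r + 1 ≢ w * w) → v₀ N ≡ 0ℤ [mod 27 ]
  vanishes-at {N} α r N≡ nonsquare with t , e ← p²ᵅ≡1 α =
    v₀-vanishes (8 * t * r + t + r) (trans N≡ (cong (324 *_) factorisation)) λ z d →
      let w , f = strip-powers α z (trans factorisation d) in nonsquare w f
    where
    expand : ∀ t r → (8 * t + 1) * (8 * r + 1) ≡ 8 * (8 * t * r + t + r) + 1
    expand = solveℕ-∀
    factorisation : p ^ (2 * α) * (8 * r + 1) ≡ 8 * (8 * t * r + t + r) + 1
    factorisation = trans (cong (_* (8 * r + 1)) e) (expand t r)

  part₁ : ∀ n α → ¬ Triangular n → v₀ (p ^ (2 * α) * 9 ^ 2 * (32 * n + 4)) ≡ 0ℤ [mod 27 ]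
  part₁ n α ¬tri = vanishes-at α n (regroup (p ^ (2 * α)) n) λ w e →
    let k , n≡ = square⇒triangular n w e in ¬tri (subst Triangular (sym n≡) (tri-triangular k))
    where
    regroup : ∀ u n → u * 81 * (32 * n + 4) ≡ 324 * (u * (8 * n + 1))
    regroup = solveℕ-∀

  -- The odd power of p leaves K = p (8 (pn + i) + p), which is p² and thus 1 modulo 8. It is not a
  -- square because p divides it exactly once, as p does not divide 8i.
  part₂ : ∀ n α i → 1 ≤ i → i < p →
    v₀ (p ^ (2 * α + 1) * 9 ^ 2 * (32 * p * n + 32 * i + 4 * p)) ≡ 0ℤ [mod 27 ]
  part₂ n α i 1≤i i<p with t , p² ← p²≡1 =
    -- With p² = 8t + 1 this is (K - 1) / 8.
    vanishes-at α (p * (p * n + i) + t)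
      (trans (cong (λ u → u * 9 ^ 2 * (32 * p * n + 32 * i + 4 * p)) (trans (ℕ.^-distribˡ-+-* p (2 * α) 1) (cong (p ^ (2 * α) *_) (ℕ.*-identityʳ p))))
        (trans (regroup (p ^ (2 * α)) p n i) (cong (λ s → 324 * (p ^ (2 * α) * s)) (cofactor p²))))
      λ w e → ¬square w (trans (cofactor p²) e)
    where
    K = p * (8 * (p * n + i) + p)
    regroup : ∀ u p n i → u * p * 81 * (32 * p * n + 32 * i + 4 * p) ≡ 324 * (u * (p * (8 * (p * n + i) + p)))
    regroup = solveℕ-∀
    cofactor : ∀ {t} → p * p ≡ 8 * t + 1 → K ≡ 8 * (p * (p * n + i) + t) + 1
    cofactor {t} p² = trans (expand p (p * n + i)) (trans (cong (_+_ (8 * (p * (p * n + i)))) p²) (collect (p * (p * n + i)) t))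
      where
      expand : ∀ p x → p * (8 * x + p) ≡ 8 * (p * x) + p * p
      expand = solveℕ-∀
      collect : ∀ x t → 8 * x + (8 * t + 1) ≡ 8 * (x + t) + 1
      collect = solveℕ-∀
    p∤i : ¬ p ∣ i
    p∤i p∣i = ℕ.<⇒≱ i<p (∣⇒≤ ⦃ >-nonZero 1≤i ⦄ p∣i)
    p∤8i : ¬ p ∣ 8 * i
    p∤8i d with euclidsLemma 8 i p-prime d
    ... | inj₂ p∣i = p∤i p∣i
    ... | inj₁ p∣8 with euclidsLemma 2 4 p-prime p∣8
    ...   | inj₁ p∣2 = p∤2 p∣2
    ...   | inj₂ p∣4 with euclidsLemma 2 2 p-prime p∣4
    ...     | inj₁ p∣2 = p∤2 p∣2
    ...     | inj₂ p∣2 = p∤2 p∣2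
    ¬square : ∀ w → K ≢ w * w
    ¬square w e with v , refl ← p∣square w (subst (p ∣_) e (m∣m*n _)) =
      p∤8i (∣m+n∣m⇒∣n (subst (p ∣_) (trans (sym reduced) (split p n i)) (m∣m*n (v * v))) (m∣m*n (8 * n + 1)))
      where
      square : ∀ p v → v * p * (v * p) ≡ p * (p * (v * v))
      square = solveℕ-∀
      split : ∀ p n i → 8 * (p * n + i) + p ≡ p * (8 * n + 1) + 8 * i
      split = solveℕ-∀
      reduced : 8 * (p * n + i) + p ≡ p * (v * v)
      reduced = ℕ.*-cancelˡ-≡ _ _ p (trans e (square p v))

  -- 8 (pn + j) + 1 is 8j + 1 modulo p, so a square root of it would make 8j + 1 a quadratic
  -- residue.
  part₃ : ∀ n α j → QuadraticNonresidue (8 * j + 1) p →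
    v₀ (p ^ (2 * α) * 9 ^ 2 * (32 * p * n + 32 * j + 4)) ≡ 0ℤ [mod 27 ]
  part₃ n α j (_ , nonresidue) = vanishes-at α (p * n + j) (regroup (p ^ (2 * α)) p n j) λ w e →
    nonresidue (+ w , ∣⇒∣ᵤ (divides (+ (8 * n)) (begin
      + w ℤ.* + w ℤ.- + (8 * j + 1)                     ≡⟨ cong (ℤ._- + (8 * j + 1)) (trans (sym (ℤ.pos-* w w)) (cong +_ (trans (sym e) (split p n j)))) ⟩
      (+ (8 * n * p) ℤ.+ + (8 * j + 1)) ℤ.- + (8 * j + 1) ≡⟨ ℤ.+-assoc (+ (8 * n * p)) (+ (8 * j + 1)) (ℤ.- + (8 * j + 1)) ⟩
      + (8 * n * p) ℤ.+ (+ (8 * j + 1) ℤ.- + (8 * j + 1)) ≡⟨ cong (ℤ._+_ (+ (8 * n * p))) (ℤ.+-inverseʳ (+ (8 * j + 1))) ⟩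
      + (8 * n * p) ℤ.+ 0ℤ                              ≡⟨ trans (ℤ.+-identityʳ _) (ℤ.pos-* (8 * n) p) ⟩
      + (8 * n) ℤ.* + p                                 ∎)))
    where
    open ≡-Reasoning
    regroup : ∀ u p n j → u * 81 * (32 * p * n + 32 * j + 4) ≡ 324 * (u * (8 * (p * n + j) + 1))
    regroup = solveℕ-∀
    split : ∀ p n j → 8 * (p * n + j) + 1 ≡ 8 * n * p + (8 * j + 1)
    split = solveℕ-∀

theorem5p5 : ∀ (p : ℕ) → Prime p → 3 ≤ p → ∀ (n α : ℕ) →
    (¬ Triangular n →
    v₀ (p ^ (2 * α) * 9 ^ 2 * (32 * n + 4)) ≡ 0ℤ [mod 27 ])
    × (∀ (i : ℕ) → 1 ≤ i → i < p →
    v₀ (p ^ (2 * α + 1) * 9 ^ 2 * (32 * p * n + 32 * i + 4 * p)) ≡ 0ℤ [mod 27 ])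
    × (∀ (j : ℕ) → QuadraticNonresidue (8 * j + 1) p →
    v₀ (p ^ (2 * α) * 9 ^ 2 * (32 * p * n + 32 * j + 4)) ≡ 0ℤ [mod 27 ])
theorem5p5 p p-prime 3≤p n α = part₁ p p-prime 3≤p n α , part₂ p p-prime 3≤p n α , part₃ p p-prime 3≤p n α
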